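{- Let $q$ be a prime power and let $n,k,t,r$ be integers with $0\le r<t$, $k\ge 2$ and $n=kt+r$. Then \[\rho_q(n,t)=q^{t+r}\sum_{i=0}^{k-2}q^{it}+1,\] and if furthermore $1\le r<t$, then \[\sigma_q(n,t)=q^{t+r}\sum_{i=0}^{k-2}q^{it}+q^{\lceil (t+r)/2\rceil}+1.\]
   Context: $V(n,q)$ denotes the $n$-dimensional vector space over the finite field with $q$ elements. A subspace partition of $V=V(n,q)$ is a collection $\Pi$ of subspaces of $V$ such that every $1$-dimensional subspace of $V$ is contained in exactly one member of $\Pi$; its size is the number of its subspaces, $|\Pi|$. $\sigma_q(n,t)$ denotes the minimum size of a subspace partition of $V(n,q)$ in which the largest subspace has dimension $t$, and $\rho_q(n,t)$ denotes the maximum size of a subspace partition of $V(n,q)$ in which the smallest subspace has dimension $t$. -}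

module Defs where

open import Level using (Level; _⊔_)
open import Data.Nat using (ℕ; zero; suc)
import Data.Nat as N
open import Data.Fin using (Fin; zero; suc)
open import Data.Product using (Σ; ∃; _×_; _,_)
open import Relation.Nullary using (¬_)
open import Relation.Binary.PropositionalEquality using (_≡_)
import Relation.Binary.PropositionalEquality as ≡
open import Function.Bundles using (Inverse)
open import Algebra.Bundles using (CommutativeRing)

-- A finite field with exactly q elements: a commutative ring with 0 ≠ 1,
-- in which every nonzero element has a multiplicative inverse, whose
-- carrier (up to the ring's equality) is in bijection with Fin q.
-- (Such a field exists iff q is a prime power, and it is then unique up
-- to isomorphism: it is GF(q).)
record FiniteField (c ℓ : Level) : Set (Level.suc (c ⊔ ℓ)) where
  field
    ring     : CommutativeRing c ℓ
  open CommutativeRing ring using (Carrier; _≈_; _+_; _*_; 0#; 1#; setoid)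
  field
    0≉1      : ¬ (0# ≈ 1#)
    inverse  : ∀ x → ¬ (x ≈ 0#) → Σ Carrier λ y → (x * y) ≈ 1#
    q        : ℕ
    enumerate : Inverse (≡.setoid (Fin q)) setoid

module VectorSpace {c ℓ : Level} (F : FiniteField c ℓ) where
  open FiniteField F
  open CommutativeRing ring using (Carrier; _≈_; _+_; _*_; 0#; 1#; setoid)

  Vec : ℕ → Set c
  Vec n = Fin n → Carrier

  _≈ᵛ_ : ∀ {n} → Vec n → Vec n → Set ℓ
  u ≈ᵛ v = ∀ i → u i ≈ v i

  NonZeroVec : ∀ {n} → Vec n → Set ℓ
  NonZeroVec v = ¬ (∀ i → v i ≈ 0#)

  ∑ : ∀ {d} → (Fin d → Carrier) → Carrier
  ∑ {zero}  f = 0#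
  ∑ {suc d} f = f zero + ∑ (λ j → f (suc j))

  lincomb : ∀ {d n} → (Fin d → Carrier) → (Fin d → Vec n) → Vec n
  lincomb cs bs i = ∑ (λ j → cs j * bs j i)

  LinIndep : ∀ {d n} → (Fin d → Vec n) → Set (c ⊔ ℓ)
  LinIndep {d} {n} bs =
    ∀ (cs : Fin d → Carrier) → (∀ i → lincomb cs bs i ≈ 0#) → ∀ j → cs j ≈ 0#

  record Subspace (n : ℕ) : Set (c ⊔ ℓ) where
    field
      dim   : ℕ
      basis : Fin dim → Vec n
      indep : LinIndep basis

  open Subspace public

  _∈ˢ_ : ∀ {n} → Vec n → Subspace n → Set (c ⊔ ℓ)
  v ∈ˢ W = Σ (Fin (dim W) → Carrier) λ cs → v ≈ᵛ lincomb cs (basis W)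

  -- A subspace partition of V(n,q): a finite collection of nonzero
  -- subspaces such that every 1-dimensional subspace <v> (v ≠ 0) is
  -- contained in exactly one member (<v> ⊆ W iff v ∈ W).
  record SubspacePartition (n : ℕ) : Set (c ⊔ ℓ) where
    field
      size    : ℕ
      part    : Fin size → Subspace n
      nonzero : ∀ i → 1 N.≤ dim (part i)
      cover   : ∀ (v : Vec n) → NonZeroVec v →
                Σ (Fin size) λ i → (v ∈ˢ part i) × (∀ j → v ∈ˢ part j → j ≡ i)

  open SubspacePartition public

  MinDim : ∀ {n} → SubspacePartition n → ℕ → Set
  MinDim Π t = (∀ i → t N.≤ dim (part Π i)) × Σ (Fin (size Π)) λ i → dim (part Π i) ≡ t

  MaxDim : ∀ {n} → SubspacePartition n → ℕ → Set
  MaxDim Π t = (∀ i → dim (part Π i) N.≤ t) × Σ (Fin (size Π)) λ i → dim (part Π i) ≡ t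

  IsRho : ℕ → ℕ → ℕ → Set (c ⊔ ℓ)
  IsRho n t m = (Σ (SubspacePartition n) λ Π → MinDim Π t × size Π ≡ m)
              × (∀ (Π : SubspacePartition n) → MinDim Π t → size Π N.≤ m)

  IsSigma : ℕ → ℕ → ℕ → Set (c ⊔ ℓ)
  IsSigma n t m = (Σ (SubspacePartition n) λ Π → MaxDim Π t × size Π ≡ m)
                × (∀ (Π : SubspacePartition n) → MaxDim Π t → m N.≤ size Π)

open N using (_+_; _*_; _^_; _∸_; ⌈_/2⌉)

sumRange : ℕ → (ℕ → ℕ) → ℕ
sumRange zero    f = 0
sumRange (suc m) f = sumRange m f + f m

rhoValue : ℕ → ℕ → ℕ → ℕ → ℕ
rhoValue q k t r = q ^ (t + r) * sumRange (k ∸ 1) (λ i → q ^ (i * t)) + 1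

sigmaValue : ℕ → ℕ → ℕ → ℕ → ℕ
sigmaValue q k t r =
  q ^ (t + r) * sumRange (k ∸ 1) (λ i → q ^ (i * t)) + q ^ ⌈ t + r /2⌉ + 1

{-# OPTIONS --safe #-}
-- Constructions. For b ≤ a, multiplication of polynomials modulo an irreducible polynomial of
-- degree a gives a bilinear map F^a × F^b → F^a without zero divisors, so the graphs
-- {(x , α x)}, α ∈ F^a, cover each vector of F^b × F^a outside 0 × F^a exactly once. Adding them to
-- a partition of F^a gives one of F^(a+b) with q^a more members, all of dimension b. Starting from
-- F^(t+r) itself (for ρ), or from its splitting with a = ⌈(t+r)/2⌉ and b = ⌊(t+r)/2⌋ (for σ), this
-- is repeated with b = t. An irreducible polynomial of each degree exists by Gauss's count, obtained
-- by summing deg f = ∑ deg p, over the prime powers p^k ∣ f, over all monic f of a given degree.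
--
-- Bounds. Counting vectors in a hyperplane H shows |Π| = 1 + ∑ q^(dim W) over the members W ⊆ H.
-- If all dimensions are at least t, then q^t divides |Π| − 1, and comparison with the volume
-- ∑ (q^(dim W) − 1) = q^n − 1 gives the upper bound for ρ. For σ write
-- |Π| = 1 + q^(t+r) ∑ q^(it) + δ and suppose δ < q^⌈(t+r)/2⌉ ≤ q^t. The tail sum f(H), over the
-- W ⊆ H with dim W < t, is ≡ δ mod q^t, hence at least δ. Let U have the largest dimension u in the
-- tail. Averaging f over the hyperplanes not containing U shows that the tail has more than δ
-- members; if δ < q^u, then f ≥ δ + q^t on the hyperplanes containing U, and averaging over these
-- gives still more members. Either way the volume of the tail contradicts the choice of δ.
module Submission where

open import Defs
open import Level using (Level) renaming (_⊔_ to _⊔ˡ_)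
open import Algebra.Bundles using (CommutativeRing)
open import Data.Empty using (⊥; ⊥-elim)
open import Data.Fin using (Fin; zero; suc; toℕ; fromℕ<; combine; finToFun; funToFin; splitAt; _↑ˡ_; _↑ʳ_; punchOut)
import Data.Fin.Properties as Fin
open import Data.List using (List; []; _∷_)
import Data.Nat as ℕ
open import Data.Nat hiding (_≟_)
open import Data.Nat.Induction using (<-rec)
import Data.Nat.Properties as ℕ
open import Data.Nat.Properties hiding (_≟_)
open import Data.Nat.Solver using (module +-*-Solver)
open import Data.Product using (Σ; ∃; ∃₂; _×_; _,_; proj₁; proj₂)
open import Data.Sum using (_⊎_; inj₁; inj₂; [_,_]′)
open import Function using (_∘_)
open import Function.Bundles using (Inverse)
open import Relation.Binary.Bundles using (Setoid)
open import Relation.Binary.PropositionalEquality hiding (J)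
open import Relation.Binary.Structures using (IsEquivalence)
open import Relation.Nullary using (¬_; Dec; yes; no; contradiction)
open import Relation.Nullary.Decidable using (map′; _×-dec_; ¬?)

-- A hyperplane is represented by a functional `φ : Vec n`. The zero functional is kept, so that
-- averages run over the whole of `Vec n`: its sum is larger by q^n, which is invisible modulo q^t.
-- The averages are exact for two reasons. The weight q^(dim W) offsets the proportion q^(-dim W) of
-- functionals vanishing on W; and distinct members meet only in 0, so vanishing on one and
-- vanishing on another are independent conditions.
--
-- The exponent ⌈(t+r)/2⌉ comes from the case q^(dim U) ≤ δ, where the volume is contradictory once
-- δ < q^(t+r-dim U). Under the assumption δ < q^c this case has dim U < c, so it is enough that m <
-- c implies c + m ≤ t + r, and ⌈(t+r)/2⌉ is the largest such c.
--
-- All counts are natural numbers. Identities with differences are therefore stated with the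
-- negative terms moved to the other side, and quantities such as Q - u enter as witnesses of
-- inequalities.

-- Finite sums of natural numbers and indicators

module FiniteSums where

  open import Algebra.Properties.CommutativeSemigroup +-commutativeSemigroup using (interchange)

  private variable
    a b : Level
    A : Set a
    B : Set b
    n : ℕ

  𝟙 : Dec A → ℕ
  𝟙 (yes _) = 1
  𝟙 (no _)  = 0

  𝟙-yes : (d : Dec A) → A → 𝟙 d ≡ 1
  𝟙-yes (yes _) _ = refl
  𝟙-yes (no ¬x) x = contradiction x ¬x

  𝟙-no : (d : Dec A) → ¬ A → 𝟙 d ≡ 0
  𝟙-no (yes x) ¬x = contradiction x ¬x
  𝟙-no (no _)  _  = refl

  𝟙-cong : (d : Dec A) (e : Dec B) → (A → B) → (B → A) → 𝟙 d ≡ 𝟙 e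
  𝟙-cong (yes x) e f g = sym (𝟙-yes e (f x))
  𝟙-cong (no ¬x) e f g = sym (𝟙-no e (¬x ∘ g))

  opaque
    sum : (Fin n → ℕ) → ℕ
    sum {zero}  f = 0
    sum {suc n} f = f zero + sum (f ∘ suc)

    sum-cong : {f g : Fin n → ℕ} → (∀ i → f i ≡ g i) → sum f ≡ sum g
    sum-cong {zero}  f≡g = refl
    sum-cong {suc n} f≡g = cong₂ _+_ (f≡g zero) (sum-cong (f≡g ∘ suc))

    sum-+ : (f g : Fin n → ℕ) → sum (λ i → f i + g i) ≡ sum f + sum g
    sum-+ {zero}  f g = refl
    sum-+ {suc n} f g = trans (cong (f zero + g zero +_) (sum-+ (f ∘ suc) (g ∘ suc)))
                              (interchange (f zero) (g zero) _ _)

    sum-*ˡ : ∀ c (f : Fin n → ℕ) → sum (λ i → c * f i) ≡ c * sum f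
    sum-*ˡ {zero}  c f = sym (*-zeroʳ c)
    sum-*ˡ {suc n} c f = trans (cong (c * f zero +_) (sum-*ˡ c (f ∘ suc)))
                               (sym (*-distribˡ-+ c (f zero) _))

    sum-*ʳ : ∀ c (f : Fin n → ℕ) → sum (λ i → f i * c) ≡ sum f * c
    sum-*ʳ c f = trans (sum-cong (λ i → *-comm (f i) c)) (trans (sum-*ˡ c f) (*-comm c _))

    sum-const : ∀ n c → sum {n} (λ _ → c) ≡ n * c
    sum-const zero    c = refl
    sum-const (suc n) c = cong (c +_) (sum-const n c)

    sum-swap : ∀ {m} (f : Fin m → Fin n → ℕ) →
               sum (λ i → sum (f i)) ≡ sum (λ j → sum (λ i → f i j))
    sum-swap {n = n} {zero}  f = sym (trans (sum-const n 0) (*-zeroʳ n))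
    sum-swap {n = n} {suc m} f = trans (cong (sum (f zero) +_) (sum-swap (f ∘ suc)))
                               (sym (sum-+ (f zero) _))

    sum-mono-≤ : {f g : Fin n → ℕ} → (∀ i → f i ≤ g i) → sum f ≤ sum g
    sum-mono-≤ {zero}  f≤g = z≤n
    sum-mono-≤ {suc n} f≤g = +-mono-≤ (f≤g zero) (sum-mono-≤ (f≤g ∘ suc))

    term≤sum : (f : Fin n → ℕ) → ∀ i → f i ≤ sum f
    term≤sum f zero    = m≤m+n _ _
    term≤sum f (suc i) = ≤-trans (term≤sum (f ∘ suc) i) (m≤n+m _ (f zero))

    sum-none : ∀ {p} {P : Fin n → Set p} (P? : ∀ i → Dec (P i)) (g : Fin n → ℕ) →
               (∀ i → ¬ P i) → sum (λ i → 𝟙 (P? i) * g i) ≡ 0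
    sum-none {n = n} P? g none =
      trans (sum-cong (λ i → cong (_* g i) (𝟙-no (P? i) (none i))))
            (trans (sum-const n 0) (*-zeroʳ n))

    sum-single : (f : Fin n → ℕ) → ∀ i → (∀ j → j ≢ i → f j ≡ 0) → sum f ≡ f i
    sum-single {suc n} f zero others =
      trans (cong (f zero +_) (trans (sum-cong {f = f ∘ suc} {λ _ → 0} (λ j → others (suc j) λ ()))
                                     (trans (sum-const n 0) (*-zeroʳ n))))
            (+-identityʳ _)
    sum-single {suc n} f (suc i) others =
      cong₂ _+_ (others zero λ ())
                (sum-single (f ∘ suc) i (λ j j≢i → others (suc j) (j≢i ∘ Fin.suc-injective)))

  sum-unique : ∀ {p} {P : Fin n → Set p} (P? : ∀ i → Dec (P i)) (g : Fin n → ℕ) →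
               ∀ i → P i → (∀ j → P j → j ≡ i) → sum (λ j → 𝟙 (P? j) * g j) ≡ g i
  sum-unique P? g i Pi uniq =
    trans (sum-single (λ j → 𝟙 (P? j) * g j) i (λ j j≢i → cong (_* g j) (𝟙-no (P? j) (j≢i ∘ uniq j))))
          (trans (cong (_* g i) (𝟙-yes (P? i) Pi)) (*-identityˡ _))

  count-none : ∀ {p} {P : Fin n → Set p} (P? : ∀ i → Dec (P i)) →
               (∀ i → ¬ P i) → sum (λ i → 𝟙 (P? i)) ≡ 0
  count-none P? none = trans (sum-cong (λ i → sym (*-identityʳ _))) (sum-none P? (λ _ → 1) none)

  count-unique : ∀ {p} {P : Fin n → Set p} (P? : ∀ i → Dec (P i)) →
                 ∀ i → P i → (∀ j → P j → j ≡ i) → sum (λ j → 𝟙 (P? j)) ≡ 1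
  count-unique P? i Pi uniq =
    trans (sum-cong (λ i → sym (*-identityʳ _))) (sum-unique P? (λ _ → 1) i Pi uniq)

  -- Inserting the indicator of `j = to i` turns either side into the same double sum over the graph
  -- of the bijection.
  sum-bijection : ∀ {m} (to : Fin m → Fin n) (from : Fin n → Fin m) →
                  (∀ j → to (from j) ≡ j) → (∀ i → from (to i) ≡ i) →
                  (g : Fin n → ℕ) → sum (g ∘ to) ≡ sum g
  sum-bijection to from to-from from-to g = begin
    sum (g ∘ to)
      ≡⟨ sum-cong (λ i → sym (sum-unique (λ j → j Fin.≟ to i) g (to i) refl (λ _ j≡ → j≡))) ⟩
    sum (λ i → sum (λ j → 𝟙 (j Fin.≟ to i) * g j))
      ≡⟨ sum-swap (λ i j → 𝟙 (j Fin.≟ to i) * g j) ⟩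
    sum (λ j → sum (λ i → 𝟙 (j Fin.≟ to i) * g j))
      ≡⟨ sum-cong (λ j → sum-unique (λ i → j Fin.≟ to i) (λ _ → g j) (from j) (sym (to-from j))
           (λ i j≡ → trans (sym (from-to i)) (cong from (sym j≡)))) ⟩
    sum g ∎
    where open ≡-Reasoning

  sumRange-cong : ∀ m {f g : ℕ → ℕ} → (∀ k → k < m → f k ≡ g k) → sumRange m f ≡ sumRange m g
  sumRange-cong zero    f≡g = refl
  sumRange-cong (suc m) f≡g = cong₂ _+_ (sumRange-cong m (λ k k<m → f≡g k (m<n⇒m<1+n k<m))) (f≡g m ≤-refl)

  sumRange-const : ∀ m x → sumRange m (λ _ → x) ≡ m * x
  sumRange-const zero    x = refl
  sumRange-const (suc m) x = trans (cong (_+ x) (sumRange-const m x)) (+-comm (m * x) x)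

  sumRange-none : ∀ m {f} → (∀ k → k < m → f k ≡ 0) → sumRange m f ≡ 0
  sumRange-none m f≡0 = trans (sumRange-cong m f≡0) (trans (sumRange-const m 0) (*-zeroʳ m))

  sumRange-+ : ∀ m f g → sumRange m (λ k → f k + g k) ≡ sumRange m f + sumRange m g
  sumRange-+ zero    f g = refl
  sumRange-+ (suc m) f g = trans (cong (_+ (f m + g m)) (sumRange-+ m f g)) (interchange (sumRange m f) (sumRange m g) (f m) (g m))

  sumRange-*ˡ : ∀ x m f → sumRange m (λ k → x * f k) ≡ x * sumRange m f
  sumRange-*ˡ x zero    f = sym (*-zeroʳ x)
  sumRange-*ˡ x (suc m) f = trans (cong (_+ x * f m) (sumRange-*ˡ x m f)) (sym (*-distribˡ-+ x _ (f m)))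

  sumRange-mono-≤ : ∀ m {f g : ℕ → ℕ} → (∀ k → k < m → f k ≤ g k) → sumRange m f ≤ sumRange m g
  sumRange-mono-≤ zero    f≤g = z≤n
  sumRange-mono-≤ (suc m) f≤g = +-mono-≤ (sumRange-mono-≤ m (λ k k<m → f≤g k (m<n⇒m<1+n k<m))) (f≤g m ≤-refl)

  sumRange-front : ∀ m f → sumRange (suc m) f ≡ f 0 + sumRange m (f ∘ suc)
  sumRange-front zero    f = sym (+-identityʳ (f 0))
  sumRange-front (suc m) f = trans (cong (_+ f (suc m)) (sumRange-front m f)) (+-assoc (f 0) _ _)

  sumRange-single : ∀ m {f} i → i < m → (∀ k → k < m → k ≢ i → f k ≡ 0) → sumRange m f ≡ f i
  sumRange-single (suc m) {f} i i<1+m others with i ℕ.≟ m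
  ... | yes refl = cong (_+ f m) (sumRange-none m (λ k k<m → others k (m<n⇒m<1+n k<m) (<⇒≢ k<m)))
  ... | no  i≢m  = trans
    (cong₂ _+_ (sumRange-single m i (≤∧≢⇒< (s≤s⁻¹ i<1+m) i≢m) (λ k k<m → others k (m<n⇒m<1+n k<m)))
               (others m ≤-refl (i≢m ∘ sym)))
    (+-identityʳ _)

  sumRange-sum : ∀ m (f : ℕ → Fin n → ℕ) → sum (λ i → sumRange m (λ k → f k i)) ≡ sumRange m (λ k → sum (f k))
  sumRange-sum {n} zero    f = trans (sum-const n 0) (*-zeroʳ n)
  sumRange-sum {n} (suc m) f = trans (sum-+ (λ i → sumRange m (λ k → f k i)) (f m)) (cong (_+ sum (f m)) (sumRange-sum m f))

  term≤sumRange : ∀ m f {k} → k < m → f k ≤ sumRange m f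
  term≤sumRange (suc m) f {k} k<1+m with k ℕ.≟ m
  ... | yes refl = m≤n+m (f k) _
  ... | no  k≢m  = ≤-trans (term≤sumRange m f (≤∧≢⇒< (s≤s⁻¹ k<1+m) k≢m)) (m≤m+n _ (f m))

open FiniteSums

-- Numerical inequalities behind the two bounds

module Arithmetic where

  -- The dimension is (k+1)t + r: here and in Bounds, k stands for the k − 1 of the theorem.
  power-identity : ∀ q k t r → q ^ (suc k * t + r) + q ^ t * (q ^ r * sumRange k (λ i → q ^ (i * t)))
                               ≡ q ^ t * (q ^ t * (q ^ r * sumRange k (λ i → q ^ (i * t))) + q ^ r)
  power-identity q k t r = begin
    q ^ (suc k * t + r) + Q * (ρ * M)
      ≡⟨ cong (_+ Q * (ρ * M)) (trans (^-distribˡ-+-* q (suc k * t) r) (cong (_* ρ) (^-distribˡ-+-* q t (k * t)))) ⟩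
    Q * X * ρ + Q * (ρ * M)
      ≡⟨ solve 4 (λ Q X ρ M → Q :* X :* ρ :+ Q :* (ρ :* M) := Q :* (ρ :* (X :+ M))) refl Q X ρ M ⟩
    Q * (ρ * (X + M))
      ≡⟨ cong (λ a → Q * (ρ * a)) (geometric k) ⟩
    Q * (ρ * (Q * M + 1))
      ≡⟨ solve 3 (λ Q ρ M → Q :* (ρ :* (Q :* M :+ con 1)) := Q :* (Q :* (ρ :* M) :+ ρ)) refl Q ρ M ⟩
    Q * (Q * (ρ * M) + ρ) ∎
    where
    open ≡-Reasoning
    open +-*-Solver
    Q = q ^ t
    ρ = q ^ r
    X = q ^ (k * t)
    M = sumRange k (λ i → q ^ (i * t))
    geometric : ∀ k → q ^ (k * t) + sumRange k (λ i → q ^ (i * t)) ≡ q ^ t * sumRange k (λ i → q ^ (i * t)) + 1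
    geometric zero    = sym (cong (_+ 1) (*-zeroʳ (q ^ t)))
    geometric (suc k) = begin
      q ^ (t + k * t) + (M′ + q ^ (k * t))         ≡⟨ cong₂ _+_ (^-distribˡ-+-* q t (k * t)) (trans (+-comm M′ _) (geometric k)) ⟩
      q ^ t * q ^ (k * t) + (q ^ t * M′ + 1)       ≡⟨ solve 3 (λ Q X M → Q :* X :+ (Q :* M :+ con 1) := Q :* (M :+ X) :+ con 1) refl (q ^ t) (q ^ (k * t)) M′ ⟩
      q ^ t * (M′ + q ^ (k * t)) + 1               ∎
      where M′ = sumRange k (λ i → q ^ (i * t))

  -- f ≡ δ mod Q with 0 ≤ δ < Q.
  residue-≤ : ∀ Q f c δ k → δ < Q → f + Q * c ≡ δ + Q * k → δ ≤ f
  residue-≤ Q f c δ k δ<Q e with ≤-total c k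
  ... | inj₁ c≤k = +-cancelʳ-≤ (Q * c) δ f (≤-trans (+-monoʳ-≤ δ (*-monoʳ-≤ Q c≤k)) (≤-reflexive (sym e)))
  ... | inj₂ k≤c with m≤n⇒m<n∨m≡n k≤c
  ...   | inj₂ refl = ≤-reflexive (sym (+-cancelʳ-≡ (Q * c) f δ e))
  ...   | inj₁ k<c  = contradiction (begin-strict
    δ + Q * k     <⟨ +-monoˡ-< (Q * k) δ<Q ⟩
    Q + Q * k     ≡⟨ *-suc Q k ⟨
    Q * suc k     ≤⟨ *-monoʳ-≤ Q k<c ⟩
    Q * c         ≤⟨ m≤n+m (Q * c) f ⟩
    f + Q * c     ≡⟨ e ⟩
    δ + Q * k     ∎) (<-irrefl refl)
    where open ≤-Reasoning

  -- f and δ are congruent modulo Q, so f > δ forces `c < k`, and the gap contains at least one full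
  -- Q.
  residue-next : ∀ Q f c δ k → f + Q * c ≡ δ + Q * k → δ < f → δ + Q ≤ f
  residue-next Q f c δ k e δ<f = +-cancelʳ-≤ (Q * c) (δ + Q) f (begin
    δ + Q + Q * c    ≡⟨ +-assoc δ Q (Q * c) ⟩
    δ + (Q + Q * c)  ≡⟨ cong (δ +_) (*-suc Q c) ⟨
    δ + Q * suc c    ≤⟨ +-monoʳ-≤ δ (*-monoʳ-≤ Q c<k) ⟩
    δ + Q * k        ≡⟨ e ⟨
    f + Q * c        ∎)
    where
    open ≤-Reasoning
    c<k : c < k
    c<k = ≰⇒> λ k≤c → <-irrefl (sym e) (+-mono-<-≤ δ<f (*-monoʳ-≤ Q k≤c))

  -- In the lower bound, Q = q^t, ρ = q^r, the partition has 1 + Qρ ∑_{i<k} q^{it} + δ members, and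
  -- T of them form the tail (dimension less than t); S is the sum of q^dim over the tail and u is
  -- q^dim for the largest member of the tail.
  tail-too-short : ∀ {Q ρ T δ u S} → S + Q + Q * δ ≡ δ + Q * ρ + Q * T → S ≤ u * T →
                   1 ≤ ρ → 1 ≤ u → 2 * u ≤ Q → δ < u → ¬ (δ + Q + 1 ≤ T + u)
  tail-too-short {Q} {ρ} {T} {δ} {u} {S} star S≤ 1≤ρ 1≤u 2u≤Q δ<u B
    -- With Q = u + w the hypothesis 2u ≤ Q reads u ≤ w; it remains to show w = 0, against 1 ≤ u.
    with m≤n⇒∃[o]m+o≡n (≤-trans (m≤m+n u (u + 0)) 2u≤Q)
  ... | w , refl = contradiction (≤-trans 1≤u u≤w) (<⇒≱ (s≤s w≤0))
    where
    open ≤-Reasoning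
    open +-*-Solver
    u≤w : u ≤ w
    u≤w = +-cancelˡ-≤ u u w (≤-trans (≤-reflexive (cong (u +_) (sym (+-identityʳ u)))) 2u≤Q)
    T-bound : δ + w + 1 ≤ T
    T-bound = +-cancelʳ-≤ u _ _ (≤-trans (≤-reflexive
      (solve 3 (λ δ u w → δ :+ w :+ con 1 :+ u := δ :+ (u :+ w) :+ con 1) refl δ u w)) B)
    -- This is `star` with S bounded by uT and ρ by 1.
    wT-bound : w * T + δ ≤ u * δ + w * δ
    wT-bound = +-cancelʳ-≤ (u * T + (u + w)) _ _ (begin
      w * T + δ + (u * T + (u + w))
        ≡⟨ solve 4 (λ u w T δ → w :* T :+ δ :+ (u :* T :+ (u :+ w)) := δ :+ (u :+ w) :* con 1 :+ (u :+ w) :* T) refl u w T δ ⟩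
      δ + (u + w) * 1 + (u + w) * T
        ≤⟨ +-monoˡ-≤ ((u + w) * T) (+-monoʳ-≤ δ (*-monoʳ-≤ (u + w) 1≤ρ)) ⟩
      δ + (u + w) * ρ + (u + w) * T
        ≡⟨ star ⟨
      S + (u + w) + (u + w) * δ
        ≤⟨ +-monoˡ-≤ ((u + w) * δ) (+-monoˡ-≤ (u + w) S≤) ⟩
      u * T + (u + w) + (u + w) * δ
        ≡⟨ solve 4 (λ u w T δ → u :* T :+ (u :+ w) :+ (u :+ w) :* δ := u :* δ :+ w :* δ :+ (u :* T :+ (u :+ w))) refl u w T δ ⟩
      u * δ + w * δ + (u * T + (u + w)) ∎)
    -- Inserting T ≥ δ + w + 1 leaves w² + w + δ ≤ uδ, whereas uδ ≤ w² because u and δ are both at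
    -- most w.
    w≤0 : w ≤ 0
    w≤0 = ≤-trans (m≤m+n w δ) (+-cancelʳ-≤ (w * w + w * δ) _ _ (begin
      w + δ + (w * w + w * δ)
        ≡⟨ solve 2 (λ w δ → w :+ δ :+ (w :* w :+ w :* δ) := w :* (δ :+ w :+ con 1) :+ δ) refl w δ ⟩
      w * (δ + w + 1) + δ
        ≤⟨ +-monoˡ-≤ δ (*-monoʳ-≤ w T-bound) ⟩
      w * T + δ
        ≤⟨ wT-bound ⟩
      u * δ + w * δ
        ≤⟨ +-monoˡ-≤ (w * δ) (*-mono-≤ u≤w (≤-trans (<⇒≤ δ<u) u≤w)) ⟩
      w * w + w * δ ∎))

  -- For T = δ + 1 + x, `star` says S = δ + Qρ + Qx. But S ≤ u(1 + δ) + ux ≤ uv + Qx = Qρ + Qx,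
  -- which leaves no room for δ ≥ 1.
  tail-too-thin : ∀ {Q ρ T δ u v S} → S + Q + Q * δ ≡ δ + Q * ρ + Q * T → S ≤ u * T →
                  Q * ρ ≡ u * v → u ≤ Q → 1 ≤ δ → δ < v → ¬ (δ + 1 ≤ T)
  tail-too-thin {Q} {ρ} {T} {δ} {u} {v} {S} star S≤ Qρ≡uv u≤Q 1≤δ δ<v A
    with m≤n⇒∃[o]m+o≡n A
  ... | x , refl = contradiction 1≤δ (<⇒≱ (s≤s δ≤0))
    where
    open ≤-Reasoning
    open +-*-Solver
    δ≤0 : δ ≤ 0
    δ≤0 = +-cancelʳ-≤ (u * v + Q * x + (Q + Q * δ)) _ _ (begin
      δ + (u * v + Q * x + (Q + Q * δ))
        ≡⟨ solve 4 (λ Q δ x y → δ :+ (y :+ Q :* x :+ (Q :+ Q :* δ)) := δ :+ y :+ Q :* (δ :+ con 1 :+ x)) refl Q δ x (u * v) ⟩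
      δ + u * v + Q * (δ + 1 + x)
        ≡⟨ cong (λ a → δ + a + Q * (δ + 1 + x)) Qρ≡uv ⟨
      δ + Q * ρ + Q * (δ + 1 + x)
        ≡⟨ star ⟨
      S + Q + Q * δ
        ≤⟨ +-monoˡ-≤ (Q * δ) (+-monoˡ-≤ Q S≤) ⟩
      u * (δ + 1 + x) + Q + Q * δ
        ≡⟨ solve 4 (λ Q δ x u → u :* (δ :+ con 1 :+ x) :+ Q :+ Q :* δ := u :* (con 1 :+ δ) :+ u :* x :+ (Q :+ Q :* δ)) refl Q δ x u ⟩
      u * (1 + δ) + u * x + (Q + Q * δ)
        ≤⟨ +-monoˡ-≤ (Q + Q * δ) (+-mono-≤ (*-monoʳ-≤ u δ<v) (*-monoˡ-≤ x u≤Q)) ⟩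
      u * v + Q * x + (Q + Q * δ) ∎)

  -- The volume gives (Q - 1)N ≥ q^n - 1 = (Q - 1)QR + (Qρ - 1), and the last bracket is positive.
  -- Consequently the excess δ in N = 1 + QR + δ is a natural number.
  volume-lower : ∀ {Q ρ R N q^n} → q^n + Q * R ≡ Q * (Q * R + ρ) → N + q^n ≤ Q * N + 1 → 1 ≤ Q → 2 ≤ Q * ρ → Q * R < N
  volume-lower {Q} {ρ} {R} {N} {q^n} power vol 1≤Q 2≤Qρ = ≰⇒> λ N≤QR → too-small (m≤n⇒∃[o]m+o≡n N≤QR)
    where
    open ≤-Reasoning
    open +-*-Solver
    too-small : ∃ (λ y → N + y ≡ Q * R) → ⊥
    too-small (y , e) = contradiction 2≤Qρ (<⇒≱ (s≤s (+-cancelʳ-≤ (y + (N + Q * N)) _ _ (begin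
      Q * ρ + (y + (N + Q * N))
        ≤⟨ +-monoʳ-≤ (Q * ρ) (+-monoˡ-≤ (N + Q * N) (≤-trans (≤-reflexive (sym (*-identityˡ y))) (*-monoˡ-≤ y 1≤Q))) ⟩
      Q * ρ + (Q * y + (N + Q * N))
        ≡⟨ solve 4 (λ Q ρ y N → Q :* ρ :+ (Q :* y :+ (N :+ Q :* N)) := N :+ Q :* ((N :+ y) :+ ρ)) refl Q ρ y N ⟩
      N + Q * ((N + y) + ρ)
        ≡⟨ cong (λ a → N + Q * (a + ρ)) e ⟩
      N + Q * (Q * R + ρ)
        ≡⟨ cong (N +_) power ⟨
      N + (q^n + Q * R)
        ≡⟨ +-assoc N q^n (Q * R) ⟨
      N + q^n + Q * R
        ≤⟨ +-monoˡ-≤ (Q * R) vol ⟩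
      Q * N + 1 + Q * R
        ≡⟨ cong (Q * N + 1 +_) e ⟨
      Q * N + 1 + (N + y)
        ≡⟨ solve 3 (λ Q y N → Q :* N :+ con 1 :+ (N :+ y) := con 1 :+ (y :+ (N :+ Q :* N))) refl Q y N ⟩
      1 + (y + (N + Q * N)) ∎))))

open Arithmetic

-- Linear algebra over the finite field and sums over all vectors

module Vectors {c ℓ : Level} (F : FiniteField c ℓ) where

  open FiniteField F public
  open VectorSpace F public
  module R = CommutativeRing ring
  open R public using (Carrier; _≈_; 0#; 1#) renaming (_+_ to _+ᶠ_; _*_ to _*ᶠ_; -_ to -ᶠ_)
  open Inverse enumerate public using (to; from; from-cong)
  open import Algebra.Properties.Ring R.ring public
    using (-1*x≈-x)
  open import Algebra.Properties.AbelianGroup R.+-abelianGroup public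
    using () renaming (∙-cancelˡ to +ᶠ-cancelˡ; x∙y⁻¹≈ε⇒x≈y to x-y≈0⇒x≈y;
                       inverseˡ-unique to -ᶠ-unique)
  open import Algebra.Properties.CommutativeSemigroup
    (CommutativeRing.+-commutativeSemigroup ring) public
    using () renaming (interchange to +ᶠ-interchange)
  module ≈-Reasoning where
    open import Relation.Binary.Reasoning.Setoid R.setoid public

  infix 4 _≟_ _≟ᵛ_

  to-from : ∀ x → to (from x) ≈ x
  to-from x = Inverse.inverseˡ enumerate refl

  from-to : ∀ i → from (to i) ≡ i
  from-to i = Inverse.inverseʳ enumerate R.refl

  from-injective : ∀ {x y} → from x ≡ from y → x ≈ y
  from-injective {x} {y} e = R.trans (R.sym (to-from x)) (R.trans (R.reflexive (cong to e)) (to-from y))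

  _≟_ : ∀ x y → Dec (x ≈ y)
  x ≟ y = map′ from-injective from-cong (from x Fin.≟ from y)

  2≤q : 2 ≤ q
  2≤q = distinct⇒2≤ (from 0#) (from 1#) (0≉1 ∘ from-injective)
    where
    distinct⇒2≤ : ∀ {n} (i j : Fin n) → i ≢ j → 2 ≤ n
    distinct⇒2≤ {suc zero}    zero zero i≢j = contradiction refl i≢j
    distinct⇒2≤ {suc (suc n)} i    j    i≢j = s≤s (s≤s z≤n)

  instance
    q≢0 : NonZero q
    q≢0 = >-nonZero (≤-trans (s≤s z≤n) 2≤q)

  ∑-cong : ∀ {d} {f g : Fin d → Carrier} → (∀ i → f i ≈ g i) → ∑ f ≈ ∑ g
  ∑-cong {zero}  f≈g = R.refl
  ∑-cong {suc d} f≈g = R.+-cong (f≈g zero) (∑-cong (f≈g ∘ suc))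

  ∑-zero : ∀ {d} {f : Fin d → Carrier} → (∀ i → f i ≈ 0#) → ∑ f ≈ 0#
  ∑-zero {zero}  f≈0 = R.refl
  ∑-zero {suc d} f≈0 = R.trans (R.+-cong (f≈0 zero) (∑-zero (f≈0 ∘ suc))) (R.+-identityˡ 0#)

  ∑-+ : ∀ {d} (f g : Fin d → Carrier) → ∑ (λ i → f i +ᶠ g i) ≈ ∑ f +ᶠ ∑ g
  ∑-+ {zero}  f g = R.sym (R.+-identityˡ 0#)
  ∑-+ {suc d} f g = R.trans (R.+-congˡ (∑-+ (f ∘ suc) (g ∘ suc))) (+ᶠ-interchange _ _ _ _)

  ∑-*ˡ : ∀ {d} x (f : Fin d → Carrier) → ∑ (λ i → x *ᶠ f i) ≈ x *ᶠ ∑ f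
  ∑-*ˡ {zero}  x f = R.sym (R.zeroʳ x)
  ∑-*ˡ {suc d} x f = R.trans (R.+-congˡ (∑-*ˡ x (f ∘ suc))) (R.sym (R.distribˡ x _ _))

  ∑-swap : ∀ {d e} (f : Fin d → Fin e → Carrier) → ∑ (λ i → ∑ (f i)) ≈ ∑ (λ j → ∑ (λ i → f i j))
  ∑-swap {zero}  {e} f = R.sym (∑-zero {e} (λ _ → R.refl))
  ∑-swap {suc d} f = R.trans (R.+-congˡ (∑-swap (f ∘ suc))) (R.sym (∑-+ (f zero) _))

  ≈ᵛ-refl : ∀ {m} {u : Vec m} → u ≈ᵛ u
  ≈ᵛ-refl i = R.refl

  ≈ᵛ-sym : ∀ {m} {u v : Vec m} → u ≈ᵛ v → v ≈ᵛ u
  ≈ᵛ-sym u≈v i = R.sym (u≈v i)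

  ≈ᵛ-trans : ∀ {m} {u v w : Vec m} → u ≈ᵛ v → v ≈ᵛ w → u ≈ᵛ w
  ≈ᵛ-trans u≈v v≈w i = R.trans (u≈v i) (v≈w i)

  0ᵛ : ∀ {m} → Vec m
  0ᵛ _ = 0#

  _+ᵛ_ : ∀ {m} → Vec m → Vec m → Vec m
  (u +ᵛ v) i = u i +ᶠ v i

  _*ᵛ_ : ∀ {m} → Carrier → Vec m → Vec m
  (x *ᵛ v) i = x *ᶠ v i

  opaque
    _≟ᵛ_ : ∀ {m} (u v : Vec m) → Dec (u ≈ᵛ v)
    u ≟ᵛ v = Fin.all? (λ i → u i ≟ v i)

  ∑-single : ∀ {d} (f : Fin d → Carrier) i → (∀ j → j ≢ i → f j ≈ 0#) → ∑ f ≈ f i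
  ∑-single {suc d} f zero    others =
    R.trans (R.+-congˡ (∑-zero (λ j → others (suc j) (λ ())))) (R.+-identityʳ _)
  ∑-single {suc d} f (suc i) others =
    R.trans (R.+-cong (others zero (λ ())) (∑-single (f ∘ suc) i (λ j j≢i → others (suc j) (j≢i ∘ Fin.suc-injective))))
            (R.+-identityˡ _)

  δ : ∀ {m} → Fin m → Vec m
  δ i j with i Fin.≟ j
  ... | yes _ = 1#
  ... | no  _ = 0#

  δ-refl : ∀ {m} (i : Fin m) → δ i i ≈ 1#
  δ-refl i with i Fin.≟ i
  ... | yes _   = R.refl
  ... | no  i≢i = contradiction refl i≢i

  δ-≢ : ∀ {m} {i j : Fin m} → i ≢ j → δ i j ≈ 0#
  δ-≢ {i = i} {j} i≢j with i Fin.≟ j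
  ... | yes i≡j = contradiction i≡j i≢j
  ... | no  _   = R.refl

  ∑-δ : ∀ {m} (v : Vec m) i → ∑ (λ j → v j *ᶠ δ j i) ≈ v i
  ∑-δ v i = R.trans (∑-single (λ j → v j *ᶠ δ j i) i (λ j j≢i → R.trans (R.*-congˡ (δ-≢ j≢i)) (R.zeroʳ _)))
                    (R.trans (R.*-congˡ (δ-refl i)) (R.*-identityʳ _))

  dot : ∀ {m} → Vec m → Vec m → Carrier
  dot φ v = ∑ (λ i → φ i *ᶠ v i)

  dot-cong : ∀ {m} {φ ψ u v : Vec m} → φ ≈ᵛ ψ → u ≈ᵛ v → dot φ u ≈ dot ψ v
  dot-cong φ≈ψ u≈v = ∑-cong (λ i → R.*-cong (φ≈ψ i) (u≈v i))

  dot-comm : ∀ {m} (φ v : Vec m) → dot φ v ≈ dot v φ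
  dot-comm φ v = ∑-cong (λ i → R.*-comm (φ i) (v i))

  dot-zeroʳ : ∀ {m} (φ : Vec m) {v} → v ≈ᵛ 0ᵛ → dot φ v ≈ 0#
  dot-zeroʳ φ v≈0 = ∑-zero (λ i → R.trans (R.*-congˡ (v≈0 i)) (R.zeroʳ _))

  dot-zeroˡ : ∀ {m} {φ : Vec m} v → φ ≈ᵛ 0ᵛ → dot φ v ≈ 0#
  dot-zeroˡ v φ≈0 = ∑-zero (λ i → R.trans (R.*-congʳ (φ≈0 i)) (R.zeroˡ _))

  dot-+ : ∀ {m} (φ u v : Vec m) → dot φ (u +ᵛ v) ≈ dot φ u +ᶠ dot φ v
  dot-+ φ u v = R.trans (∑-cong (λ i → R.distribˡ (φ i) (u i) (v i)))
                        (∑-+ (λ i → φ i *ᶠ u i) (λ i → φ i *ᶠ v i))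

  dot-* : ∀ {m} (φ : Vec m) x v → dot φ (x *ᵛ v) ≈ x *ᶠ dot φ v
  dot-* φ x v = R.trans (∑-cong (λ i → begin
      φ i *ᶠ (x *ᶠ v i)  ≈⟨ R.*-assoc _ _ _ ⟨
      (φ i *ᶠ x) *ᶠ v i  ≈⟨ R.*-congʳ (R.*-comm _ _) ⟩
      (x *ᶠ φ i) *ᶠ v i  ≈⟨ R.*-assoc _ _ _ ⟩
      x *ᶠ (φ i *ᶠ v i)  ∎)) (∑-*ˡ x (λ i → φ i *ᶠ v i))
    where open ≈-Reasoning

  dot-lincomb : ∀ {d m} (φ : Vec m) (cs : Vec d) (bs : Fin d → Vec m) →
                dot φ (lincomb cs bs) ≈ dot (λ j → dot φ (bs j)) cs
  dot-lincomb φ cs bs = begin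
    ∑ (λ i → φ i *ᶠ ∑ (λ j → cs j *ᶠ bs j i))     ≈⟨ ∑-cong (λ i → R.sym (∑-*ˡ (φ i) (λ j → cs j *ᶠ bs j i))) ⟩
    ∑ (λ i → ∑ (λ j → φ i *ᶠ (cs j *ᶠ bs j i)))   ≈⟨ ∑-swap (λ i j → φ i *ᶠ (cs j *ᶠ bs j i)) ⟩
    ∑ (λ j → ∑ (λ i → φ i *ᶠ (cs j *ᶠ bs j i)))   ≈⟨ ∑-cong (λ j → dot-* φ (cs j) (bs j)) ⟩
    ∑ (λ j → cs j *ᶠ dot φ (bs j))                ≈⟨ ∑-cong (λ j → R.*-comm (cs j) (dot φ (bs j))) ⟩
    ∑ (λ j → dot φ (bs j) *ᶠ cs j)                ∎
    where open ≈-Reasoning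

  lincomb-cong : ∀ {d m} {cs es : Vec d} (bs : Fin d → Vec m) → cs ≈ᵛ es → lincomb cs bs ≈ᵛ lincomb es bs
  lincomb-cong bs cs≈es i = ∑-cong (λ j → R.*-congʳ (cs≈es j))

  lincomb-+ : ∀ {d m} (cs es : Vec d) (bs : Fin d → Vec m) →
              lincomb (cs +ᵛ es) bs ≈ᵛ (lincomb cs bs +ᵛ lincomb es bs)
  lincomb-+ cs es bs i = R.trans (∑-cong (λ j → R.distribʳ (bs j i) (cs j) (es j)))
                                 (∑-+ (λ j → cs j *ᶠ bs j i) (λ j → es j *ᶠ bs j i))

  lincomb-* : ∀ {d m} x (cs : Vec d) (bs : Fin d → Vec m) →
              lincomb (x *ᵛ cs) bs ≈ᵛ (x *ᵛ lincomb cs bs)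
  lincomb-* x cs bs i = R.trans (∑-cong (λ j → R.*-assoc x (cs j) (bs j i)))
                               (∑-*ˡ x (λ j → cs j *ᶠ bs j i))

  -1ᶠ : Carrier
  -1ᶠ = -ᶠ 1#

  x+-1*y≈0⇒x≈y : ∀ {x y} → x +ᶠ (-1ᶠ *ᶠ y) ≈ 0# → x ≈ y
  x+-1*y≈0⇒x≈y e = x-y≈0⇒x≈y _ _ (R.trans (R.+-congˡ (R.sym (-1*x≈-x _))) e)

  x≈y⇒x+-1*y≈0 : ∀ {x y} → x ≈ y → x +ᶠ (-1ᶠ *ᶠ y) ≈ 0#
  x≈y⇒x+-1*y≈0 {x} {y} e = R.trans (R.+-cong e (-1*x≈-x y)) (R.-‿inverseʳ y)

  lincomb-injective : ∀ {d m} {bs : Fin d → Vec m} → LinIndep bs →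
                      ∀ cs es → lincomb cs bs ≈ᵛ lincomb es bs → cs ≈ᵛ es
  lincomb-injective {bs = bs} ind cs es e j = x+-1*y≈0⇒x≈y (ind (cs +ᵛ (-1ᶠ *ᵛ es)) (λ i → begin
    lincomb (cs +ᵛ (-1ᶠ *ᵛ es)) bs i            ≈⟨ lincomb-+ cs (-1ᶠ *ᵛ es) bs i ⟩
    lincomb cs bs i +ᶠ lincomb (-1ᶠ *ᵛ es) bs i ≈⟨ R.+-congˡ (lincomb-* -1ᶠ es bs i) ⟩
    lincomb cs bs i +ᶠ (-1ᶠ *ᶠ lincomb es bs i) ≈⟨ x≈y⇒x+-1*y≈0 (e i) ⟩
    0#                                          ∎) j)
    where open ≈-Reasoning

  funToFin-cong : ∀ {m n} {f g : Fin m → Fin n} → (∀ i → f i ≡ g i) → funToFin f ≡ funToFin g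
  funToFin-cong {zero}  f≡g = refl
  funToFin-cong {suc m} f≡g = cong₂ combine (f≡g zero) (funToFin-cong (f≡g ∘ suc))

  code : ∀ {m} → Vec m → Fin (q ^ m)
  code v = funToFin (from ∘ v)

  vec : ∀ {m} → Fin (q ^ m) → Vec m
  vec x = to ∘ finToFun x

  code-cong : ∀ {m} {u v : Vec m} → u ≈ᵛ v → code u ≡ code v
  code-cong u≈v = funToFin-cong (from-cong ∘ u≈v)

  vec-code : ∀ {m} (v : Vec m) → vec (code v) ≈ᵛ v
  vec-code v i = R.trans (R.reflexive (cong to (Fin.finToFun-funToFin (from ∘ v) i))) (to-from (v i))

  code-vec : ∀ {m} (x : Fin (q ^ m)) → code {m} (vec x) ≡ x
  code-vec {m} x = trans (funToFin-cong {m} (from-to ∘ finToFun x)) (Fin.funToFin-finToFin {m} x)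

  code-injective : ∀ {m} {u v : Vec m} → code u ≡ code v → u ≈ᵛ v
  code-injective {u = u} {v} e =
    ≈ᵛ-trans (≈ᵛ-sym (vec-code u)) (≈ᵛ-trans (λ i → R.reflexive (cong (λ x → vec x i) e)) (vec-code v))

  -- Sums over F^m run over the codes in `Fin (q ^ m)`, and `vec (code v)` recovers v only up to
  -- `_≈ᵛ_`; a summand must not see the difference.
  Respects : ∀ {m} → (Vec m → ℕ) → Set _
  Respects g = ∀ {u v} → u ≈ᵛ v → g u ≡ g v

  sumᵛ : ∀ {m} → (Vec m → ℕ) → ℕ
  sumᵛ g = sum (g ∘ vec)

  sumᵛ-bijection : ∀ {m} (f f⁻¹ : Vec m → Vec m) →
                   (∀ {u v} → u ≈ᵛ v → f u ≈ᵛ f v) → (∀ {u v} → u ≈ᵛ v → f⁻¹ u ≈ᵛ f⁻¹ v) →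
                   (∀ v → f (f⁻¹ v) ≈ᵛ v) → (∀ v → f⁻¹ (f v) ≈ᵛ v) →
                   ∀ {g : Vec m → ℕ} → Respects g → sumᵛ (g ∘ f) ≡ sumᵛ g
  sumᵛ-bijection {m} f f⁻¹ f-cong f⁻¹-cong ff⁻¹ f⁻¹f {g} g-resp =
    trans (sum-cong (λ x → g-resp (≈ᵛ-sym (vec-code (f (vec x))))))
          (sum-bijection (code ∘ f ∘ vec) (code ∘ f⁻¹ ∘ vec)
            (λ y → trans (code-cong (≈ᵛ-trans (f-cong (vec-code _)) (ff⁻¹ _))) (code-vec {m} y))
            (λ x → trans (code-cong (≈ᵛ-trans (f⁻¹-cong (vec-code _)) (f⁻¹f _))) (code-vec {m} x))
            (g ∘ vec))

  sumᵛ-unique : ∀ {m p} {P : Vec m → Set p} (P? : ∀ v → Dec (P v)) (g : Vec m → ℕ) → Respects g →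
                ∀ v → (∀ {u} → u ≈ᵛ v → P u) → (∀ u → P u → u ≈ᵛ v) →
                sumᵛ (λ u → 𝟙 (P? u) * g u) ≡ g v
  sumᵛ-unique {m} P? g g-resp v Pv uniq =
    trans (sum-unique (P? ∘ vec) (g ∘ vec) (code v) (Pv (vec-code v))
             (λ y Py → trans (sym (code-vec {m} y)) (code-cong (uniq (vec y) Py))))
          (g-resp (vec-code v))

  countᵛ-unique : ∀ {m p} {P : Vec m → Set p} (P? : ∀ v → Dec (P v)) →
                  ∀ v → (∀ {u} → u ≈ᵛ v → P u) → (∀ u → P u → u ≈ᵛ v) →
                  sumᵛ (λ u → 𝟙 (P? u)) ≡ 1
  countᵛ-unique P? v Pv uniq =
    trans (sum-cong (λ y → sym (*-identityʳ _))) (sumᵛ-unique P? (λ _ → 1) (λ _ → refl) v Pv uniq)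

-- Polynomial arithmetic

module Polynomials {c ℓ : Level} (F : FiniteField c ℓ) where

  open Vectors F

  -- Coefficients from the constant term upwards, trailing zeros allowed. Representation is thus not
  -- unique: equality is `_≋_`, and degrees are predicates (`Bounded`, `Monic`, `HasDegree`) instead
  -- of a function.
  Poly : Set c
  Poly = List Carrier

  coef : Poly → ℕ → Carrier
  coef []      i       = 0#
  coef (a ∷ f) zero    = a
  coef (a ∷ f) (suc i) = coef f i

  infix 4 _≋_
  infixl 6 _⊕_
  infixl 7 _⊗_ _·_

  record _≋_ (f g : Poly) : Set ℓ where
    constructor coefs
    field at : ∀ i → coef f i ≈ coef g i
  open _≋_ public

  ≋-isEquivalence : IsEquivalence _≋_
  ≋-isEquivalence = record
    { refl  = coefs λ i → R.refl
    ; sym   = λ f≋g → coefs λ i → R.sym (at f≋g i)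
    ; trans = λ f≋g g≋h → coefs λ i → R.trans (at f≋g i) (at g≋h i)
    }

  _⊕_ : Poly → Poly → Poly
  []      ⊕ g       = g
  (a ∷ f) ⊕ []      = a ∷ f
  (a ∷ f) ⊕ (b ∷ g) = (a +ᶠ b) ∷ (f ⊕ g)

  _·_ : Carrier → Poly → Poly
  x · []      = []
  x · (a ∷ f) = (x *ᶠ a) ∷ (x · f)

  _⊗_ : Poly → Poly → Poly
  []      ⊗ g = []
  (a ∷ f) ⊗ g = a · g ⊕ (0# ∷ f ⊗ g)

  coef-⊕ : ∀ f g i → coef (f ⊕ g) i ≈ coef f i +ᶠ coef g i
  coef-⊕ []      g       i       = R.sym (R.+-identityˡ _)
  coef-⊕ (a ∷ f) []      i       = R.sym (R.+-identityʳ _)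
  coef-⊕ (a ∷ f) (b ∷ g) zero    = R.refl
  coef-⊕ (a ∷ f) (b ∷ g) (suc i) = coef-⊕ f g i

  coef-· : ∀ x f i → coef (x · f) i ≈ x *ᶠ coef f i
  coef-· x []      i       = R.sym (R.zeroʳ x)
  coef-· x (a ∷ f) zero    = R.refl
  coef-· x (a ∷ f) (suc i) = coef-· x f i

  open IsEquivalence ≋-isEquivalence public
    renaming (refl to ≋-refl; sym to ≋-sym; trans to ≋-trans) using ()

  ≋-setoid : Setoid _ _
  ≋-setoid = record { isEquivalence = ≋-isEquivalence }

  module ≋-Reasoning where
    open import Relation.Binary.Reasoning.Setoid ≋-setoid public

  ∷-cong : ∀ {a b f g} → a ≈ b → f ≋ g → (a ∷ f) ≋ (b ∷ g)
  ∷-cong a≈b f≋g = coefs λ { zero → a≈b ; (suc i) → at f≋g i }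

  ∷-zero : ∀ {a f} → a ≈ 0# → f ≋ [] → (a ∷ f) ≋ []
  ∷-zero a≈0 f≋0 = coefs λ { zero → a≈0 ; (suc i) → at f≋0 i }

  ∷-tail : ∀ {a f} → (a ∷ f) ≋ [] → f ≋ []
  ∷-tail e = coefs (at e ∘ suc)

  ⊕-cong : ∀ {f f′ g g′} → f ≋ f′ → g ≋ g′ → f ⊕ g ≋ f′ ⊕ g′
  ⊕-cong {f} {f′} {g} {g′} e e′ = coefs λ i →
    R.trans (coef-⊕ f g i) (R.trans (R.+-cong (at e i) (at e′ i)) (R.sym (coef-⊕ f′ g′ i)))

  ·-cong : ∀ {x y f g} → x ≈ y → f ≋ g → x · f ≋ y · g
  ·-cong {x} {y} {f} {g} e e′ = coefs λ i →
    R.trans (coef-· x f i) (R.trans (R.*-cong e (at e′ i)) (R.sym (coef-· y g i)))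

  ⊕-comm : ∀ f g → f ⊕ g ≋ g ⊕ f
  ⊕-comm f g = coefs λ i → R.trans (coef-⊕ f g i) (R.trans (R.+-comm _ _) (R.sym (coef-⊕ g f i)))

  ⊕-assoc : ∀ f g h → (f ⊕ g) ⊕ h ≋ f ⊕ (g ⊕ h)
  ⊕-assoc f g h = coefs λ i → begin
    coef ((f ⊕ g) ⊕ h) i                ≈⟨ coef-⊕ (f ⊕ g) h i ⟩
    coef (f ⊕ g) i +ᶠ coef h i          ≈⟨ R.+-congʳ (coef-⊕ f g i) ⟩
    (coef f i +ᶠ coef g i) +ᶠ coef h i  ≈⟨ R.+-assoc _ _ _ ⟩
    coef f i +ᶠ (coef g i +ᶠ coef h i)  ≈⟨ R.+-congˡ (coef-⊕ g h i) ⟨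
    coef f i +ᶠ coef (g ⊕ h) i          ≈⟨ coef-⊕ f (g ⊕ h) i ⟨
    coef (f ⊕ (g ⊕ h)) i                ∎
    where open ≈-Reasoning

  ⊕-identityʳ : ∀ f → f ⊕ [] ≋ f
  ⊕-identityʳ f = ⊕-comm f []

  ·-distribˡ : ∀ x f g → x · (f ⊕ g) ≋ x · f ⊕ x · g
  ·-distribˡ x f g = coefs λ i → begin
    coef (x · (f ⊕ g)) i               ≈⟨ coef-· x (f ⊕ g) i ⟩
    x *ᶠ coef (f ⊕ g) i                ≈⟨ R.*-congˡ (coef-⊕ f g i) ⟩
    x *ᶠ (coef f i +ᶠ coef g i)        ≈⟨ R.distribˡ x _ _ ⟩
    x *ᶠ coef f i +ᶠ x *ᶠ coef g i     ≈⟨ R.+-cong (coef-· x f i) (coef-· x g i) ⟨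
    coef (x · f) i +ᶠ coef (x · g) i   ≈⟨ coef-⊕ (x · f) (x · g) i ⟨
    coef (x · f ⊕ x · g) i             ∎
    where open ≈-Reasoning

  ·-assoc : ∀ x y f → (x *ᶠ y) · f ≋ x · (y · f)
  ·-assoc x y f = coefs λ i → begin
    coef ((x *ᶠ y) · f) i     ≈⟨ coef-· (x *ᶠ y) f i ⟩
    (x *ᶠ y) *ᶠ coef f i      ≈⟨ R.*-assoc x y _ ⟩
    x *ᶠ (y *ᶠ coef f i)      ≈⟨ R.*-congˡ (coef-· y f i) ⟨
    x *ᶠ coef (y · f) i       ≈⟨ coef-· x (y · f) i ⟨
    coef (x · (y · f)) i      ∎
    where open ≈-Reasoning

  ·-identity : ∀ f → 1# · f ≋ f
  ·-identity f = coefs λ i → R.trans (coef-· 1# f i) (R.*-identityˡ _)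

  ·-zero : ∀ {x} f → x ≈ 0# → x · f ≋ []
  ·-zero {x} f x≈0 = coefs λ i → R.trans (coef-· x f i) (R.trans (R.*-congʳ x≈0) (R.zeroˡ _))

  ⊕-cancelled : ∀ f → f ⊕ -1ᶠ · f ≋ []
  ⊕-cancelled f = coefs λ i → R.trans (coef-⊕ f _ i)
    (R.trans (R.+-congˡ (coef-· -1ᶠ f i)) (x≈y⇒x+-1*y≈0 R.refl))

  ⊕-interchange : ∀ f g h k → (f ⊕ g) ⊕ (h ⊕ k) ≋ (f ⊕ h) ⊕ (g ⊕ k)
  ⊕-interchange f g h k = coefs λ i → begin
    coef ((f ⊕ g) ⊕ (h ⊕ k)) i  ≈⟨ R.trans (coef-⊕ (f ⊕ g) _ i) (R.+-cong (coef-⊕ f g i) (coef-⊕ h k i)) ⟩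
    (coef f i +ᶠ coef g i) +ᶠ (coef h i +ᶠ coef k i) ≈⟨ +ᶠ-interchange _ _ _ _ ⟩
    (coef f i +ᶠ coef h i) +ᶠ (coef g i +ᶠ coef k i)
      ≈⟨ R.trans (coef-⊕ (f ⊕ h) _ i) (R.+-cong (coef-⊕ f h i) (coef-⊕ g k i)) ⟨
    coef ((f ⊕ h) ⊕ (g ⊕ k)) i  ∎
    where open ≈-Reasoning

  ⊗-congʳ : ∀ f {g g′} → g ≋ g′ → f ⊗ g ≋ f ⊗ g′
  ⊗-congʳ []      e = ≋-refl
  ⊗-congʳ (a ∷ f) e = ⊕-cong (·-cong R.refl e) (∷-cong R.refl (⊗-congʳ f e))

  ⊗-distribˡ : ∀ f g h → f ⊗ (g ⊕ h) ≋ f ⊗ g ⊕ f ⊗ h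
  ⊗-distribˡ []      g h = ≋-refl
  ⊗-distribˡ (a ∷ f) g h = begin
    a · (g ⊕ h) ⊕ (0# ∷ f ⊗ (g ⊕ h))
      ≈⟨ ⊕-cong (·-distribˡ a g h) (∷-cong (R.sym (R.+-identityˡ 0#)) (⊗-distribˡ f g h)) ⟩
    (a · g ⊕ a · h) ⊕ ((0# ∷ f ⊗ g) ⊕ (0# ∷ f ⊗ h))
      ≈⟨ ⊕-interchange (a · g) (a · h) (0# ∷ f ⊗ g) (0# ∷ f ⊗ h) ⟩
    (a · g ⊕ (0# ∷ f ⊗ g)) ⊕ (a · h ⊕ (0# ∷ f ⊗ h)) ∎
    where open ≋-Reasoning

  ⊗-zeroʳ : ∀ f → f ⊗ [] ≋ []
  ⊗-zeroʳ []      = ≋-refl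
  ⊗-zeroʳ (a ∷ f) = ∷-zero R.refl (⊗-zeroʳ f)

  ⊗-∷ʳ : ∀ f b g → f ⊗ (b ∷ g) ≋ b · f ⊕ (0# ∷ f ⊗ g)
  ⊗-∷ʳ []      b g = ≋-sym (∷-zero R.refl ≋-refl)
  ⊗-∷ʳ (a ∷ f) b g = ∷-cong (R.+-congʳ (R.*-comm a b)) (begin
    a · g ⊕ f ⊗ (b ∷ g)                ≈⟨ ⊕-cong ≋-refl (⊗-∷ʳ f b g) ⟩
    a · g ⊕ (b · f ⊕ (0# ∷ f ⊗ g))     ≈⟨ ⊕-assoc (a · g) (b · f) _ ⟨
    (a · g ⊕ b · f) ⊕ (0# ∷ f ⊗ g)     ≈⟨ ⊕-cong (⊕-comm (a · g) (b · f)) ≋-refl ⟩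
    (b · f ⊕ a · g) ⊕ (0# ∷ f ⊗ g)     ≈⟨ ⊕-assoc (b · f) (a · g) _ ⟩
    b · f ⊕ (a · g ⊕ (0# ∷ f ⊗ g))     ∎)
    where open ≋-Reasoning

  ⊗-comm : ∀ f g → f ⊗ g ≋ g ⊗ f
  ⊗-comm []      g = ≋-sym (⊗-zeroʳ g)
  ⊗-comm (a ∷ f) g = ≋-trans (⊕-cong ≋-refl (∷-cong R.refl (⊗-comm f g))) (≋-sym (⊗-∷ʳ g a f))

  ⊗-cong : ∀ {f f′ g g′} → f ≋ f′ → g ≋ g′ → f ⊗ g ≋ f′ ⊗ g′
  ⊗-cong {f} {f′} {g} {g′} e e′ = begin
    f ⊗ g    ≈⟨ ⊗-congʳ f e′ ⟩
    f ⊗ g′   ≈⟨ ⊗-comm f g′ ⟩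
    g′ ⊗ f   ≈⟨ ⊗-congʳ g′ e ⟩
    g′ ⊗ f′  ≈⟨ ⊗-comm g′ f′ ⟩
    f′ ⊗ g′  ∎
    where open ≋-Reasoning

  ⊗-distribʳ : ∀ h f g → (f ⊕ g) ⊗ h ≋ f ⊗ h ⊕ g ⊗ h
  ⊗-distribʳ h f g = ≋-trans (⊗-comm (f ⊕ g) h)
    (≋-trans (⊗-distribˡ h f g) (⊕-cong (⊗-comm h f) (⊗-comm h g)))

  ·-⊗ : ∀ x f g → (x · f) ⊗ g ≋ x · (f ⊗ g)
  ·-⊗ x []      g = ≋-refl
  ·-⊗ x (a ∷ f) g = begin
    (x *ᶠ a) · g ⊕ (0# ∷ (x · f) ⊗ g)     ≈⟨ ⊕-cong (·-assoc x a g) (∷-cong (R.sym (R.zeroʳ x)) (·-⊗ x f g)) ⟩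
    x · (a · g) ⊕ x · (0# ∷ f ⊗ g)        ≈⟨ ·-distribˡ x (a · g) _ ⟨
    x · (a · g ⊕ (0# ∷ f ⊗ g))            ∎
    where open ≋-Reasoning

  0∷-⊗ : ∀ f g → (0# ∷ f) ⊗ g ≋ 0# ∷ f ⊗ g
  0∷-⊗ f g = ⊕-cong (·-zero g R.refl) ≋-refl

  ⊗-assoc : ∀ f g h → (f ⊗ g) ⊗ h ≋ f ⊗ (g ⊗ h)
  ⊗-assoc []      g h = ≋-refl
  ⊗-assoc (a ∷ f) g h = begin
    (a · g ⊕ (0# ∷ f ⊗ g)) ⊗ h            ≈⟨ ⊗-distribʳ h (a · g) (0# ∷ f ⊗ g) ⟩
    (a · g) ⊗ h ⊕ (0# ∷ f ⊗ g) ⊗ h        ≈⟨ ⊕-cong (·-⊗ a g h) (0∷-⊗ (f ⊗ g) h) ⟩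
    a · (g ⊗ h) ⊕ (0# ∷ (f ⊗ g) ⊗ h)      ≈⟨ ⊕-cong ≋-refl (∷-cong R.refl (⊗-assoc f g h)) ⟩
    a · (g ⊗ h) ⊕ (0# ∷ f ⊗ (g ⊗ h))      ∎
    where open ≋-Reasoning

  const : Carrier → Poly
  const x = x ∷ []

  const-⊗ : ∀ x f → const x ⊗ f ≋ x · f
  const-⊗ x f = ≋-trans (⊕-cong ≋-refl (∷-zero R.refl ≋-refl)) (⊕-identityʳ _)

  ⊗-const : ∀ f x → f ⊗ const x ≋ x · f
  ⊗-const f x = ≋-trans (⊗-comm f (const x)) (const-⊗ x f)

  1ᵖ : Poly
  1ᵖ = const 1#

  ⊗-identityˡ : ∀ f → 1ᵖ ⊗ f ≋ f
  ⊗-identityˡ f = ≋-trans (const-⊗ 1# f) (·-identity f)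

  ⊗-identityʳ : ∀ f → f ⊗ 1ᵖ ≋ f
  ⊗-identityʳ f = ≋-trans (⊗-comm f 1ᵖ) (⊗-identityˡ f)

-- Degrees, division with remainder, divisibility

module Division {c ℓ : Level} (F : FiniteField c ℓ) where

  open Vectors F
  open Polynomials F

  -- Degree less than m, where the zero polynomial qualifies for every m.
  record Bounded (f : Poly) (m : ℕ) : Set ℓ where
    constructor bounded
    field beyond : ∀ i → m ≤ i → coef f i ≈ 0#
  open Bounded public

  record Monic (f : Poly) (d : ℕ) : Set ℓ where
    constructor _,_
    field
      leading : coef f d ≈ 1#
      bound   : Bounded f (suc d)
  open Monic public

  record HasDegree (f : Poly) (d : ℕ) : Set ℓ where
    constructor _,_
    field
      leading≉0 : ¬ (coef f d ≈ 0#)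
      bound     : Bounded f (suc d)

  Bounded-cong : ∀ {f g m} → f ≋ g → Bounded f m → Bounded g m
  Bounded-cong e (bounded b) = bounded λ i m≤i → R.trans (R.sym (at e i)) (b i m≤i)

  Bounded-0⇒≋[] : ∀ {f} → Bounded f 0 → f ≋ []
  Bounded-0⇒≋[] (bounded b) = coefs λ i → b i z≤n

  Bounded-⊕ : ∀ {f g m} → Bounded f m → Bounded g m → Bounded (f ⊕ g) m
  Bounded-⊕ {f} {g} (bounded b) (bounded b′) = bounded λ i m≤i →
    R.trans (coef-⊕ f g i) (R.trans (R.+-cong (b i m≤i) (b′ i m≤i)) (R.+-identityˡ 0#))

  Bounded-· : ∀ {x f m} → Bounded f m → Bounded (x · f) m
  Bounded-· {x} {f} (bounded b) = bounded λ i m≤i → R.trans (coef-· x f i) (R.trans (R.*-congˡ (b i m≤i)) (R.zeroʳ x))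

  Bounded-∷ : ∀ {a f m} → Bounded f m → Bounded (a ∷ f) (suc m)
  Bounded-∷ (bounded b) = bounded λ { (suc i) (s≤s m≤i) → b i m≤i }

  Bounded-tail : ∀ {a f m} → Bounded (a ∷ f) (suc m) → Bounded f m
  Bounded-tail (bounded b) = bounded λ i m≤i → b (suc i) (s≤s m≤i)

  Bounded-weaken : ∀ {f m n} → m ≤ n → Bounded f m → Bounded f n
  Bounded-weaken m≤n (bounded b) = bounded λ i n≤i → b i (≤-trans m≤n n≤i)

  ≋[]⇒Bounded : ∀ {f m} → f ≋ [] → Bounded f m
  ≋[]⇒Bounded e = bounded λ i _ → at e i

  Bounded-⊗ : ∀ f g {d e} → Bounded f (suc d) → Bounded g (suc e) → Bounded (f ⊗ g) (suc (d + e))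
  coef-⊗-top : ∀ f g {d e} → Bounded f (suc d) → Bounded g (suc e) →
               coef (f ⊗ g) (d + e) ≈ coef f d *ᶠ coef g e

  private
    tail≋[] : ∀ {a f} → Bounded (a ∷ f) 1 → f ≋ []
    tail≋[] = Bounded-0⇒≋[] ∘ Bounded-tail

    ⊗-tail≋[] : ∀ {a f} g → Bounded (a ∷ f) 1 → (a ∷ f) ⊗ g ≋ a · g
    ⊗-tail≋[] g b = ≋-trans (⊕-cong ≋-refl (∷-zero R.refl (⊗-cong {g = g} (tail≋[] b) ≋-refl)))
                            (⊕-identityʳ _)

  Bounded-⊗ []      g bf bg = ≋[]⇒Bounded ≋-refl
  Bounded-⊗ (a ∷ f) g {zero}  bf bg = Bounded-cong (≋-sym (⊗-tail≋[] g bf)) (Bounded-· {f = g} bg)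
  Bounded-⊗ (a ∷ f) g {suc d} {e} bf bg = Bounded-⊕ {a · g}
    (Bounded-· {f = g} (Bounded-weaken (s≤s (m≤n+m e (suc d))) bg))
    (Bounded-∷ (Bounded-⊗ f g (Bounded-tail bf) bg))

  coef-⊗-top []      g bf bg = R.sym (R.zeroˡ _)
  coef-⊗-top (a ∷ f) g {zero} {e} bf bg = R.trans (at (⊗-tail≋[] g bf) e) (coef-· a g e)
  coef-⊗-top (a ∷ f) g {suc d} {e} bf bg = begin
    coef (a · g ⊕ (0# ∷ f ⊗ g)) (suc (d + e))   ≈⟨ coef-⊕ (a · g) _ (suc (d + e)) ⟩
    coef (a · g) (suc (d + e)) +ᶠ coef (f ⊗ g) (d + e)
      ≈⟨ R.+-cong (beyond (Bounded-· {a} {g} bg) _ (s≤s (m≤n+m e d))) (coef-⊗-top f g (Bounded-tail bf) bg) ⟩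
    0# +ᶠ (coef f d *ᶠ coef g e)                ≈⟨ R.+-identityˡ _ ⟩
    coef f d *ᶠ coef g e                        ∎
    where open ≈-Reasoning

  Monic-⊗ : ∀ {f g d e} → Monic f d → Monic g e → Monic (f ⊗ g) (d + e)
  Monic-⊗ {f} {g} (tf , bf) (tg , bg) =
    R.trans (coef-⊗-top f g bf bg) (R.trans (R.*-cong tf tg) (R.*-identityˡ 1#)) , Bounded-⊗ f g bf bg

  zero-or-degree : ∀ f → f ≋ [] ⊎ ∃ (HasDegree f)
  zero-or-degree [] = inj₁ ≋-refl
  zero-or-degree (a ∷ f) with zero-or-degree f | a ≟ 0#
  ... | inj₂ (d , top , b) | _       = inj₂ (suc d , top , Bounded-∷ b)
  ... | inj₁ f≋0           | yes a≈0 = inj₁ (∷-zero a≈0 f≋0)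
  ... | inj₁ f≋0           | no  a≉0 = inj₂ (0 , a≉0 , Bounded-∷ (≋[]⇒Bounded f≋0))

  ⊗-degree : ∀ {p d s e} → Monic p d → HasDegree s e → ¬ (coef (p ⊗ s) (d + e) ≈ 0#)
  ⊗-degree {p} {d} {s} {e} (tp , bp) (ts , bs) z = ts (begin
    coef s e               ≈⟨ R.*-identityˡ _ ⟨
    1# *ᶠ coef s e         ≈⟨ R.*-congʳ tp ⟨
    coef p d *ᶠ coef s e   ≈⟨ coef-⊗-top p s bp bs ⟨
    coef (p ⊗ s) (d + e)   ≈⟨ z ⟩
    0#                     ∎)
    where open ≈-Reasoning

  -- A nonzero cofactor would add its own degree to d, as p has leading coefficient 1. Cancellation
  -- of p and uniqueness of remainders both rest on this.
  multiple-bounded⇒zero : ∀ {p d s} → Monic p d → Bounded (p ⊗ s) d → s ≋ []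
  multiple-bounded⇒zero {s = s} mp b with zero-or-degree s
  ... | inj₁ s≋0     = s≋0
  ... | inj₂ (e , h) = contradiction (beyond b _ (m≤m+n _ e)) (⊗-degree {s = s} mp h)

  ⊗-cancelˡ : ∀ {p d} → Monic p d → ∀ f g → p ⊗ f ≋ p ⊗ g → f ≋ g
  ⊗-cancelˡ {p} {d} mp f g e = coefs λ i → x+-1*y≈0⇒x≈y
    (R.trans (R.+-congˡ (R.sym (coef-· -1ᶠ g i))) (R.trans (R.sym (coef-⊕ f _ i)) (at difference≋0 i)))
    where
    product≋0 : p ⊗ (f ⊕ -1ᶠ · g) ≋ []
    product≋0 = begin
      p ⊗ (f ⊕ -1ᶠ · g)          ≈⟨ ⊗-distribˡ p f _ ⟩
      p ⊗ f ⊕ p ⊗ (-1ᶠ · g)      ≈⟨ ⊕-cong e (≋-trans (⊗-comm p _) (≋-trans (·-⊗ -1ᶠ g p) (·-cong R.refl (⊗-comm g p)))) ⟩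
      p ⊗ g ⊕ -1ᶠ · (p ⊗ g)      ≈⟨ ⊕-cancelled (p ⊗ g) ⟩
      []                         ∎
      where open ≋-Reasoning
    difference≋0 : f ⊕ -1ᶠ · g ≋ []
    difference≋0 = multiple-bounded⇒zero mp (≋[]⇒Bounded product≋0)

  -- Degrees add and leading coefficients multiply, which determines both for s. It allows the monic
  -- multiples of h to be parametrised by monic cofactors.
  cofactor-monic : ∀ {h e f n s} → Monic h e → Monic f n → f ≋ h ⊗ s → ∃ λ d → n ≡ e + d × Monic s d
  cofactor-monic {h} {e} {f} {n} {s} mh (tf , bf) eq with zero-or-degree s
  ... | inj₁ s≋0 = contradiction
    (R.trans (R.sym (at (≋-trans eq (≋-trans (⊗-cong {h} ≋-refl s≋0) (⊗-zeroʳ h))) n)) tf) 0≉1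
  ... | inj₂ (d , ts , bs) = d , n≡e+d , top , bs
    where
    n≡e+d : n ≡ e + d
    n≡e+d = ≤-antisym
      (≮⇒≥ λ lt → 0≉1 (R.trans (R.sym (R.trans (at eq n) (beyond (Bounded-⊗ h s (bound mh) bs) n lt))) tf))
      (≮⇒≥ λ lt → ⊗-degree {s = s} mh (ts , bs) (R.trans (R.sym (at eq _)) (beyond bf _ lt)))
    top : coef s d ≈ 1#
    top = begin
      coef s d              ≈⟨ R.*-identityˡ _ ⟨
      1# *ᶠ coef s d        ≈⟨ R.*-congʳ (leading mh) ⟨
      coef h e *ᶠ coef s d  ≈⟨ coef-⊗-top h s (bound mh) bs ⟨
      coef (h ⊗ s) (e + d)  ≈⟨ at eq _ ⟨
      coef f (e + d)        ≡⟨ cong (coef f) n≡e+d ⟨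
      coef f n              ≈⟨ tf ⟩
      1#                    ∎
      where open ≈-Reasoning

  divMod : ∀ {p d} → Monic p d → ∀ f → ∃₂ λ s r → f ≋ p ⊗ s ⊕ r × Bounded r d
  divMod {p} {d} mp [] = [] , [] , ≋-sym (≋-trans (⊕-identityʳ _) (⊗-zeroʳ p)) , ≋[]⇒Bounded ≋-refl
  divMod {p} {d} (tp , bp) (a ∷ f) with divMod {p} {d} (tp , bp) f
  -- From f = ps + r follows a + Xf = p(Xs) + (a + Xr). The last term has degree at most d, and
  -- subtracting xp clears its coefficient x at X^d.
  ... | s , r , eq , br = (x ∷ s) , r′ ⊕ (-1ᶠ *ᶠ x) · p , eq′ , bounded bound′
    where
    r′ = a ∷ r
    x = coef r′ d
    eq′ : a ∷ f ≋ p ⊗ (x ∷ s) ⊕ (r′ ⊕ (-1ᶠ *ᶠ x) · p)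
    eq′ = ≋-sym (begin
      p ⊗ (x ∷ s) ⊕ (r′ ⊕ (-1ᶠ *ᶠ x) · p)
        ≈⟨ ⊕-cong (⊗-∷ʳ p x s) (≋-trans (⊕-comm r′ _) (⊕-cong (·-assoc -1ᶠ x p) ≋-refl)) ⟩
      (x · p ⊕ (0# ∷ p ⊗ s)) ⊕ (-1ᶠ · (x · p) ⊕ r′)
        ≈⟨ ⊕-interchange (x · p) (0# ∷ p ⊗ s) (-1ᶠ · (x · p)) r′ ⟩
      (x · p ⊕ -1ᶠ · (x · p)) ⊕ ((0# ∷ p ⊗ s) ⊕ r′)
        ≈⟨ ⊕-cong (⊕-cancelled (x · p)) (∷-cong (R.+-identityˡ a) (≋-sym eq)) ⟩
      a ∷ f ∎)
      where open ≋-Reasoning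
    r′-bound : Bounded r′ (suc d)
    r′-bound = Bounded-∷ br
    bound′ : ∀ i → d ≤ i → coef (r′ ⊕ (-1ᶠ *ᶠ x) · p) i ≈ 0#
    bound′ i d≤i with m≤n⇒m<n∨m≡n d≤i
    ... | inj₁ d<i  = beyond (Bounded-⊕ {r′} {(-1ᶠ *ᶠ x) · p} r′-bound (Bounded-· {f = p} bp)) i d<i
    ... | inj₂ refl = begin
      coef (r′ ⊕ (-1ᶠ *ᶠ x) · p) d         ≈⟨ coef-⊕ r′ ((-1ᶠ *ᶠ x) · p) d ⟩
      x +ᶠ coef ((-1ᶠ *ᶠ x) · p) d         ≈⟨ R.+-congˡ (coef-· _ p d) ⟩
      x +ᶠ ((-1ᶠ *ᶠ x) *ᶠ coef p d)        ≈⟨ R.+-congˡ (R.trans (R.*-congˡ tp) (R.*-identityʳ _)) ⟩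
      x +ᶠ (-1ᶠ *ᶠ x)                      ≈⟨ x≈y⇒x+-1*y≈0 R.refl ⟩
      0#                                   ∎
      where open ≈-Reasoning

  infix 4 _∣_

  record _∣_ (p f : Poly) : Set (c ⊔ˡ ℓ) where
    constructor _,_
    field
      quotient : Poly
      equality : f ≋ p ⊗ quotient

  ∣-respʳ : ∀ {p f g} → f ≋ g → p ∣ f → p ∣ g
  ∣-respʳ e (s , eq) = s , ≋-trans (≋-sym e) eq

  ∣-respˡ : ∀ {p p′ f} → p ≋ p′ → p ∣ f → p′ ∣ f
  ∣-respˡ e (s , eq) = s , ≋-trans eq (⊗-cong e ≋-refl)

  ∣-trans : ∀ {f g h} → f ∣ g → g ∣ h → f ∣ h
  ∣-trans {f} (s , e) (t , e′) = s ⊗ t , ≋-trans e′ (≋-trans (⊗-cong e ≋-refl) (⊗-assoc f s t))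

  ∣-⊕ : ∀ {p f g} → p ∣ f → p ∣ g → p ∣ f ⊕ g
  ∣-⊕ {p} (s , e) (t , e′) = s ⊕ t , ≋-trans (⊕-cong e e′) (≋-sym (⊗-distribˡ p s t))

  ∣-⊗ʳ : ∀ {p f} g → p ∣ f → p ∣ f ⊗ g
  ∣-⊗ʳ {p} g (s , e) = s ⊗ g , ≋-trans (⊗-cong e ≋-refl) (⊗-assoc p s g)

  ∣-· : ∀ {p f} x → p ∣ f → p ∣ x · f
  ∣-· {p} {f} x h = ∣-respʳ (⊗-const f x) (∣-⊗ʳ (const x) h)

  ∣-summandʳ : ∀ {p f g} → p ∣ f → p ∣ f ⊕ g → p ∣ g
  ∣-summandʳ {p} {f} {g} h h′ = ∣-respʳ (begin
    (f ⊕ g) ⊕ -1ᶠ · f   ≈⟨ ⊕-cong (⊕-comm f g) ≋-refl ⟩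
    (g ⊕ f) ⊕ -1ᶠ · f   ≈⟨ ⊕-assoc g f _ ⟩
    g ⊕ (f ⊕ -1ᶠ · f)   ≈⟨ ⊕-cong ≋-refl (⊕-cancelled f) ⟩
    g ⊕ []              ≈⟨ ⊕-identityʳ g ⟩
    g                   ∎) (∣-⊕ h′ (∣-· -1ᶠ h))
    where open ≋-Reasoning

  ∣-bounded⇒zero : ∀ {p d f} → Monic p d → Bounded f d → p ∣ f → f ≋ []
  ∣-bounded⇒zero {p} mp b (s , e) = ≋-trans e (≋-trans
    (⊗-congʳ p (multiple-bounded⇒zero mp (Bounded-cong e b))) (⊗-zeroʳ p))

  []? : ∀ f → Dec (f ≋ [])
  []? f with zero-or-degree f
  ... | inj₁ f≋0           = yes f≋0
  ... | inj₂ (d , top , _) = no λ f≋0 → top (at f≋0 d)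

  opaque
    divides? : ∀ {p d} → Monic p d → ∀ f → Dec (p ∣ f)
    divides? {p} mp f with divMod mp f
    ... | s , r , eq , br with []? r
    ...   | yes r≋0 = yes (s , ≋-trans eq (≋-trans (⊕-cong ≋-refl r≋0) (⊕-identityʳ _)))
    ...   | no  r≉0 = no λ h → r≉0 (∣-bounded⇒zero mp br (∣-summandʳ (s , ≋-refl) (∣-respʳ eq h)))

-- Monic irreducible polynomials and Euclid's lemma

module Irreducibles {c ℓ : Level} (F : FiniteField c ℓ) where

  open Vectors F
  open Polynomials F
  open Division F

  -- The vector holds the coefficients below a leading 1, so monic polynomials of degree d are
  -- counted by sums over `Vec d`.
  monic : ∀ {d} → Vec d → Poly
  monic {zero}  v = 1ᵖ
  monic {suc d} v = v zero ∷ monic (v ∘ suc)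

  monic-Monic : ∀ {d} (v : Vec d) → Monic (monic v) d
  monic-Monic {zero}  v = R.refl , Bounded-∷ (≋[]⇒Bounded ≋-refl)
  monic-Monic {suc d} v with monic-Monic (v ∘ suc)
  ... | top , b = top , Bounded-∷ b

  coef-monic : ∀ {d} (v : Vec d) i → coef (monic v) (toℕ i) ≈ v i
  coef-monic {suc d} v zero    = R.refl
  coef-monic {suc d} v (suc i) = coef-monic (v ∘ suc) i

  monic-cong : ∀ {d} {u v : Vec d} → u ≈ᵛ v → monic u ≋ monic v
  monic-cong {zero}  e = ≋-refl
  monic-cong {suc d} e = ∷-cong (e zero) (monic-cong (e ∘ suc))

  monic-injective : ∀ {d} {u v : Vec d} → monic u ≋ monic v → u ≈ᵛ v
  monic-injective {u = u} {v} e i = R.trans (R.sym (coef-monic u i)) (R.trans (at e (toℕ i)) (coef-monic v i))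

  lower : ∀ d → Poly → Vec d
  lower d f i = coef f (toℕ i)

  lower-cong : ∀ {d f g} → f ≋ g → lower d f ≈ᵛ lower d g
  lower-cong e i = at e (toℕ i)

  monic-lower : ∀ {d f} → Monic f d → f ≋ monic (lower d f)
  monic-lower {d} {f} (top , b) = coefs λ i → R.trans (below f top b i) R.refl
    where
    below : ∀ {d} f → coef f d ≈ 1# → Bounded f (suc d) → ∀ i → coef f i ≈ coef (monic (lower d f)) i
    below {zero}  f top b zero    = top
    below {zero}  f top b (suc i) = beyond b (suc i) (s≤s z≤n)
    below {suc d} f top b zero    = R.refl
    below {suc d} []      top b (suc i) = contradiction top 0≉1
    below {suc d} (a ∷ f) top b (suc i) = below f top (Bounded-tail b) i

  Monic-0 : ∀ {f} → Monic f 0 → f ≋ 1ᵖ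
  Monic-0 m = monic-lower m

  monic∣? : ∀ {d} (v : Vec d) f → Dec (monic v ∣ f)
  monic∣? v f = divides? (monic-Monic v) f

  -- Factors are sought among the codes of monic polynomials of degrees 1 to d - 1. This search
  -- space is finite, so irreducibility is decidable.
  Reducible : ∀ {d} → Vec d → Set _
  Reducible {d} v = Σ (Fin d) λ e → 1 ≤ toℕ e × Σ (Fin (q ^ toℕ e)) λ x → monic {toℕ e} (vec x) ∣ monic v

  Irreducible : ∀ {d} → Vec d → Set _
  Irreducible {d} v = 1 ≤ d × ¬ Reducible v

  opaque
    reducible? : ∀ {d} (v : Vec d) → Dec (Reducible v)
    reducible? v = Fin.any? λ e → (1 ≤? toℕ e) ×-dec Fin.any? λ x → monic∣? {toℕ e} (vec x) (monic v)

    irreducible? : ∀ {d} (v : Vec d) → Dec (Irreducible v)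
    irreducible? {d} v = (1 ≤? d) ×-dec ¬? (reducible? v)

  no-proper-factor : ∀ {d} {v : Vec d} → Irreducible v →
                     ∀ {h e} → Monic h e → 1 ≤ e → e < d → ¬ (h ∣ monic v)
  no-proper-factor {d} {v} (_ , irr) {h} {e} mh 1≤e e<d h∣v =
    irr (fromℕ< e<d , subst (1 ≤_) (sym e≡) 1≤e , code {toℕ (fromℕ< e<d)} (lower _ h) ,
         ∣-respˡ (≋-trans (monic-lower mh′) (monic-cong (≈ᵛ-sym (vec-code (lower _ h))))) h∣v)
    where
    e≡ : toℕ (fromℕ< e<d) ≡ e
    e≡ = Fin.toℕ-fromℕ< e<d
    mh′ : Monic h (toℕ (fromℕ< e<d))
    mh′ = subst (Monic h) (sym e≡) mh

  irreducible-cong : ∀ {d} {u v : Vec d} → u ≈ᵛ v → Irreducible u → Irreducible v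
  irreducible-cong u≈v (1≤d , irr) = 1≤d , λ { (e , 1≤e , x , h) →
    irr (e , 1≤e , x , ∣-respʳ (monic-cong (≈ᵛ-sym u≈v)) h) }

  irreducible-factor : ∀ n (v : Vec n) → 1 ≤ n → ∃₂ λ d (p : Vec d) → Irreducible p × monic p ∣ monic v
  irreducible-factor = <-rec _ λ n rec v 1≤n → step n rec v 1≤n (reducible? v)
    where
    step : ∀ n → (∀ {m} → m < n → (v : Vec m) → 1 ≤ m → ∃₂ λ d (p : Vec d) → Irreducible p × monic p ∣ monic v) →
           (v : Vec n) → 1 ≤ n → Dec (Reducible v) → ∃₂ λ d (p : Vec d) → Irreducible p × monic p ∣ monic v
    step n rec v 1≤n (no irr) = n , v , (1≤n , irr) , (1ᵖ , ≋-sym (⊗-identityʳ _))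
    step n rec v 1≤n (yes (e , 1≤e , x , h)) =
      let (d , p , irr , p∣) = rec (Fin.toℕ<n e) (vec x) 1≤e in d , p , irr , ∣-trans p∣ h

  -- Gauss's descent: a nonzero a of degree less than p with p ∣ ab would, by dividing p by a,
  -- produce one of smaller degree.
  module _ {d} {p : Vec d} (irr : Irreducible p) (b : Poly) (p∤b : ¬ (monic p ∣ b)) where

    euclid-bounded : ∀ m a → Bounded a m → m ≤ d → monic p ∣ a ⊗ b → a ≋ []
    euclid-bounded = <-rec _ λ m rec a ba m≤d h → step m rec a ba m≤d h (zero-or-degree a)
      where
      step : ∀ m → (∀ {m′} → m′ < m → ∀ a → Bounded a m′ → m′ ≤ d → monic p ∣ a ⊗ b → a ≋ []) →
             ∀ a → Bounded a m → m ≤ d → monic p ∣ a ⊗ b → a ≋ [] ⊎ ∃ (HasDegree a) → a ≋ []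
      step m rec a ba m≤d h (inj₁ a≋0) = a≋0
      step m rec a ba m≤d h (inj₂ (e , top , b′)) = ⊥-elim (impossible e ma′ e<m)
        where
        y = proj₁ (inverse (coef a e) top)
        a′ = y · a
        ma′ : Monic a′ e
        ma′ = R.trans (coef-· y a e) (R.trans (R.*-comm _ _) (proj₂ (inverse (coef a e) top))) , Bounded-· b′
        p∣a′b : monic p ∣ a′ ⊗ b
        p∣a′b = ∣-respʳ (≋-sym (·-⊗ y a b)) (∣-· y h)
        e<m : e < m
        e<m = ≰⇒> λ m≤e → top (beyond ba e m≤e)
        impossible : ∀ e → Monic a′ e → e < m → ⊥
        impossible zero ma′ _ =
          p∤b (∣-respʳ (≋-trans (⊗-cong (Monic-0 ma′) ≋-refl) (⊗-identityˡ b)) p∣a′b)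
        -- Write p = a′s + r. Then p divides rb, as it divides pb and a′b; so r = 0 by recursion,
        -- and a′ would be a proper factor of p.
        impossible (suc e) ma′ e<m with divMod ma′ (monic p)
        ... | s , r , eq , br = no-proper-factor irr ma′ (s≤s z≤n) (≤-trans e<m m≤d)
            (s , ≋-trans eq (≋-trans (⊕-cong ≋-refl (rec e<m r br (≤-trans (<⇒≤ e<m) m≤d) p∣rb)) (⊕-identityʳ _)))
          where
          p∣rb : monic p ∣ r ⊗ b
          p∣rb = ∣-summandʳ
            (∣-respʳ (≋-trans (⊗-cong (⊗-comm a′ b) ≋-refl) (≋-trans (⊗-assoc b a′ s) (⊗-comm b _))) (∣-⊗ʳ s p∣a′b))
            (∣-respʳ (≋-trans (⊗-cong eq ≋-refl) (⊗-distribʳ b (a′ ⊗ s) r)) (∣-⊗ʳ b (1ᵖ , ≋-sym (⊗-identityʳ (monic p)))))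

    euclid : ∀ a → monic p ∣ a ⊗ b → monic p ∣ a
    euclid a h with divMod (monic-Monic p) a
    ... | s , r , eq , br = s , ≋-trans eq (≋-trans (⊕-cong ≋-refl (euclid-bounded d r br ≤-refl p∣rb)) (⊕-identityʳ _))
      where
      p∣rb : monic p ∣ r ⊗ b
      p∣rb = ∣-summandʳ
        (∣-⊗ʳ b (s , ≋-refl))
        (∣-respʳ (≋-trans (⊗-cong eq ≋-refl) (⊗-distribʳ b (monic p ⊗ s) r)) h)

  _^ᵖ_ : Poly → ℕ → Poly
  p ^ᵖ zero  = 1ᵖ
  p ^ᵖ suc k = p ⊗ p ^ᵖ k

  Monic-^ᵖ : ∀ {p d} → Monic p d → ∀ k → Monic (p ^ᵖ k) (k * d)
  Monic-^ᵖ mp zero    = R.refl , Bounded-∷ (≋[]⇒Bounded ≋-refl)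
  Monic-^ᵖ mp (suc k) = Monic-⊗ mp (Monic-^ᵖ mp k)

  ∣-⊗-cancelˡ : ∀ {p d} → Monic p d → ∀ {f g} → p ⊗ f ∣ p ⊗ g → f ∣ g
  ∣-⊗-cancelˡ {p} mp {f} {g} (s , e) = s , ⊗-cancelˡ mp g (f ⊗ s) (≋-trans e (⊗-assoc p f s))

  ∣-⊗-monoˡ : ∀ p {f g} → f ∣ g → p ⊗ f ∣ p ⊗ g
  ∣-⊗-monoˡ p {f} (s , e) = s , ≋-trans (⊗-congʳ p e) (≋-sym (⊗-assoc p f s))

  ∣-⊗ˡ : ∀ {p f} g → p ∣ f → p ∣ g ⊗ f
  ∣-⊗ˡ {p} {f} g h = ∣-respʳ (⊗-comm f g) (∣-⊗ʳ g h)

  -- Induction on k: `euclid` takes one factor p out of f, and it is cancelled on both sides.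
  euclid-power : ∀ {d} {p : Vec d} → Irreducible p → ∀ b → ¬ (monic p ∣ b) →
                 ∀ k f → monic p ^ᵖ k ∣ b ⊗ f → monic p ^ᵖ k ∣ f
  euclid-power irr b p∤b zero    f h = f , ≋-sym (⊗-identityˡ f)
  euclid-power {p = p} irr b p∤b (suc k) f h
    with euclid irr b p∤b f (∣-respʳ (⊗-comm b f) (∣-trans (monic p ^ᵖ k , ≋-refl) h))
  ... | f′ , e = ∣-respʳ (≋-sym e) (∣-⊗-monoˡ (monic p) (euclid-power irr b p∤b k f′
                   (∣-⊗-cancelˡ (monic-Monic p) (∣-respʳ swapped h))))
    where
    swapped : b ⊗ f ≋ monic p ⊗ (b ⊗ f′)
    swapped = begin
      b ⊗ f                  ≈⟨ ⊗-congʳ b e ⟩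
      b ⊗ (monic p ⊗ f′)     ≈⟨ ⊗-assoc b (monic p) f′ ⟨
      (b ⊗ monic p) ⊗ f′     ≈⟨ ⊗-cong (⊗-comm b (monic p)) ≋-refl ⟩
      (monic p ⊗ b) ⊗ f′     ≈⟨ ⊗-assoc (monic p) b f′ ⟩
      monic p ⊗ (b ⊗ f′)     ∎
      where open ≋-Reasoning

-- Gauss's count and the existence of irreducible polynomials

module Existence {c ℓ : Level} (F : FiniteField c ℓ) where

  open Vectors F
  open Polynomials F
  open Division F
  open Irreducibles F

  ^ᵖ∣? : ∀ {d} (p : Vec d) k f → Dec (monic p ^ᵖ k ∣ f)
  ^ᵖ∣? p k f = divides? (Monic-^ᵖ (monic-Monic p) k) f

  -- The exponent of p in f, provided B is at least deg f, expressed through the powers p, ..., p^B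
  -- that divide f. In this form its sum over all f reduces to counting multiples of each p^k.
  multiplicity : ∀ {d} → ℕ → Vec d → Poly → ℕ
  multiplicity B p f = sumRange B (λ k → 𝟙 (^ᵖ∣? p (suc k) f))

  divides-irreducible⇒≋ : ∀ {d e} {p : Vec d} {p₀ : Vec e} → Irreducible p → Irreducible p₀ →
                          monic p ∣ monic p₀ → d ≡ e × monic p ≋ monic p₀
  divides-irreducible⇒≋ {d} {e} {p} {p₀} (1≤d , _) irr₀ h@(s , eq)
    with cofactor-monic {s = s} (monic-Monic p) (monic-Monic p₀) eq
  ... | zero  , e≡ , ms = sym (trans e≡ (+-identityʳ d)) ,
        ≋-sym (≋-trans eq (≋-trans (⊗-congʳ (monic p) (Monic-0 ms)) (⊗-identityʳ _)))
  ... | suc x , e≡ , ms = contradiction h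
        (no-proper-factor irr₀ (monic-Monic p) 1≤d (subst (d <_) (sym e≡) (m<m+n d (s≤s z≤n))))

  multiplicity-unit : ∀ {d} B (p : Vec d) → Irreducible p → ∀ f → Monic f 0 → multiplicity B p f ≡ 0
  multiplicity-unit B p (1≤d , _) f mf = sumRange-none B λ k _ → 𝟙-no (^ᵖ∣? p (suc k) f) λ { (s , eq) →
    let (e , 0≡ , _) = cofactor-monic {s = s} (Monic-^ᵖ (monic-Monic p) (suc k)) mf eq in
    <⇒≢ (≤-trans 1≤d (≤-trans (m≤m+n _ _) (m≤m+n _ e))) 0≡ }

  -- If p does not divide p₀, a power of p dividing f already divides f′. Otherwise p is p₀, and
  -- p^(k+1) divides f exactly when p^k divides f′, a shift of the exponents by one.
  multiplicity-⊗ : ∀ {d d₀} B (p : Vec d) (p₀ : Vec d₀) → Irreducible p → Irreducible p₀ →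
                   ∀ {f f′ n} → f ≋ monic p₀ ⊗ f′ → Monic f′ n → n < B →
                   multiplicity B p f ≡ multiplicity B p f′ + 𝟙 (monic∣? p (monic p₀))
  multiplicity-⊗ {d} B p p₀ irr irr₀ {f} {f′} {n} eq mf′ n<B with monic∣? p (monic p₀)
  ... | no p∤p₀ = trans
    (sumRange-cong B λ k _ → 𝟙-cong (^ᵖ∣? p (suc k) f) (^ᵖ∣? p (suc k) f′)
      (λ h → euclid-power irr (monic p₀) p∤p₀ (suc k) f′ (∣-respʳ eq h))
      (λ h → ∣-respʳ (≋-sym eq) (∣-⊗ˡ (monic p₀) h)))
    (sym (+-identityʳ _))
  ... | yes p∣p₀ = begin
    sumRange B (λ k → 𝟙 (^ᵖ∣? p (suc k) f))
      ≡⟨ sumRange-cong B (λ k _ → 𝟙-cong (^ᵖ∣? p (suc k) f) (^ᵖ∣? p k f′)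
           (λ h → ∣-⊗-cancelˡ (monic-Monic p) (∣-respʳ eq′ h))
           (λ h → ∣-respʳ (≋-sym eq′) (∣-⊗-monoˡ (monic p) h))) ⟩
    sumRange B (λ k → 𝟙 (^ᵖ∣? p k f′))
      ≡⟨ +-identityʳ _ ⟨
    sumRange B (λ k → 𝟙 (^ᵖ∣? p k f′)) + 0
      -- The range is prolonged by k = B, where p^B has degree above n and so does not divide f′;
      -- then the term k = 0, which is 1, can be split off.
      ≡⟨ cong (sumRange B (λ k → 𝟙 (^ᵖ∣? p k f′)) +_) (𝟙-no (^ᵖ∣? p B f′) too-big) ⟨
    sumRange (suc B) (λ k → 𝟙 (^ᵖ∣? p k f′))
      ≡⟨ sumRange-front B (λ k → 𝟙 (^ᵖ∣? p k f′)) ⟩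
    𝟙 (^ᵖ∣? p 0 f′) + multiplicity B p f′
      ≡⟨ cong (_+ multiplicity B p f′) (𝟙-yes (^ᵖ∣? p 0 f′) (f′ , ≋-sym (⊗-identityˡ f′))) ⟩
    1 + multiplicity B p f′
      ≡⟨ +-comm 1 _ ⟩
    multiplicity B p f′ + 1 ∎
    where
    open ≡-Reasoning
    eq′ : f ≋ monic p ⊗ f′
    eq′ = ≋-trans eq (⊗-cong (≋-sym (proj₂ (divides-irreducible⇒≋ irr irr₀ p∣p₀))) ≋-refl)
    too-big : ¬ (monic p ^ᵖ B ∣ f′)
    too-big (s , e) = let (x , n≡ , _) = cofactor-monic {s = s} (Monic-^ᵖ (monic-Monic p) B) mf′ e in
      <⇒≱ n<B (subst (B ≤_) (sym n≡) (≤-trans (≤-trans (≤-reflexive (sym (*-identityʳ B))) (*-monoʳ-≤ B (proj₁ irr)))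
                                     (m≤m+n (B * d) x)))

  -- The sum of deg p · g p over the monic irreducible p of degree at most B: the degree is suc d.
  ∑irr : ℕ → (∀ {d} → Vec d → ℕ) → ℕ
  ∑irr B g = sumRange B λ d → sum λ x → 𝟙 (irreducible? {suc d} (vec x)) * (suc d * g {suc d} (vec x))

  private
    𝟙-*-cong : ∀ {a} {A : Set a} (d : Dec A) {m n} → (A → m ≡ n) → 𝟙 d * m ≡ 𝟙 d * n
    𝟙-*-cong (yes x) e = cong (1 *_) (e x)
    𝟙-*-cong (no _)  e = refl

  ∑irr-cong : ∀ B {g h : ∀ {d} → Vec d → ℕ} → (∀ {d} (p : Vec d) → Irreducible p → g p ≡ h p) →
              ∑irr B g ≡ ∑irr B h
  ∑irr-cong B g≡h = sumRange-cong B λ d _ → sum-cong λ x →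
    𝟙-*-cong (irreducible? {suc d} (vec x)) λ irr → cong (suc d *_) (g≡h {suc d} (vec x) irr)

  ∑irr-+ : ∀ B (g h : ∀ {d} → Vec d → ℕ) → ∑irr B (λ p → g p + h p) ≡ ∑irr B g + ∑irr B h
  ∑irr-+ B g h = trans
    (sumRange-cong B λ d _ → trans
      (sum-cong λ x → trans
        (cong (𝟙 (irreducible? {suc d} (vec x)) *_) (*-distribˡ-+ (suc d) (g {suc d} (vec x)) (h {suc d} (vec x))))
        (*-distribˡ-+ (𝟙 (irreducible? {suc d} (vec x))) (suc d * g {suc d} (vec x)) (suc d * h {suc d} (vec x))))
      (sum-+ (λ x → 𝟙 (irreducible? {suc d} (vec x)) * (suc d * g {suc d} (vec x)))
             (λ x → 𝟙 (irreducible? {suc d} (vec x)) * (suc d * h {suc d} (vec x)))))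
    (sumRange-+ B _ _)

  ∑irr-*ˡ : ∀ B y (g : ∀ {d} → Vec d → ℕ) → ∑irr B (λ p → y * g p) ≡ y * ∑irr B g
  ∑irr-*ˡ B y g = trans
    (sumRange-cong B λ d _ → trans
      (sum-cong λ x → trans
        (cong (𝟙 (irreducible? {suc d} (vec x)) *_) (x∙yz≈y∙xz (suc d) y (g {suc d} (vec x))))
        (x∙yz≈y∙xz (𝟙 (irreducible? {suc d} (vec x))) y (suc d * g {suc d} (vec x))))
      (sum-*ˡ y (λ x → 𝟙 (irreducible? {suc d} (vec x)) * (suc d * g {suc d} (vec x)))))
    (sumRange-*ˡ y B _)
    where open import Algebra.Properties.CommutativeSemigroup ℕ.*-commutativeSemigroup using (x∙yz≈y∙xz)

  sum-∑irr : ∀ {N} B (g : Fin N → ∀ {d} → Vec d → ℕ) →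
             sum (λ i → ∑irr B (g i)) ≡ ∑irr B (λ p → sum (λ i → g i p))
  sum-∑irr {N} B g = trans
    (sumRange-sum B λ d i → sum λ x → term d x i)
    (sumRange-cong B λ d _ → trans (sum-swap (λ i x → term d x i)) (sum-cong λ x → trans
      (sum-*ˡ (𝟙 (irreducible? {suc d} (vec x))) (λ i → suc d * g i {suc d} (vec x)))
      (cong (𝟙 (irreducible? {suc d} (vec x)) *_) (sum-*ˡ (suc d) (λ i → g i {suc d} (vec x))))))
    where
    term : ∀ d → Fin (q ^ suc d) → Fin N → ℕ
    term d x i = 𝟙 (irreducible? {suc d} (vec x)) * (suc d * g i {suc d} (vec x))

  -- The only monic irreducible divisor of p₀ is p₀ itself, so one term survives, weighted by its
  -- degree.
  ∑irr-divisors : ∀ B {d₀} (p₀ : Vec d₀) → Irreducible p₀ → d₀ ≤ B →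
                  ∑irr B (λ p → 𝟙 (monic∣? p (monic p₀))) ≡ d₀
  ∑irr-divisors B {zero}   p₀ (() , _) d₀≤B
  ∑irr-divisors B {suc d₀} p₀ irr₀ d₀<B = trans
    (sumRange-single B d₀ d₀<B λ d _ d≢d₀ →
      trans (sum-cong λ x → zero-term d x λ irr h → d≢d₀ (suc-injective (proj₁ (divides-irreducible⇒≋ {p = vec x} {p₀} irr irr₀ h))))
            (trans (sum-const (q ^ suc d) 0) (*-zeroʳ (q ^ suc d))))
    (trans
      (sum-single (term d₀) (code p₀) λ x x≢ → zero-term d₀ x λ irr h →
        x≢ (trans (sym (code-vec {suc d₀} x)) (code-cong (monic-injective {u = vec x} {p₀} (proj₂ (divides-irreducible⇒≋ {p = vec x} {p₀} irr irr₀ h))))))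
      (trans (cong₂ (λ a b → a * (suc d₀ * b))
               (𝟙-yes (irreducible? (vec (code p₀))) (irreducible-cong (≈ᵛ-sym (vec-code p₀)) irr₀))
               (𝟙-yes (monic∣? (vec (code p₀)) (monic p₀)) (1ᵖ , ≋-trans (monic-cong (≈ᵛ-sym (vec-code p₀))) (≋-sym (⊗-identityʳ _)))))
             (trans (*-identityˡ _) (*-identityʳ _))))
    where
    term : ∀ d → Fin (q ^ suc d) → ℕ
    term d x = 𝟙 (irreducible? {suc d} (vec x)) * (suc d * 𝟙 (monic∣? {suc d} (vec x) (monic p₀)))
    zero-term : ∀ d x → (Irreducible {suc d} (vec x) → ¬ (monic {suc d} (vec x) ∣ monic p₀)) → term d x ≡ 0
    zero-term d x none = trans
      (𝟙-*-cong (irreducible? {suc d} (vec x)) λ irr →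
        trans (cong (suc d *_) (𝟙-no (monic∣? {suc d} (vec x) (monic p₀)) (none irr))) (*-zeroʳ (suc d)))
      (*-zeroʳ (𝟙 (irreducible? {suc d} (vec x))))

  -- Induction on the degree: splitting off an irreducible factor p₀ lowers the multiplicity of p₀
  -- alone, by one, and the degree by deg p₀.
  degree≡∑multiplicity : ∀ B n (v : Vec n) → n ≤ B → ∑irr B (λ p → multiplicity B p (monic v)) ≡ n
  degree≡∑multiplicity B n v n≤B = go n (monic-Monic v) n≤B
    where
    go : ∀ n {f} → Monic f n → n ≤ B → ∑irr B (λ p → multiplicity B p f) ≡ n
    go = <-rec _ λ { zero _ {f} mf _ →
                       trans (∑irr-cong B {h = λ _ → 0} (λ p irr → multiplicity-unit B p irr f mf)) (∑irr-zero B)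
                   ; (suc n) rec mf n≤B → step n rec mf n≤B }
      where
      ∑irr-zero : ∀ B → ∑irr B (λ _ → 0) ≡ 0
      ∑irr-zero B = sumRange-none B λ d _ → trans
        (sum-cong λ x → trans (cong (𝟙 (irreducible? {suc d} (vec x)) *_) (*-zeroʳ (suc d))) (*-zeroʳ (𝟙 (irreducible? {suc d} (vec x)))))
        (trans (sum-const (q ^ suc d) 0) (*-zeroʳ (q ^ suc d)))
      step : ∀ n → (∀ {m} → m < suc n → ∀ {f} → Monic f m → m ≤ B → ∑irr B (λ p → multiplicity B p f) ≡ m) →
             ∀ {f} → Monic f (suc n) → suc n ≤ B → ∑irr B (λ p → multiplicity B p f) ≡ suc n
      step n rec {f} mf n<B
        with irreducible-factor (suc n) (lower (suc n) f) (s≤s z≤n)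
      ... | d₀ , p₀ , irr₀ , (s , e)
        with cofactor-monic {s = s} (monic-Monic p₀) mf (≋-trans (monic-lower mf) e)
      ...   | n′ , n≡ , ms = begin
        ∑irr B (λ p → multiplicity B p f)
          ≡⟨ ∑irr-cong B (λ p irr → multiplicity-⊗ B p p₀ irr irr₀ (≋-trans (monic-lower mf) e) ms (≤-trans n′<n n<B)) ⟩
        ∑irr B (λ p → multiplicity B p s + 𝟙 (monic∣? p (monic p₀)))
          ≡⟨ ∑irr-+ B (λ p → multiplicity B p s) (λ p → 𝟙 (monic∣? p (monic p₀))) ⟩
        ∑irr B (λ p → multiplicity B p s) + ∑irr B (λ p → 𝟙 (monic∣? p (monic p₀)))
          ≡⟨ cong₂ _+_ (rec n′<n ms (≤-trans (<⇒≤ n′<n) n<B))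
               (∑irr-divisors B p₀ irr₀ (≤-trans (subst (d₀ ≤_) (sym n≡) (m≤m+n d₀ n′)) n<B)) ⟩
        n′ + d₀  ≡⟨ +-comm n′ d₀ ⟩
        d₀ + n′  ≡⟨ n≡ ⟨
        suc n    ∎
        where
        open ≡-Reasoning
        n′<n : n′ < suc n
        n′<n = subst (n′ <_) (sym n≡) (m<n+m n′ (proj₁ irr₀))

  -- A multiple of h of degree m + d has exactly one monic cofactor, of degree d; hence divisibility
  -- of v by h is a sum of indicators over the possible cofactors s.
  count-multiples : ∀ {h m} (mh : Monic h m) d → sumᵛ {m + d} (λ v → 𝟙 (divides? mh (monic v))) ≡ q ^ d
  count-multiples {h} {m} mh d = begin
    sumᵛ (λ v → 𝟙 (divides? mh (monic v)))
      ≡⟨ sum-cong (λ x → sym (quotients (vec x))) ⟩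
    sumᵛ (λ v → sumᵛ {d} (λ s → 𝟙 (v ≟ᵛ multiple s)))
      ≡⟨ sum-swap (λ x y → 𝟙 (vec {m + d} x ≟ᵛ multiple (vec {d} y))) ⟩
    sumᵛ {d} (λ s → sumᵛ (λ v → 𝟙 (v ≟ᵛ multiple s)))
      ≡⟨ sum-cong (λ y → countᵛ-unique (_≟ᵛ multiple (vec y)) (multiple (vec y)) (λ e → e) (λ _ e → e)) ⟩
    sumᵛ {d} (λ s → 1)
      ≡⟨ trans (sum-const (q ^ d) 1) (*-identityʳ _) ⟩
    q ^ d ∎
    where
    open ≡-Reasoning
    multiple : Vec d → Vec (m + d)
    multiple s = lower (m + d) (h ⊗ monic s)
    multiple-≋ : ∀ s → h ⊗ monic s ≋ monic (multiple s)
    multiple-≋ s = monic-lower (Monic-⊗ mh (monic-Monic s))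
    quotients : ∀ v → sumᵛ {d} (λ s → 𝟙 (v ≟ᵛ multiple s)) ≡ 𝟙 (divides? mh (monic v))
    quotients v with divides? mh (monic v)
    ... | no h∤v = count-none (λ y → v ≟ᵛ multiple (vec y)) λ y e →
          h∤v (monic (vec y) , ≋-trans (monic-cong e) (≋-sym (multiple-≋ (vec y))))
    ... | yes (s , eq) with cofactor-monic {s = s} mh (monic-Monic v) eq
    ...   | d′ , m+d≡m+d′ , ms with +-cancelˡ-≡ m d d′ m+d≡m+d′
    ...     | refl = countᵛ-unique (λ s → v ≟ᵛ multiple s) (lower d s)
              (λ {u} u≈ → lower-unique u (≋-trans eq (⊗-congʳ h (≋-trans (monic-lower ms) (monic-cong (≈ᵛ-sym u≈))))))
              (λ u e → monic-injective (⊗-cancelˡ mh (monic u) (monic (lower d s))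
                 (≋-trans (multiple-≋ u) (≋-trans (monic-cong (≈ᵛ-sym e)) (≋-trans eq (⊗-congʳ h (monic-lower ms)))))))
      where
      lower-unique : ∀ u → monic v ≋ h ⊗ monic u → v ≈ᵛ multiple u
      lower-unique u e = monic-injective (≋-trans e (multiple-≋ u))

  -- The indicator is needed for m > n, where truncated subtraction alone would yield q^0 = 1.
  multiples : ℕ → ℕ → ℕ
  multiples n m = 𝟙 (m ≤? n) * q ^ (n ∸ m)

  count-multiples′ : ∀ {h m} (mh : Monic h m) n → sumᵛ {n} (λ v → 𝟙 (divides? mh (monic v))) ≡ multiples n m
  count-multiples′ {h} {m} mh n with m ≤? n
  ... | no m≰n = count-none (λ x → divides? mh (monic {n} (vec x))) λ { x (s , eq) →
        m≰n (let (d , n≡ , _) = cofactor-monic {s = s} mh (monic-Monic {n} (vec x)) eq in subst (m ≤_) (sym n≡) (m≤m+n m d)) }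
  ... | yes m≤n = subst (λ n′ → sumᵛ {n′} (λ v → 𝟙 (divides? mh (monic v))) ≡ 1 * q ^ (n ∸ m))
                        (m+[n∸m]≡n m≤n) (trans (count-multiples mh (n ∸ m)) (sym (*-identityˡ _)))

  -- Subtracting q times `∑irr-multiples` for n from its instance for n + 1 leaves only the prime
  -- powers of degree exactly n + 1 on one side and (n + 1)q^(n+1) - q · nq^n = q^(n+1) on the
  -- other.
  multiples-suc : ∀ n m → multiples (suc n) m ≡ q * multiples n m + 𝟙 (m ℕ.≟ suc n)
  multiples-suc n m with m ≤? n | m ≤? suc n | m ℕ.≟ suc n
  ... | yes m≤n | yes _    | no _     = trans (*-identityˡ _)
        (trans (cong (q ^_) (+-∸-assoc 1 m≤n)) (sym (trans (+-identityʳ _) (cong (q *_) (*-identityˡ _)))))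
  ... | yes m≤n | yes _    | yes refl = contradiction m≤n (<⇒≱ ≤-refl)
  ... | yes m≤n | no m≰    | _        = contradiction (m≤n⇒m≤1+n m≤n) m≰
  ... | no m≰n  | yes m≤   | no m≢    = contradiction (s≤s⁻¹ (≤∧≢⇒< m≤ m≢)) m≰n
  ... | no m≰n  | yes _    | yes refl = trans (*-identityˡ _)
        (trans (cong (q ^_) (n∸n≡0 n)) (sym (cong (_+ 1) (*-zeroʳ q))))
  ... | no m≰n  | no m≰    | yes refl = contradiction ≤-refl m≰
  ... | no m≰n  | no m≰    | no _     = sym (cong (_+ 0) (*-zeroʳ q))

  -- Two evaluations of ∑ deg f over the q^n monic f of degree n: directly, and with the sum over f
  -- moved inside, where it counts the multiples of each p^k.
  ∑irr-multiples : ∀ B n → n ≤ B → ∑irr B (λ {d} p → sumRange B (λ k → multiples n (suc k * d))) ≡ n * q ^ n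
  ∑irr-multiples B n n≤B = begin
    ∑irr B (λ {d} p → sumRange B (λ k → multiples n (suc k * d)))
      ≡⟨ ∑irr-cong B (λ p _ → sym (trans
           (sumRange-sum B (λ k x → 𝟙 (^ᵖ∣? p (suc k) (monic {n} (vec x)))))
           (sumRange-cong B (λ k _ → count-multiples′ (Monic-^ᵖ (monic-Monic p) (suc k)) n)))) ⟩
    ∑irr B (λ p → sumᵛ {n} (λ v → multiplicity B p (monic v)))
      ≡⟨ sum-∑irr B (λ x p → multiplicity B p (monic {n} (vec x))) ⟨
    sumᵛ {n} (λ v → ∑irr B (λ p → multiplicity B p (monic v)))
      ≡⟨ sum-cong (λ x → degree≡∑multiplicity B n (vec x) n≤B) ⟩
    sumᵛ {n} (λ v → n)
      ≡⟨ trans (sum-const (q ^ n) n) (*-comm (q ^ n) n) ⟩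
    n * q ^ n ∎
    where open ≡-Reasoning

  -- For d ≥ 1 and 1 ≤ n ≤ B this is the indicator of d ∣ n, with n = (k + 1)d the degree of p^(k+1)
  -- for p of degree d.
  exponents : ℕ → ℕ → ℕ → ℕ
  exponents B n d = sumRange B (λ k → 𝟙 (suc k * d ℕ.≟ n))

  -- Gauss's formula ∑_{d ∣ n} d · N_d = q^n.
  ∑irr-exponents : ∀ B n → suc n ≤ B → ∑irr B (λ {d} p → exponents B (suc n) d) ≡ q ^ suc n
  ∑irr-exponents B n n<B = +-cancelˡ-≡ (n * q ^ suc n) _ _ (begin
    n * q ^ suc n + W
      ≡⟨ cong (_+ W) (x∙yz≈y∙xz n q (q ^ n)) ⟩
    q * (n * q ^ n) + W
      ≡⟨ cong (λ y → q * y + W) (∑irr-multiples B n (<⇒≤ n<B)) ⟨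
    q * ∑irr B (λ {d} p → sumRange B (λ k → multiples n (suc k * d))) + W
      ≡⟨ cong (_+ W) (∑irr-*ˡ B q (λ {d} p → sumRange B (λ k → multiples n (suc k * d)))) ⟨
    ∑irr B (λ {d} p → q * sumRange B (λ k → multiples n (suc k * d))) + W
      ≡⟨ ∑irr-+ B (λ {d} p → q * sumRange B (λ k → multiples n (suc k * d))) (λ {d} p → exponents B (suc n) d) ⟨
    ∑irr B (λ {d} p → q * sumRange B (λ k → multiples n (suc k * d)) + exponents B (suc n) d)
      ≡⟨ ∑irr-cong B (λ {d} p _ → trans
           (cong (_+ exponents B (suc n) d) (sym (sumRange-*ˡ q B (λ k → multiples n (suc k * d)))))
           (sym (trans (sumRange-cong B (λ k _ → multiples-suc n (suc k * d))) (sumRange-+ B _ _)))) ⟩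
    ∑irr B (λ {d} p → sumRange B (λ k → multiples (suc n) (suc k * d)))
      ≡⟨ ∑irr-multiples B (suc n) n<B ⟩
    q ^ suc n + n * q ^ suc n
      ≡⟨ +-comm (q ^ suc n) _ ⟩
    n * q ^ suc n + q ^ suc n ∎)
    where
    open ≡-Reasoning
    open import Algebra.Properties.CommutativeSemigroup ℕ.*-commutativeSemigroup using (x∙yz≈y∙xz)
    W = ∑irr B (λ {d} p → exponents B (suc n) d)

  -- Indexed as in `∑irr`: the argument d stands for degree d + 1.
  irreducibles : ℕ → ℕ
  irreducibles d = sumᵛ {suc d} (λ v → 𝟙 (irreducible? v))

  ∑irr-by-degree : ∀ B (g : ℕ → ℕ) → ∑irr B (λ {d} p → g d) ≡ sumRange B (λ d → irreducibles d * (suc d * g (suc d)))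
  ∑irr-by-degree B g = sumRange-cong B λ d _ → sum-*ʳ (suc d * g (suc d)) (λ x → 𝟙 (irreducible? {suc d} (vec x)))

  -- One term of Gauss's formula for degree d + 1, namely that of the irreducibles of degree d + 1
  -- itself.
  irreducibles-bound : ∀ d → irreducibles d * suc d ≤ q ^ suc d
  irreducibles-bound d = begin
    irreducibles d * suc d
      ≤⟨ *-monoʳ-≤ (irreducibles d) (≤-trans (≤-reflexive (sym (*-identityʳ (suc d)))) (*-monoʳ-≤ (suc d) 1≤)) ⟩
    irreducibles d * (suc d * exponents (suc d) (suc d) (suc d))
      ≤⟨ term≤sumRange (suc d) (λ e → irreducibles e * (suc e * exponents (suc d) (suc d) (suc e))) ≤-refl ⟩
    sumRange (suc d) (λ e → irreducibles e * (suc e * exponents (suc d) (suc d) (suc e)))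
      ≡⟨ ∑irr-by-degree (suc d) (exponents (suc d) (suc d)) ⟨
    ∑irr (suc d) (λ {e} p → exponents (suc d) (suc d) e)
      ≡⟨ ∑irr-exponents (suc d) d ≤-refl ⟩
    q ^ suc d ∎
    where
    open ≤-Reasoning
    1≤ : 1 ≤ exponents (suc d) (suc d) (suc d)
    1≤ = ≤-trans (≤-reflexive (sym (𝟙-yes (1 * suc d ℕ.≟ suc d) (*-identityˡ (suc d)))))
                 (term≤sumRange (suc d) (λ k → 𝟙 (suc k * suc d ℕ.≟ suc d)) (s≤s z≤n))

  exponents≤1 : ∀ B n d → exponents B n (suc d) ≤ 1
  exponents≤1 zero    n d = z≤n
  exponents≤1 (suc B) n d with suc B * suc d ℕ.≟ n
  ... | no _     = ≤-trans (≤-reflexive (+-identityʳ _)) (exponents≤1 B n d)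
  ... | yes refl = ≤-reflexive (cong (_+ 1) (sumRange-none B λ k k<B →
        𝟙-no (suc k * suc d ℕ.≟ n) (<⇒≢ (*-monoˡ-< (suc d) (s≤s k<B)))))

  geometric-< : ∀ n → sumRange n (λ d → q ^ suc d) < q ^ suc n
  geometric-< zero    = >-nonZero⁻¹ (q ^ 1) {{m^n≢0 q 1}}
  geometric-< (suc n) = begin-strict
    sumRange n (λ d → q ^ suc d) + q ^ suc n  <⟨ +-monoˡ-< (q ^ suc n) (geometric-< n) ⟩
    q ^ suc n + q ^ suc n                     ≡⟨ cong (q ^ suc n +_) (+-identityʳ _) ⟨
    2 * q ^ suc n                             ≤⟨ *-monoˡ-≤ (q ^ suc n) 2≤q ⟩
    q * q ^ suc n                             ∎
    where open ≤-Reasoning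

  -- Without irreducibles of degree n + 1, Gauss's sum for q^(n+1) has terms for degrees 1 to n
  -- only. By `irreducibles-bound` they are at most q, ..., q^n, and these add up to less than
  -- q^(n+1).
  irreducible-exists : ∀ n → Σ (Vec (suc n)) Irreducible
  irreducible-exists n with Fin.any? (λ x → irreducible? {suc n} (vec x))
  ... | yes (x , irr) = vec x , irr
  ... | no none = contradiction (begin-strict
    q ^ suc n
      ≡⟨ ∑irr-exponents (suc n) n ≤-refl ⟨
    ∑irr (suc n) (λ {d} p → exponents (suc n) (suc n) d)
      ≡⟨ ∑irr-by-degree (suc n) (exponents (suc n) (suc n)) ⟩
    sumRange n (λ d → irreducibles d * (suc d * e d)) + irreducibles n * (suc n * e n)
      ≡⟨ cong (λ y → sumRange n (λ d → irreducibles d * (suc d * e d)) + y * (suc n * e n))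
           (count-none (λ x → irreducible? {suc n} (vec x)) (λ x irr → none (x , irr))) ⟩
    sumRange n (λ d → irreducibles d * (suc d * e d)) + 0
      ≡⟨ +-identityʳ _ ⟩
    sumRange n (λ d → irreducibles d * (suc d * e d))
      ≤⟨ sumRange-mono-≤ n (λ d _ → ≤-trans
           (*-monoʳ-≤ (irreducibles d) (≤-trans (*-monoʳ-≤ (suc d) (exponents≤1 (suc n) (suc n) d)) (≤-reflexive (*-identityʳ (suc d)))))
           (irreducibles-bound d)) ⟩
    sumRange n (λ d → q ^ suc d)
      <⟨ geometric-< n ⟩
    q ^ suc n ∎) (<-irrefl refl)
    where
    open ≤-Reasoning
    e : ℕ → ℕ
    e d = exponents (suc n) (suc n) (suc d)

-- Multiplication modulo an irreducible polynomial

module Multiplication {c ℓ : Level} (F : FiniteField c ℓ) where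

  open Vectors F
  open Polynomials F
  open Division F
  open Irreducibles F
  open Existence F

  poly : ∀ {d} → Vec d → Poly
  poly {zero}  v = []
  poly {suc d} v = v zero ∷ poly (v ∘ suc)

  poly-cong : ∀ {d} {u v : Vec d} → u ≈ᵛ v → poly u ≋ poly v
  poly-cong {zero}  e = ≋-refl
  poly-cong {suc d} e = ∷-cong (e zero) (poly-cong (e ∘ suc))

  poly-+ : ∀ {d} (u v : Vec d) → poly (u +ᵛ v) ≋ poly u ⊕ poly v
  poly-+ {zero}  u v = ≋-refl
  poly-+ {suc d} u v = ∷-cong R.refl (poly-+ (u ∘ suc) (v ∘ suc))

  poly-* : ∀ {d} x (v : Vec d) → poly (x *ᵛ v) ≋ x · poly v
  poly-* {zero}  x v = ≋-refl
  poly-* {suc d} x v = ∷-cong R.refl (poly-* x (v ∘ suc))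

  poly-Bounded : ∀ {d} (v : Vec d) → Bounded (poly v) d
  poly-Bounded {zero}  v = ≋[]⇒Bounded ≋-refl
  poly-Bounded {suc d} v = Bounded-∷ (poly-Bounded (v ∘ suc))

  poly≋[]⇒≈0 : ∀ {d} {v : Vec d} → poly v ≋ [] → v ≈ᵛ 0ᵛ
  poly≋[]⇒≈0 {suc d} e zero    = at e zero
  poly≋[]⇒≈0 {suc d} e (suc i) = poly≋[]⇒≈0 (∷-tail e) i

  lower≈0⇒≋[] : ∀ {d f} → Bounded f d → lower d f ≈ᵛ 0ᵛ → f ≋ []
  lower≈0⇒≋[] {zero}  b e = Bounded-0⇒≋[] b
  lower≈0⇒≋[] {suc d} {[]}    b e = ≋-refl
  lower≈0⇒≋[] {suc d} {a ∷ f} b e = ∷-zero (e zero) (lower≈0⇒≋[] (Bounded-tail b) (e ∘ suc))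

  -- A relation stable under sums and scalar multiples, whose r is unique. Bilinearity of the
  -- multiplication follows from these properties alone, without following the steps of `divMod`.
  record IsRemainder (p : Poly) (d : ℕ) (f r : Poly) : Set (c Level.⊔ ℓ) where
    constructor _,_
    field
      below     : Bounded r d
      congruent : p ∣ f ⊕ -1ᶠ · r

  module _ {p : Poly} {d : ℕ} (mp : Monic p d) where

    opaque
      remainder : Poly → Poly
      remainder f = proj₁ (proj₂ (divMod mp f))

      remainder-isRemainder : ∀ f → IsRemainder p d f (remainder f)
      remainder-isRemainder f with divMod mp f
      ... | s , r , eq , br = br , (s , (begin
        f ⊕ -1ᶠ · r              ≈⟨ ⊕-cong eq ≋-refl ⟩
        (p ⊗ s ⊕ r) ⊕ -1ᶠ · r    ≈⟨ ⊕-assoc (p ⊗ s) r _ ⟩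
        p ⊗ s ⊕ (r ⊕ -1ᶠ · r)    ≈⟨ ⊕-cong ≋-refl (⊕-cancelled r) ⟩
        p ⊗ s ⊕ []               ≈⟨ ⊕-identityʳ _ ⟩
        p ⊗ s                    ∎))
        where open ≋-Reasoning

    isRemainder-cong : ∀ {f g r} → f ≋ g → IsRemainder p d f r → IsRemainder p d g r
    isRemainder-cong e (b , h) = b , ∣-respʳ (⊕-cong e ≋-refl) h

    isRemainder-⊕ : ∀ {f g r s} → IsRemainder p d f r → IsRemainder p d g s → IsRemainder p d (f ⊕ g) (r ⊕ s)
    isRemainder-⊕ {f} {g} {r} {s} (b , h) (b′ , h′) = Bounded-⊕ b b′ ,
      ∣-respʳ (≋-trans (⊕-interchange f _ g _) (⊕-cong ≋-refl (≋-sym (·-distribˡ -1ᶠ r s)))) (∣-⊕ h h′)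

    isRemainder-· : ∀ x {f r} → IsRemainder p d f r → IsRemainder p d (x · f) (x · r)
    isRemainder-· x {f} {r} (b , h) = Bounded-· b ,
      ∣-respʳ (≋-trans (·-distribˡ x f _) (⊕-cong ≋-refl
        (≋-trans (≋-sym (·-assoc x -1ᶠ r)) (≋-trans (·-cong (R.*-comm x -1ᶠ) ≋-refl) (·-assoc -1ᶠ x r)))))
        (∣-· x h)

    isRemainder-unique : ∀ {f r s} → IsRemainder p d f r → IsRemainder p d f s → r ≋ s
    isRemainder-unique {f} {r} {s} (b , h) (b′ , h′) = coefs λ i → x+-1*y≈0⇒x≈y
      (R.trans (R.sym (R.trans (coef-⊕ r _ i) (R.+-congˡ (coef-· -1ᶠ s i)))) (at difference i))
      where
      p∣difference : p ∣ r ⊕ -1ᶠ · s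
      p∣difference = ∣-summandʳ h (∣-respʳ (begin
        f ⊕ -1ᶠ · s                        ≈⟨ ⊕-cong (⊕-identityʳ f) ≋-refl ⟨
        (f ⊕ []) ⊕ -1ᶠ · s                 ≈⟨ ⊕-cong {f ⊕ (-1ᶠ · r ⊕ r)} (⊕-cong {f} ≋-refl (≋-trans (⊕-comm (-1ᶠ · r) r) (⊕-cancelled r))) ≋-refl ⟨
        (f ⊕ (-1ᶠ · r ⊕ r)) ⊕ -1ᶠ · s      ≈⟨ ⊕-cong (⊕-assoc f _ r) ≋-refl ⟨
        ((f ⊕ -1ᶠ · r) ⊕ r) ⊕ -1ᶠ · s      ≈⟨ ⊕-assoc (f ⊕ -1ᶠ · r) r _ ⟩
        (f ⊕ -1ᶠ · r) ⊕ (r ⊕ -1ᶠ · s)      ∎) h′)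
        where open ≋-Reasoning
      difference : r ⊕ -1ᶠ · s ≋ []
      difference = ∣-bounded⇒zero mp (Bounded-⊕ b (Bounded-· b′)) p∣difference

    remainder≋[]⇒∣ : ∀ {f} → remainder f ≋ [] → p ∣ f
    remainder≋[]⇒∣ {f} e = ∣-respʳ
      (≋-trans (⊕-cong ≋-refl (·-cong R.refl e)) (⊕-identityʳ f))
      (IsRemainder.congruent (remainder-isRemainder f))

  -- For b ≥ 1 this amounts to a linear space of q^a maps F^b → F^a in which every nonzero map is
  -- injective.
  record NonsingularMultiplication (a b : ℕ) : Set (c Level.⊔ ℓ) where
    field
      mul        : Vec a → Vec b → Vec a
      mul-cong   : ∀ {α β x y} → α ≈ᵛ β → x ≈ᵛ y → mul α x ≈ᵛ mul β y
      mul-+ˡ     : ∀ α β x → mul (α +ᵛ β) x ≈ᵛ (mul α x +ᵛ mul β x)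
      mul-*ˡ     : ∀ y α x → mul (y *ᵛ α) x ≈ᵛ (y *ᵛ mul α x)
      mul-+ʳ     : ∀ α x y → mul α (x +ᵛ y) ≈ᵛ (mul α x +ᵛ mul α y)
      mul-*ʳ     : ∀ y α x → mul α (y *ᵛ x) ≈ᵛ (y *ᵛ mul α x)
      mul≈0      : ∀ α x → mul α x ≈ᵛ 0ᵛ → α ≈ᵛ 0ᵛ ⊎ x ≈ᵛ 0ᵛ

  -- Multiplication of polynomials modulo an irreducible polynomial of degree suc a.
  nonsingularMultiplication : ∀ a {b} → b ≤ suc a → NonsingularMultiplication (suc a) b
  nonsingularMultiplication a′ {b} b≤a with irreducible-exists a′
  ... | p , irr = record
    { mul      = mul
    ; mul-cong = λ {α} {β} {x} {y} e e′ → lower-cong (unique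
        (isRemainder-cong mp (⊗-cong (poly-cong e) (poly-cong e′)) (isRem α x)) (isRem β y))
    ; mul-+ˡ = λ α β x → pointwise-+ {g = product α x} {product β x} (unique (isRem (α +ᵛ β) x)
        (isRemainder-cong mp (≋-sym (≋-trans (⊗-cong (poly-+ α β) ≋-refl) (⊗-distribʳ (poly x) (poly α) (poly β))))
          (isRemainder-⊕ mp (isRem α x) (isRem β x))))
    ; mul-*ˡ = λ y α x → pointwise-* (unique (isRem (y *ᵛ α) x)
        (isRemainder-cong mp (≋-sym (≋-trans (⊗-cong (poly-* y α) ≋-refl) (·-⊗ y (poly α) (poly x))))
          (isRemainder-· mp y (isRem α x))))
    ; mul-+ʳ = λ α x y → pointwise-+ {g = product α x} {product α y} (unique (isRem α (x +ᵛ y))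
        (isRemainder-cong mp (≋-sym (≋-trans (⊗-congʳ (poly α) (poly-+ x y)) (⊗-distribˡ (poly α) (poly x) (poly y))))
          (isRemainder-⊕ mp (isRem α x) (isRem α y))))
    ; mul-*ʳ = λ y α x → pointwise-* (unique (isRem α (y *ᵛ x))
        (isRemainder-cong mp (≋-sym (≋-trans (⊗-congʳ (poly α) (poly-* y x)) (≋-trans (⊗-comm (poly α) _)
            (≋-trans (·-⊗ y (poly x) (poly α)) (·-cong R.refl (⊗-comm (poly x) (poly α)))))))
          (isRemainder-· mp y (isRem α x))))
    ; mul≈0 = mul≈0
    }
    where
    a = suc a′
    mp = monic-Monic p
    product : Vec a → Vec b → Poly
    product α x = remainder mp (poly α ⊗ poly x)
    mul : Vec a → Vec b → Vec a
    mul α x = lower a (product α x)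
    isRem : ∀ α (x : Vec b) → IsRemainder (monic p) a (poly α ⊗ poly x) (product α x)
    isRem α x = remainder-isRemainder mp (poly α ⊗ poly x)
    unique : ∀ {f r s} → IsRemainder (monic p) a f r → IsRemainder (monic p) a f s → r ≋ s
    unique = isRemainder-unique mp
    pointwise-+ : ∀ {f g h} → f ≋ g ⊕ h → lower a f ≈ᵛ (lower a g +ᵛ lower a h)
    pointwise-+ {f} {g} {h} e i = R.trans (at e (toℕ i)) (coef-⊕ g h (toℕ i))
    pointwise-* : ∀ {f y g} → f ≋ y · g → lower a f ≈ᵛ (y *ᵛ lower a g)
    pointwise-* {f} {y} {g} e i = R.trans (at e (toℕ i)) (coef-· y g (toℕ i))
    mul≈0 : ∀ α x → mul α x ≈ᵛ 0ᵛ → α ≈ᵛ 0ᵛ ⊎ x ≈ᵛ 0ᵛ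
    -- Both α and, by b ≤ a, also x have degree below that of p, so whichever of them p divides is
    -- zero.
    mul≈0 α x e with monic∣? p (poly x)
    ... | yes p∣x = inj₂ (poly≋[]⇒≈0 (∣-bounded⇒zero mp (Bounded-weaken b≤a (poly-Bounded x)) p∣x))
    ... | no  p∤x = inj₁ (poly≋[]⇒≈0 (∣-bounded⇒zero mp (poly-Bounded α) (euclid {p = p} irr (poly x) p∤x (poly α)
          (remainder≋[]⇒∣ mp (lower≈0⇒≋[] (IsRemainder.below (isRem α x)) e)))))

-- Construction of subspace partitions

module Construction {c ℓ : Level} (F : FiniteField c ℓ) where

  open Vectors F
  open Multiplication F

  -- Pigeonhole: a missed value could be punched out, leaving an injection of `Fin (suc n)` into
  -- `Fin n`.
  injective⇒surjective : ∀ {n} (f : Fin n → Fin n) → (∀ {i j} → f i ≡ f j → i ≡ j) → ∀ y → ∃ λ x → f x ≡ y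
  injective⇒surjective {suc n} f inj y with Fin.any? (λ x → f x Fin.≟ y)
  ... | yes hit  = hit
  ... | no  miss = contradiction
        (Fin.injective⇒≤ {f = λ x → punchOut (λ y≡fx → miss (x , sym y≡fx))}
          (λ {i} {j} e → inj (Fin.punchOut-injective (λ y≡fx → miss (i , sym y≡fx)) (λ y≡fx → miss (j , sym y≡fx)) e)))
        (<⇒≱ ≤-refl)

  infixr 5 _⧺_

  _⧺_ : ∀ {b a} → Vec b → Vec a → Vec (b + a)
  _⧺_ {b} u v i = [ u , v ]′ (splitAt b i)

  ⧺-left : ∀ {b a} (u : Vec b) (v : Vec a) i → (u ⧺ v) (i ↑ˡ a) ≡ u i
  ⧺-left {b} {a} u v i = cong [ u , v ]′ (Fin.splitAt-↑ˡ b i a)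

  ⧺-right : ∀ {b a} (u : Vec b) (v : Vec a) i → (u ⧺ v) (b ↑ʳ i) ≡ v i
  ⧺-right {b} {a} u v i = cong [ u , v ]′ (Fin.splitAt-↑ʳ b a i)

  left : ∀ {b a} → Vec (b + a) → Vec b
  left {b} {a} v i = v (i ↑ˡ a)

  right : ∀ b {a} → Vec (b + a) → Vec a
  right b v i = v (b ↑ʳ i)

  halves-≈ : ∀ b {a} {u v : Vec (b + a)} → left {b} u ≈ᵛ left {b} v → right b u ≈ᵛ right b v → u ≈ᵛ v
  halves-≈ b {a} {u} {v} el er i with splitAt b i in eq
  ... | inj₁ j = subst (λ k → u k ≈ v k) (Fin.splitAt⁻¹-↑ˡ eq) (el j)
  ... | inj₂ j = subst (λ k → u k ≈ v k) (Fin.splitAt⁻¹-↑ʳ eq) (er j)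

  fullSubspace : ∀ m → Subspace m
  fullSubspace m = record
    { dim = m ; basis = δ ; indep = λ cs e j → R.trans (R.sym (∑-δ cs j)) (e j) }

  trivialPartition : ∀ {m} → 1 ≤ m → SubspacePartition m
  trivialPartition {m} 1≤m = record
    { size = 1
    ; part = λ _ → fullSubspace m
    ; nonzero = λ _ → 1≤m
    ; cover = λ v _ → zero , (v , λ i → R.sym (∑-δ v i)) , λ { zero _ → refl }
    }

  module Extend {a b : ℕ} (M : NonsingularMultiplication a b) (1≤b : 1 ≤ b) (Π : SubspacePartition a) where

    open NonsingularMultiplication M

    mul-zeroʳ : ∀ α {x} → x ≈ᵛ 0ᵛ → mul α x ≈ᵛ 0ᵛ
    mul-zeroʳ α {x} x≈0 = ≈ᵛ-trans
      (mul-cong ≈ᵛ-refl (≈ᵛ-trans x≈0 (≈ᵛ-sym (λ i → R.zeroˡ (x i)))))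
      (≈ᵛ-trans (mul-*ʳ 0# α x) (λ i → R.zeroˡ _))

    mul-lincomb : ∀ {d} α (cs : Vec d) (xs : Fin d → Vec b) →
                  mul α (lincomb cs xs) ≈ᵛ lincomb cs (mul α ∘ xs)
    mul-lincomb {zero}  α cs xs = mul-zeroʳ α ≈ᵛ-refl
    mul-lincomb {suc d} α cs xs = ≈ᵛ-trans (mul-+ʳ α (cs zero *ᵛ xs zero) (lincomb (cs ∘ suc) (xs ∘ suc)))
      (λ i → R.+-cong (mul-*ʳ (cs zero) α (xs zero) i) (mul-lincomb α (cs ∘ suc) (xs ∘ suc) i))

    mul-injectiveˡ : ∀ {α β x} → ¬ (x ≈ᵛ 0ᵛ) → mul α x ≈ᵛ mul β x → α ≈ᵛ β
    mul-injectiveˡ {α} {β} {x} x≉0 e with mul≈0 (α +ᵛ (-1ᶠ *ᵛ β)) x (≈ᵛ-trans (mul-+ˡ α _ x)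
        (λ i → R.trans (R.+-congˡ (mul-*ˡ -1ᶠ β x i)) (x≈y⇒x+-1*y≈0 (e i))))
    ... | inj₁ α-β≈0 = λ i → x+-1*y≈0⇒x≈y (α-β≈0 i)
    ... | inj₂ x≈0   = contradiction x≈0 x≉0

    -- α ↦ αx is an injective map of the finite set F^a to itself, hence onto. So a vector (x , y)
    -- with x ≠ 0 lies on some graph.
    mul-surjectiveˡ : ∀ {x} → ¬ (x ≈ᵛ 0ᵛ) → ∀ y → ∃ λ α → mul α x ≈ᵛ y
    mul-surjectiveˡ {x} x≉0 y =
      let (i , e) = injective⇒surjective (λ i → code (mul (vec i) x))
                      (λ {i} {j} e → trans (sym (code-vec {a} i)) (trans (code-cong (mul-injectiveˡ x≉0 (code-injective e))) (code-vec {a} j)))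
                      (code y)
      in vec i , code-injective e

    graph : Vec a → Subspace (b + a)
    graph α = record
      { dim   = b
      ; basis = λ j → δ j ⧺ mul α (δ j)
      ; indep = λ cs e j → R.trans (R.sym (left-lincomb α cs j)) (e (j ↑ˡ a))
      }
      module Graph where
      left-lincomb : ∀ α cs → left {b} (lincomb cs (λ j → δ j ⧺ mul α (δ j))) ≈ᵛ cs
      left-lincomb α cs i = R.trans (∑-cong {b} (λ j → R.*-congˡ (R.reflexive (⧺-left (δ j) (mul α (δ j)) i)))) (∑-δ cs i)

    right-lincomb : ∀ α cs → right b (lincomb cs (basis (graph α))) ≈ᵛ mul α cs
    right-lincomb α cs i = begin
      ∑ (λ j → cs j *ᶠ (δ j ⧺ mul α (δ j)) (b ↑ʳ i))
        ≈⟨ ∑-cong {b} (λ j → R.*-congˡ (R.reflexive (⧺-right (δ j) (mul α (δ j)) i))) ⟩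
      lincomb cs (mul α ∘ δ) i
        ≈⟨ mul-lincomb α cs δ i ⟨
      mul α (lincomb cs δ) i
        ≈⟨ mul-cong ≈ᵛ-refl (∑-δ cs) i ⟩
      mul α cs i ∎
      where open ≈-Reasoning

    ∈graph : ∀ α v → right b v ≈ᵛ mul α (left v) → v ∈ˢ graph α
    ∈graph α v e = left v , halves-≈ b
      (≈ᵛ-sym (Graph.left-lincomb α α (left v)))
      (≈ᵛ-trans e (≈ᵛ-sym (right-lincomb α (left v))))

    ∈graph⁻¹ : ∀ α v → v ∈ˢ graph α → right b v ≈ᵛ mul α (left v)
    ∈graph⁻¹ α v (cs , e) = ≈ᵛ-trans (e ∘ (b ↑ʳ_)) (≈ᵛ-trans (right-lincomb α cs)
      (mul-cong ≈ᵛ-refl (≈ᵛ-sym (≈ᵛ-trans (e ∘ (_↑ˡ a)) (Graph.left-lincomb α α cs)))))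

    embed-right : ∀ (W : Subspace a) cs → right b (lincomb cs (λ j → 0ᵛ {b} ⧺ basis W j)) ≈ᵛ lincomb cs (basis W)
    embed-right W cs i = ∑-cong (λ j → R.*-congˡ (R.reflexive (⧺-right {b} 0ᵛ (basis W j) i)))

    embed-left : ∀ (W : Subspace a) cs → left {b} (lincomb cs (λ j → 0ᵛ ⧺ basis W j)) ≈ᵛ 0ᵛ
    embed-left W cs i = ∑-zero (λ j → R.trans (R.*-congˡ (R.reflexive (⧺-left {b} 0ᵛ (basis W j) i))) (R.zeroʳ _))

    embed : Subspace a → Subspace (b + a)
    embed W = record
      { dim   = dim W
      ; basis = λ j → 0ᵛ {b} ⧺ basis W j
      ; indep = λ cs e → indep W cs (λ i → R.trans (R.sym (embed-right W cs i)) (e (b ↑ʳ i)))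
      }

    ∈embed : ∀ W v → left {b} v ≈ᵛ 0ᵛ → right b v ∈ˢ W → v ∈ˢ embed W
    ∈embed W v e (cs , e′) = cs , halves-≈ b
      (≈ᵛ-trans e (≈ᵛ-sym (embed-left W cs))) (≈ᵛ-trans e′ (≈ᵛ-sym (embed-right W cs)))

    ∈embed⁻¹ : ∀ W v → v ∈ˢ embed W → left {b} v ≈ᵛ 0ᵛ × right b v ∈ˢ W
    ∈embed⁻¹ W v (cs , e) = ≈ᵛ-trans (e ∘ (_↑ˡ a)) (embed-left W cs) ,
      (cs , ≈ᵛ-trans (e ∘ (b ↑ʳ_)) (embed-right W cs))

    piece : Fin (q ^ a) ⊎ Fin (size Π) → Subspace (b + a)
    piece = [ graph ∘ vec , embed ∘ part Π ]′

    extension : SubspacePartition (b + a)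
    extension = record
      { size    = q ^ a + size Π
      ; part    = piece ∘ splitAt (q ^ a)
      ; nonzero = λ i → nonzero′ (splitAt (q ^ a) i)
      ; cover   = cover′
      }
      where
      nonzero′ : ∀ i → 1 ≤ dim (piece i)
      nonzero′ (inj₁ x) = 1≤b
      nonzero′ (inj₂ i) = nonzero Π i

      Covered : Vec (b + a) → Set _
      Covered v = Σ (Fin (q ^ a + size Π)) λ i → (v ∈ˢ piece (splitAt (q ^ a) i)) ×
                    (∀ j → v ∈ˢ piece (splitAt (q ^ a) j) → j ≡ i)

      cover-left : ∀ v → ¬ (left {b} v ≈ᵛ 0ᵛ) → Covered v
      cover-left v l≉0 =
        let (α , e) = mul-surjectiveˡ l≉0 (right b v)
            e′ = ≈ᵛ-trans (≈ᵛ-sym e) (mul-cong (≈ᵛ-sym (vec-code α)) ≈ᵛ-refl)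
        in code α ↑ˡ size Π
         , subst (λ s → v ∈ˢ piece s) (sym (Fin.splitAt-↑ˡ (q ^ a) (code α) (size Π))) (∈graph (vec (code α)) v e′)
         , unique α e
        where
        unique : ∀ α → mul α (left v) ≈ᵛ right b v → ∀ j → v ∈ˢ piece (splitAt (q ^ a) j) → j ≡ code α ↑ˡ size Π
        unique α e j v∈ with splitAt (q ^ a) j in eq
        ... | inj₁ x = trans (sym (Fin.splitAt⁻¹-↑ˡ eq)) (cong (_↑ˡ size Π) (trans (sym (code-vec {a} x))
                (code-cong (mul-injectiveˡ l≉0 (≈ᵛ-trans (≈ᵛ-sym (∈graph⁻¹ (vec x) v v∈)) (≈ᵛ-sym e))))))
        ... | inj₂ i = contradiction (proj₁ (∈embed⁻¹ (part Π i) v v∈)) l≉0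

      -- A graph meets 0 × F^a only in 0, so these vectors are left to the embedded members of Π.
      cover-right : ∀ v → left {b} v ≈ᵛ 0ᵛ → ¬ (right b v ≈ᵛ 0ᵛ) → Covered v
      cover-right v l≈0 r≉0 with cover Π (right b v) r≉0
      ... | i , r∈ , uniq = q ^ a ↑ʳ i
          , subst (λ s → v ∈ˢ piece s) (sym (Fin.splitAt-↑ʳ (q ^ a) (size Π) i)) (∈embed (part Π i) v l≈0 r∈)
          , unique
        where
        unique : ∀ j → v ∈ˢ piece (splitAt (q ^ a) j) → j ≡ q ^ a ↑ʳ i
        unique j v∈ with splitAt (q ^ a) j in eq
        ... | inj₁ x = contradiction (≈ᵛ-trans (∈graph⁻¹ (vec x) v v∈) (mul-zeroʳ (vec x) l≈0)) r≉0
        ... | inj₂ k = trans (sym (Fin.splitAt⁻¹-↑ʳ eq)) (cong (q ^ a ↑ʳ_) (uniq k (proj₂ (∈embed⁻¹ (part Π k) v v∈))))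

      cover′ : ∀ v → NonZeroVec v → Covered v
      cover′ v v≉0 with left {b} v ≟ᵛ 0ᵛ
      ... | no  l≉0 = cover-left v l≉0
      ... | yes l≈0 = cover-right v l≈0 (λ r≈0 → v≉0 (halves-≈ b l≈0 r≈0))

  extend : ∀ {a b} → 1 ≤ b → b ≤ a → (Π : SubspacePartition a) →
           Σ (SubspacePartition (b + a)) λ Π′ → size Π′ ≡ q ^ a + size Π ×
             (∃ λ i → dim (part Π′ i) ≡ b) ×
             (∀ i → dim (part Π′ i) ≡ b ⊎ ∃ λ j → dim (part Π′ i) ≡ dim (part Π j))
  extend {zero}  {suc b} 1≤b ()
  extend {suc a} {b} 1≤b b≤a Π = extension , refl ,
      -- The graph of α = 0 witnesses that dimension b occurs.
      (code {suc a} 0ᵛ ↑ˡ size Π , cong (dim ∘ piece) (Fin.splitAt-↑ˡ (q ^ suc a) (code {suc a} 0ᵛ) (size Π))) ,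
      λ i → dims (splitAt (q ^ suc a) i)
    where
    open Extend (nonsingularMultiplication a b≤a) 1≤b Π
    dims : ∀ s → dim (piece s) ≡ b ⊎ ∃ λ j → dim (piece s) ≡ dim (part Π j)
    dims (inj₁ x) = inj₁ refl
    dims (inj₂ j) = inj₂ (j , refl)

  -- P is `t ≤_` for ρ and `_≤ t` for σ; the new members have dimension t, so any P that holds at t
  -- persists. Dimension t need not occur in `Π₀`, only after an extension, whence the condition
  -- `1 ≤ k`.
  iterate-extend : ∀ {t r} → 1 ≤ t → (P : ℕ → Set) → P t →
                   (Π₀ : SubspacePartition (t + r)) → (∀ i → P (dim (part Π₀ i))) →
                   ∀ k → Σ (SubspacePartition (k * t + (t + r))) λ Π →
                     size Π ≡ q ^ (t + r) * sumRange k (λ i → q ^ (i * t)) + size Π₀ ×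
                     (∀ i → P (dim (part Π i))) × (1 ≤ k → ∃ λ i → dim (part Π i) ≡ t)
  iterate-extend {t} {r} 1≤t P Pt Π₀ P₀ zero = Π₀ ,
    sym (cong (_+ size Π₀) (*-zeroʳ (q ^ (t + r)))) , P₀ , λ ()
  iterate-extend {t} {r} 1≤t P Pt Π₀ P₀ (suc k)
    with iterate-extend {t} {r} 1≤t P Pt Π₀ P₀ k
  ... | Π , size≡ , PΠ , _
    with extend 1≤t (≤-trans (m≤m+n t r) (m≤n+m (t + r) (k * t))) Π
  ... | Π′ , size′≡ , has , dims =
    subst (λ n → Σ (SubspacePartition n) λ Π → size Π ≡ q ^ (t + r) * sumRange (suc k) (λ i → q ^ (i * t)) + size Π₀ ×
                     (∀ i → P (dim (part Π i))) × (1 ≤ suc k → ∃ λ i → dim (part Π i) ≡ t))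
          (sym (+-assoc t (k * t) (t + r)))
          (Π′ , size-eq , (λ i → P-dims i (dims i)) , λ _ → has)
    where
    P-dims : ∀ i → dim (part Π′ i) ≡ t ⊎ ∃ (λ j → dim (part Π′ i) ≡ dim (part Π j)) → P (dim (part Π′ i))
    P-dims i (inj₁ e)       = subst P (sym e) Pt
    P-dims i (inj₂ (j , e)) = subst P (sym e) (PΠ j)
    S = sumRange k (λ i → q ^ (i * t))
    size-eq : size Π′ ≡ q ^ (t + r) * sumRange (suc k) (λ i → q ^ (i * t)) + size Π₀
    size-eq = begin
      size Π′                                                  ≡⟨ size′≡ ⟩
      q ^ (k * t + (t + r)) + size Π                           ≡⟨ cong₂ _+_ (cong (q ^_) (+-comm (k * t) (t + r))) size≡ ⟩
      q ^ ((t + r) + k * t) + (q ^ (t + r) * S + size Π₀)      ≡⟨ cong (_+ (q ^ (t + r) * S + size Π₀)) (^-distribˡ-+-* q (t + r) (k * t)) ⟩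
      q ^ (t + r) * q ^ (k * t) + (q ^ (t + r) * S + size Π₀)  ≡⟨ +-assoc (q ^ (t + r) * q ^ (k * t)) _ _ ⟨
      (q ^ (t + r) * q ^ (k * t) + q ^ (t + r) * S) + size Π₀  ≡⟨ cong (_+ size Π₀) (+-comm (q ^ (t + r) * q ^ (k * t)) _) ⟩
      (q ^ (t + r) * S + q ^ (t + r) * q ^ (k * t)) + size Π₀  ≡⟨ cong (_+ size Π₀) (*-distribˡ-+ (q ^ (t + r)) S (q ^ (k * t))) ⟨
      q ^ (t + r) * (S + q ^ (k * t)) + size Π₀                ∎
      where open ≡-Reasoning

-- Counting vectors in members and functionals vanishing on them

module Counting {c ℓ : Level} (F : FiniteField c ℓ) where

  open Vectors F

  zeros : ∀ {m} → Vec m → ℕ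
  zeros φ = sumᵛ (λ v → 𝟙 (dot φ v ≟ 0#))

  zeros-zero : ∀ {m} {φ : Vec m} → φ ≈ᵛ 0ᵛ → zeros φ ≡ q ^ m
  zeros-zero {m} {φ} φ≈0 = trans
    (sum-cong (λ x → 𝟙-yes (dot φ (vec x) ≟ 0#) (dot-zeroˡ (vec x) φ≈0)))
    (trans (sum-const (q ^ m) 1) (*-identityʳ _))

  -- The fibres of a nonzero functional are translates of each other.
  zeros-nonzero : ∀ {m} {φ : Vec m} → ¬ (φ ≈ᵛ 0ᵛ) → q * zeros φ ≡ q ^ m
  zeros-nonzero {m} {φ} φ≉0 = begin
    q * zeros φ
      ≡⟨ sum-const q (zeros φ) ⟨
    sum {q} (λ i → zeros φ)
      ≡⟨ sum-cong (λ i → sym (fibre (to i))) ⟩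
    sum {q} (λ i → sumᵛ {m} (λ v → 𝟙 (dot φ v ≟ to i)))
      ≡⟨ sum-swap (λ i x → 𝟙 (dot φ (vec {m} x) ≟ to i)) ⟩
    sumᵛ {m} (λ v → sum {q} (λ i → 𝟙 (dot φ v ≟ to i)))
      ≡⟨ sum-cong (λ x → count-unique (λ i → dot φ (vec {m} x) ≟ to i) (from (dot φ (vec x)))
           (R.sym (to-from _)) (λ i e → trans (sym (from-to i)) (from-cong (R.sym e)))) ⟩
    sumᵛ {m} (λ v → 1)
      ≡⟨ trans (sum-const (q ^ m) 1) (*-identityʳ _) ⟩
    q ^ m ∎
    where
    open ≡-Reasoning
    support : ∃ λ i → ¬ (φ i ≈ 0#)
    support = Fin.¬∀⟶∃¬ m (λ i → φ i ≈ 0#) (λ i → φ i ≟ 0#) φ≉0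
    i₀ = proj₁ support
    y = proj₁ (inverse (φ i₀) (proj₂ support))
    -- A unit vector at a nonzero coordinate of φ, scaled so that φ w = 1; translation by xw then
    -- carries the kernel onto the fibre over x.
    w : Vec m
    w = y *ᵛ δ i₀
    φw≈1 : dot φ w ≈ 1#
    φw≈1 = R.trans (dot-* φ y (δ i₀)) (R.trans (R.*-congˡ (R.trans (∑-single (λ j → φ j *ᶠ δ i₀ j) i₀
              (λ j j≢ → R.trans (R.*-congˡ (δ-≢ (j≢ ∘ sym))) (R.zeroʳ _)))
              (R.trans (R.*-congˡ (δ-refl i₀)) (R.*-identityʳ _))))
              (R.trans (R.*-comm y (φ i₀)) (proj₂ (inverse (φ i₀) (proj₂ support)))))
    shift : Carrier → Vec m → Vec m
    shift x v = v +ᵛ (x *ᵛ w)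
    shift-cong : ∀ x {u v} → u ≈ᵛ v → shift x u ≈ᵛ shift x v
    shift-cong x e i = R.+-congʳ (e i)
    shift-inverse : ∀ x y → x +ᶠ y ≈ 0# → ∀ v → shift x (shift y v) ≈ᵛ v
    shift-inverse x y x+y≈0 v i = begin′
      (v i +ᶠ (y *ᶠ w i)) +ᶠ (x *ᶠ w i)  ≈⟨ R.+-assoc _ _ _ ⟩
      v i +ᶠ ((y *ᶠ w i) +ᶠ (x *ᶠ w i))  ≈⟨ R.+-congˡ (R.distribʳ (w i) y x) ⟨
      v i +ᶠ ((y +ᶠ x) *ᶠ w i)           ≈⟨ R.+-congˡ (R.*-congʳ (R.trans (R.+-comm y x) x+y≈0)) ⟩
      v i +ᶠ (0# *ᶠ w i)                 ≈⟨ R.+-congˡ (R.zeroˡ _) ⟩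
      v i +ᶠ 0#                          ≈⟨ R.+-identityʳ _ ⟩
      v i                                ∎′
      where open ≈-Reasoning renaming (begin_ to begin′_; _∎ to _∎′)
    dot-shift : ∀ x v → dot φ (shift x v) ≈ dot φ v +ᶠ x
    dot-shift x v = R.trans (dot-+ φ v _) (R.+-congˡ (R.trans (dot-* φ x w)
                      (R.trans (R.*-congˡ φw≈1) (R.*-identityʳ x))))
    fibre : ∀ x → sumᵛ (λ v → 𝟙 (dot φ v ≟ x)) ≡ zeros φ
    fibre x = trans
      (sym (sumᵛ-bijection (shift x) (shift (-ᶠ x)) (shift-cong x) (shift-cong (-ᶠ x))
        (shift-inverse x (-ᶠ x) (R.-‿inverseʳ x)) (shift-inverse (-ᶠ x) x (R.-‿inverseˡ x))
        (λ {u} {v} e → 𝟙-cong (dot φ u ≟ x) (dot φ v ≟ x)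
           (R.trans (dot-cong ≈ᵛ-refl (≈ᵛ-sym e))) (R.trans (dot-cong ≈ᵛ-refl e)))))
      (sum-cong (λ y → 𝟙-cong (dot φ (shift x (vec y)) ≟ x) (dot φ (vec y) ≟ 0#)
         (λ e → +ᶠ-cancelˡ x _ _ (R.trans (R.+-comm x _) (R.trans (R.sym (dot-shift x (vec y))) (R.trans e (R.sym (R.+-identityʳ x))))))
         (λ e → R.trans (dot-shift x (vec y)) (R.trans (R.+-congʳ e) (R.+-identityˡ x)))))

  -- q · zeros φ is q · q^m or q^m; the two cases are merged without a subtraction.
  zeros-formula : ∀ {m} (φ : Vec m) →
                  q * zeros φ + q ^ m * 𝟙 (φ ≟ᵛ 0ᵛ) ≡ q ^ m + q * (q ^ m * 𝟙 (φ ≟ᵛ 0ᵛ))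
  zeros-formula {m} φ with φ ≟ᵛ 0ᵛ
  ... | yes φ≈0 rewrite zeros-zero φ≈0 | *-identityʳ (q ^ m) = +-comm (q * q ^ m) (q ^ m)
  ... | no  φ≉0 rewrite zeros-nonzero φ≉0 | *-zeroʳ (q ^ m) | *-zeroʳ q = refl

  sumᵛ-nonzero : ∀ {m} {g : Vec m → ℕ} → Respects g → sumᵛ g ≡ g 0ᵛ + sumᵛ (λ v → 𝟙 (¬? (v ≟ᵛ 0ᵛ)) * g v)
  sumᵛ-nonzero {m} {g} g-resp = trans (sum-cong (λ x → split (vec x)))
    (trans (sum-+ {q ^ m} _ _) (cong (_+ sumᵛ (λ v → 𝟙 (¬? (v ≟ᵛ 0ᵛ)) * g v))
      (sumᵛ-unique (_≟ᵛ 0ᵛ) g g-resp 0ᵛ (λ e → e) (λ _ e → e))))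
    where
    split : ∀ v → g v ≡ 𝟙 (v ≟ᵛ 0ᵛ) * g v + 𝟙 (¬? (v ≟ᵛ 0ᵛ)) * g v
    split v with v ≟ᵛ 0ᵛ
    ... | yes _ = sym (trans (+-identityʳ _) (*-identityˡ _))
    ... | no  _ = sym (*-identityˡ _)

  lincomb-zero : ∀ {d m} {cs : Vec d} (bs : Fin d → Vec m) → cs ≈ᵛ 0ᵛ → lincomb cs bs ≈ᵛ 0ᵛ
  lincomb-zero bs cs≈0 i = ∑-zero (λ j → R.trans (R.*-congʳ (cs≈0 j)) (R.zeroˡ _))

  module _ {n} (Π : SubspacePartition n) where

    span : ∀ i → Vec (dim (part Π i)) → Vec n
    span i cs = lincomb cs (basis (part Π i))

    -- A nonzero vector lies in exactly one member and has exactly one coordinate vector there; the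
    -- indicator of `v = span i cs` lets the sums be exchanged.
    partition-sum-nonzero : ∀ {g : Vec n → ℕ} → Respects g →
      sum (λ i → sumᵛ (λ cs → 𝟙 (¬? (cs ≟ᵛ 0ᵛ)) * g (span i cs))) ≡ sumᵛ (λ v → 𝟙 (¬? (v ≟ᵛ 0ᵛ)) * g v)
    partition-sum-nonzero {g} g-resp = begin
      sum (λ i → sumᵛ (λ cs → 𝟙 (¬? (cs ≟ᵛ 0ᵛ)) * g (span i cs)))
        ≡⟨ sum-cong (λ i → sum-cong (λ x → trans
             (cong (𝟙 (¬? (vec {dim (part Π i)} x ≟ᵛ 0ᵛ)) *_) (sym (sumᵛ-unique (_≟ᵛ span i (vec {dim (part Π i)} x)) g g-resp (span i (vec {dim (part Π i)} x)) (λ e → e) (λ _ e → e))))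
             (sym (sum-*ˡ (𝟙 (¬? (vec {dim (part Π i)} x ≟ᵛ 0ᵛ))) (λ y → 𝟙 (vec {n} y ≟ᵛ span i (vec {dim (part Π i)} x)) * g (vec {n} y)))))) ⟩
      sum (λ i → sumᵛ (λ cs → sumᵛ {n} (λ v → 𝟙 (¬? (cs ≟ᵛ 0ᵛ)) * (𝟙 (v ≟ᵛ span i cs) * g v))))
        ≡⟨ sum-cong (λ i → sum-swap (λ x y → 𝟙 (¬? (vec {dim (part Π i)} x ≟ᵛ 0ᵛ)) * (𝟙 (vec {n} y ≟ᵛ span i (vec x)) * g (vec y)))) ⟩
      sum (λ i → sumᵛ {n} (λ v → sumᵛ (λ cs → 𝟙 (¬? (cs ≟ᵛ 0ᵛ)) * (𝟙 (v ≟ᵛ span i cs) * g v))))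
        ≡⟨ sum-swap (λ i y → sumᵛ (λ cs → 𝟙 (¬? (cs ≟ᵛ 0ᵛ)) * (𝟙 (vec {n} y ≟ᵛ span i cs) * g (vec y)))) ⟩
      sumᵛ {n} (λ v → sum (λ i → sumᵛ (λ cs → 𝟙 (¬? (cs ≟ᵛ 0ᵛ)) * (𝟙 (v ≟ᵛ span i cs) * g v))))
        ≡⟨ sum-cong (λ y → covered (vec y)) ⟩
      sumᵛ (λ v → 𝟙 (¬? (v ≟ᵛ 0ᵛ)) * g v) ∎
      where
      open ≡-Reasoning
      none : ∀ v i → (∀ cs → ¬ (cs ≈ᵛ 0ᵛ) → ¬ (v ≈ᵛ span i cs)) →
             sumᵛ (λ cs → 𝟙 (¬? (cs ≟ᵛ 0ᵛ)) * (𝟙 (v ≟ᵛ span i cs) * g v)) ≡ 0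
      none v i no-cs = trans (sum-cong (λ x → vanish (vec x))) (trans (sum-const (q ^ dim (part Π i)) 0) (*-zeroʳ (q ^ dim (part Π i))))
        where
        vanish : ∀ cs → 𝟙 (¬? (cs ≟ᵛ 0ᵛ)) * (𝟙 (v ≟ᵛ span i cs) * g v) ≡ 0
        vanish cs with cs ≟ᵛ 0ᵛ
        ... | yes _   = refl
        ... | no cs≉0 = trans (*-identityˡ _) (cong (_* g v) (𝟙-no (v ≟ᵛ span i cs) (no-cs cs cs≉0)))
      covered : ∀ v → sum (λ i → sumᵛ (λ cs → 𝟙 (¬? (cs ≟ᵛ 0ᵛ)) * (𝟙 (v ≟ᵛ span i cs) * g v))) ≡ 𝟙 (¬? (v ≟ᵛ 0ᵛ)) * g v
      covered v with v ≟ᵛ 0ᵛ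
      ... | yes v≈0 = trans
        (sum-cong (λ i → none v i (λ cs cs≉0 e → cs≉0 (indep (part Π i) cs (≈ᵛ-trans (≈ᵛ-sym e) v≈0)))))
        (trans (sum-const (size Π) 0) (*-zeroʳ (size Π)))
      ... | no v≉0 with cover Π v v≉0
      ...   | i , (cs₀ , e₀) , uniq = trans
        (sum-single (λ j → sumᵛ (λ cs → 𝟙 (¬? (cs ≟ᵛ 0ᵛ)) * (𝟙 (v ≟ᵛ span j cs) * g v))) i
           (λ j j≢i → none v j (λ cs _ e → j≢i (uniq j (cs , e)))))
        (trans (sum-cong (λ x → drop-nonzero (vec x)))
          (trans (sumᵛ-unique (λ cs → v ≟ᵛ span i cs) (λ _ → g v) (λ _ → refl) cs₀
              (λ u≈ → ≈ᵛ-trans e₀ (lincomb-cong (basis (part Π i)) (≈ᵛ-sym u≈)))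
              (λ u e → lincomb-injective (indep (part Π i)) u cs₀ (≈ᵛ-trans (≈ᵛ-sym e) e₀)))
            (sym (*-identityˡ _))))
        where
        drop-nonzero : ∀ cs → 𝟙 (¬? (cs ≟ᵛ 0ᵛ)) * (𝟙 (v ≟ᵛ span i cs) * g v) ≡ 𝟙 (v ≟ᵛ span i cs) * g v
        drop-nonzero cs with cs ≟ᵛ 0ᵛ
        ... | no _     = *-identityˡ _
        ... | yes cs≈0 = sym (cong (_* g v) (𝟙-no (v ≟ᵛ span i cs)
                           (λ e → v≉0 (≈ᵛ-trans e (lincomb-zero (basis (part Π i)) cs≈0)))))

    -- The zero vector lies in every member, so it is counted |Π| times on the left and once in
    -- `sumᵛ g`.
    partition-sum : ∀ {g : Vec n → ℕ} → Respects g →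
                    sum (λ i → sumᵛ (g ∘ span i)) + g 0ᵛ ≡ size Π * g 0ᵛ + sumᵛ g
    partition-sum {g} g-resp = begin
      sum (λ i → sumᵛ (g ∘ span i)) + g 0ᵛ
        ≡⟨ cong (_+ g 0ᵛ) (sum-cong (λ i → trans (sumᵛ-nonzero (λ e → g-resp (lincomb-cong (basis (part Π i)) e)))
             (cong (_+ sumᵛ (λ cs → 𝟙 (¬? (cs ≟ᵛ 0ᵛ)) * g (span i cs))) (g-resp (lincomb-zero (basis (part Π i)) ≈ᵛ-refl))))) ⟩
      sum (λ i → g 0ᵛ + sumᵛ (λ cs → 𝟙 (¬? (cs ≟ᵛ 0ᵛ)) * g (span i cs))) + g 0ᵛ
        ≡⟨ cong (_+ g 0ᵛ) (trans (sum-+ (λ _ → g 0ᵛ) _) (cong₂ _+_ (sum-const (size Π) (g 0ᵛ)) (partition-sum-nonzero g-resp))) ⟩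
      size Π * g 0ᵛ + sumᵛ (λ v → 𝟙 (¬? (v ≟ᵛ 0ᵛ)) * g v) + g 0ᵛ
        ≡⟨ +-assoc (size Π * g 0ᵛ) _ _ ⟩
      size Π * g 0ᵛ + (sumᵛ (λ v → 𝟙 (¬? (v ≟ᵛ 0ᵛ)) * g v) + g 0ᵛ)
        ≡⟨ cong (size Π * g 0ᵛ +_) (trans (+-comm _ (g 0ᵛ)) (sym (sumᵛ-nonzero g-resp))) ⟩
      size Π * g 0ᵛ + sumᵛ g ∎
      where open ≡-Reasoning

    volume : sum (λ i → q ^ dim (part Π i)) + 1 ≡ size Π + q ^ n
    volume = trans
      (cong (_+ 1) (sum-cong (λ i → sym (trans (sum-const (q ^ dim (part Π i)) 1) (*-identityʳ _)))))
      (trans (partition-sum {λ _ → 1} (λ _ → refl))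
        (cong₂ _+_ (*-identityʳ (size Π)) (trans (sum-const (q ^ n) 1) (*-identityʳ _))))

  -- The restriction of φ to the span of bs, as a functional in the coordinates with respect to bs.
  pairing : ∀ {d n} → Vec n → (Fin d → Vec n) → Vec d
  pairing φ bs j = dot φ (bs j)

  zeros-lincomb : ∀ {d n} (φ : Vec n) (bs : Fin d → Vec n) →
                  sumᵛ (λ cs → 𝟙 (dot φ (lincomb cs bs) ≟ 0#)) ≡ zeros (pairing φ bs)
  zeros-lincomb {d} φ bs = sum-cong (λ x → let cs = vec {d} x in
    𝟙-cong (dot φ (lincomb cs bs) ≟ 0#) (dot (pairing φ bs) cs ≟ 0#)
      (R.trans (R.sym (dot-lincomb φ cs bs))) (R.trans (dot-lincomb φ cs bs)))

  annihilates : ∀ {d n} → Vec n → (Fin d → Vec n) → ℕ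
  annihilates φ bs = 𝟙 (pairing φ bs ≟ᵛ 0ᵛ)

  -- The equation is (q - 1)x = (q - 1)y, and q ≥ 2.
  q-1-cancel : ∀ x y → q * x + y ≡ q * y + x → x ≡ y
  q-1-cancel x y e with q | 2≤q
  ... | suc (suc p) | s≤s (s≤s z≤n) = *-cancelˡ-≡ x y (suc p) (+-cancelˡ-≡ (x + y) _ _ (begin
    x + y + suc p * x       ≡⟨ solve 3 (λ x y z → x :+ y :+ z := x :+ z :+ y) refl x y (suc p * x) ⟩
    x + suc p * x + y       ≡⟨ e ⟩
    y + suc p * y + x       ≡⟨ solve 3 (λ x y z → y :+ z :+ x := x :+ y :+ z) refl x y (suc p * y) ⟩
    x + y + suc p * y       ∎))
    where
    open ≡-Reasoning
    open +-*-Solver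

  -- For φ ≠ 0 the sum is over the members of Π inside the hyperplane φ = 0, and equals |Π| − 1
  -- whatever the hyperplane.
  hyperplane-identity : ∀ {n} (Π : SubspacePartition n) (φ : Vec n) →
    sum (λ i → q ^ dim (part Π i) * annihilates φ (basis (part Π i))) + 1
      ≡ size Π + q ^ n * 𝟙 (φ ≟ᵛ 0ᵛ)
  -- The kernel of φ is counted member by member (`zeros-sum`), where q times the part in W is
  -- q^(dim W), or q^(dim W + 1) if φ vanishes on W (`local`). Eliminating the kernel sizes and the
  -- volume leaves q - 1 times the claim.
  hyperplane-identity {n} Π φ = q-1-cancel (G + 1) (size Π + Y) (+-cancelʳ-≡ (S + q ^ n) _ _ (begin
    q * (G + 1) + (size Π + Y) + (S + q ^ n)
      ≡⟨ solve 6 (λ q G N Y S n → q :* (G :+ con 1) :+ (N :+ Y) :+ (S :+ n) :=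
                   (q :+ (S :+ q :* G)) :+ (N :+ n) :+ Y) refl q G (size Π) Y S (q ^ n) ⟩
    (q + (S + q * G)) + (size Π + q ^ n) + Y
      ≡⟨ cong₂ (λ a b → q + a + b + Y) (sym local) (sym (volume Π)) ⟩
    (q + (q * Z + G)) + (S + 1) + Y
      ≡⟨ solve 5 (λ q Z G S Y → (q :+ (q :* Z :+ G)) :+ (S :+ con 1) :+ Y := q :* (Z :+ con 1) :+ (G :+ S :+ con 1 :+ Y)) refl q Z G S Y ⟩
    q * (Z + 1) + (G + S + 1 + Y)
      ≡⟨ cong (λ a → q * a + (G + S + 1 + Y)) zeros-sum ⟩
    q * (size Π + zeros φ) + (G + S + 1 + Y)
      ≡⟨ solve 6 (λ q N z G S Y → q :* (N :+ z) :+ (G :+ S :+ con 1 :+ Y) := q :* N :+ (q :* z :+ Y) :+ (G :+ S :+ con 1)) refl q (size Π) (zeros φ) G S Y ⟩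
    q * size Π + (q * zeros φ + Y) + (G + S + 1)
      ≡⟨ cong (λ a → q * size Π + a + (G + S + 1)) (zeros-formula φ) ⟩
    q * size Π + (q ^ n + q * Y) + (G + S + 1)
      ≡⟨ solve 6 (λ q N n Y G S → q :* N :+ (n :+ q :* Y) :+ (G :+ S :+ con 1) := q :* (N :+ Y) :+ (G :+ con 1) :+ (S :+ n)) refl q (size Π) (q ^ n) Y G S ⟩
    q * (size Π + Y) + (G + 1) + (S + q ^ n) ∎))
    where
    open ≡-Reasoning
    open +-*-Solver
    N = size Π
    d : Fin N → ℕ
    d i = dim (part Π i)
    φ∣ : ∀ i → Vec (d i)
    φ∣ i = pairing φ (basis (part Π i))
    Y = q ^ n * 𝟙 (φ ≟ᵛ 0ᵛ)
    G = sum (λ i → q ^ d i * annihilates φ (basis (part Π i)))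
    S = sum (λ i → q ^ d i)
    Z = sum (λ i → zeros (φ∣ i))
    zeros-sum : Z + 1 ≡ size Π + zeros φ
    zeros-sum = begin
      Z + 1
        ≡⟨ cong₂ _+_ (sum-cong (λ i → sym (zeros-lincomb φ (basis (part Π i))))) (sym (𝟙-yes (dot φ 0ᵛ ≟ 0#) (dot-zeroʳ φ ≈ᵛ-refl))) ⟩
      sum (λ i → sumᵛ (λ cs → 𝟙 (dot φ (span Π i cs) ≟ 0#))) + 𝟙 (dot φ 0ᵛ ≟ 0#)
        ≡⟨ partition-sum Π (λ {u} {v} e → 𝟙-cong (dot φ u ≟ 0#) (dot φ v ≟ 0#)
             (R.trans (dot-cong ≈ᵛ-refl (≈ᵛ-sym e))) (R.trans (dot-cong ≈ᵛ-refl e))) ⟩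
      size Π * 𝟙 (dot φ 0ᵛ ≟ 0#) + zeros φ
        ≡⟨ cong (λ a → a + zeros φ) (trans (cong (size Π *_) (𝟙-yes (dot φ 0ᵛ ≟ 0#) (dot-zeroʳ φ ≈ᵛ-refl))) (*-identityʳ N)) ⟩
      size Π + zeros φ ∎
    local : q * Z + G ≡ S + q * G
    local = begin
      q * Z + G
        ≡⟨ cong (_+ G) (sum-*ˡ q (λ i → zeros (φ∣ i))) ⟨
      sum (λ i → q * zeros (φ∣ i)) + G
        ≡⟨ sum-+ (λ i → q * zeros (φ∣ i)) _ ⟨
      sum (λ i → q * zeros (φ∣ i) + q ^ d i * annihilates φ (basis (part Π i)))
        ≡⟨ sum-cong (λ i → zeros-formula (φ∣ i)) ⟩
      sum (λ i → q ^ d i + q * (q ^ d i * annihilates φ (basis (part Π i))))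
        ≡⟨ sum-+ (λ i → q ^ d i) _ ⟩
      S + sum (λ i → q * (q ^ d i * annihilates φ (basis (part Π i))))
        ≡⟨ cong (S +_) (sum-*ˡ q (λ i → q ^ d i * annihilates φ (basis (part Π i)))) ⟩
      S + q * G ∎

  -- Count the pairs (φ , w) with φ w = 0 in two ways.
  count-annihilators : ∀ {d n} (bs : Fin d → Vec n) → LinIndep bs →
                       q ^ d * sumᵛ (λ φ → annihilates φ bs) ≡ q ^ n
  count-annihilators {d} {n} bs ind = q-1-cancel (q ^ d * A) (q ^ n) (+-cancelʳ-≡ (q ^ n * q ^ d) _ _ (begin
    q * (q ^ d * A) + q ^ n + q ^ n * q ^ d
      ≡⟨ solve 3 (λ a b c → a :+ b :+ c := (c :+ a) :+ b) refl (q * (q ^ d * A)) (q ^ n) (q ^ n * q ^ d) ⟩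
    (q ^ n * q ^ d + q * (q ^ d * A)) + q ^ n
      ≡⟨ cong (_+ q ^ n) by-φ ⟨
    (q * T + q ^ d * A) + q ^ n
      ≡⟨ solve 3 (λ a b c → a :+ b :+ c := a :+ c :+ b) refl (q * T) (q ^ d * A) (q ^ n) ⟩
    (q * T + q ^ n) + q ^ d * A
      ≡⟨ cong (_+ q ^ d * A) by-w ⟩
    (q ^ d * q ^ n + q * q ^ n) + q ^ d * A
      ≡⟨ solve 4 (λ d n q a → d :* n :+ q :* n :+ a := q :* n :+ a :+ n :* d) refl (q ^ d) (q ^ n) q (q ^ d * A) ⟩
    q * q ^ n + q ^ d * A + q ^ n * q ^ d ∎))
    where
    open ≡-Reasoning
    open +-*-Solver
    A = sumᵛ (λ φ → annihilates φ bs)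
    T = sumᵛ {n} (λ φ → zeros (pairing φ bs))
    by-φ : q * T + q ^ d * A ≡ q ^ n * q ^ d + q * (q ^ d * A)
    by-φ = begin
      q * T + q ^ d * A
        ≡⟨ cong₂ _+_ (sum-*ˡ q (λ x → zeros (pairing (vec {n} x) bs))) (sum-*ˡ (q ^ d) (λ x → annihilates (vec x) bs)) ⟨
      sumᵛ {n} (λ φ → q * zeros (pairing φ bs)) + sumᵛ (λ φ → q ^ d * annihilates φ bs)
        ≡⟨ sum-+ (λ x → q * zeros (pairing (vec {n} x) bs)) _ ⟨
      sumᵛ {n} (λ φ → q * zeros (pairing φ bs) + q ^ d * annihilates φ bs)
        ≡⟨ sum-cong (λ x → zeros-formula (pairing (vec {n} x) bs)) ⟩
      sumᵛ {n} (λ φ → q ^ d + q * (q ^ d * annihilates φ bs))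
        ≡⟨ sum-+ (λ _ → q ^ d) (λ x → q * (q ^ d * annihilates (vec x) bs)) ⟩
      sum {q ^ n} (λ _ → q ^ d) + sumᵛ (λ φ → q * (q ^ d * annihilates φ bs))
        ≡⟨ cong₂ _+_ (sum-const (q ^ n) (q ^ d))
             (trans (sum-*ˡ q (λ x → q ^ d * annihilates (vec x) bs)) (cong (q *_) (sum-*ˡ (q ^ d) (λ x → annihilates (vec x) bs)))) ⟩
      q ^ n * q ^ d + q * (q ^ d * A) ∎
    T≡ : T ≡ sumᵛ {d} (λ cs → zeros (lincomb cs bs))
    T≡ = begin
      sumᵛ {n} (λ φ → zeros (pairing φ bs))
        ≡⟨ sum-cong (λ x → sym (zeros-lincomb (vec x) bs)) ⟩
      sumᵛ {n} (λ φ → sumᵛ {d} (λ cs → 𝟙 (dot φ (lincomb cs bs) ≟ 0#)))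
        ≡⟨ sum-swap (λ x y → 𝟙 (dot (vec {n} x) (lincomb (vec {d} y) bs) ≟ 0#)) ⟩
      sumᵛ {d} (λ cs → sumᵛ {n} (λ φ → 𝟙 (dot φ (lincomb cs bs) ≟ 0#)))
        ≡⟨ sum-cong (λ y → sum-cong (λ x → 𝟙-cong (dot (vec {n} x) (lincomb (vec {d} y) bs) ≟ 0#) (dot (lincomb (vec {d} y) bs) (vec {n} x) ≟ 0#)
             (R.trans (dot-comm (lincomb (vec {d} y) bs) (vec {n} x))) (R.trans (dot-comm (vec {n} x) (lincomb (vec {d} y) bs))))) ⟩
      sumᵛ {d} (λ cs → zeros (lincomb cs bs)) ∎
    zero-once : sumᵛ {d} (λ cs → 𝟙 (lincomb cs bs ≟ᵛ 0ᵛ)) ≡ 1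
    zero-once = countᵛ-unique (λ cs → lincomb cs bs ≟ᵛ 0ᵛ) 0ᵛ (lincomb-zero bs) ind
    by-w : q * T + q ^ n ≡ q ^ d * q ^ n + q * q ^ n
    by-w = begin
      q * T + q ^ n
        ≡⟨ cong₂ _+_ (trans (cong (q *_) T≡) (sym (sum-*ˡ q (λ y → zeros (lincomb (vec {d} y) bs))))) (sym n≡) ⟩
      sumᵛ {d} (λ cs → q * zeros (lincomb cs bs)) + sumᵛ {d} (λ cs → q ^ n * 𝟙 (lincomb cs bs ≟ᵛ 0ᵛ))
        ≡⟨ sum-+ (λ y → q * zeros (lincomb (vec {d} y) bs)) _ ⟨
      sumᵛ {d} (λ cs → q * zeros (lincomb cs bs) + q ^ n * 𝟙 (lincomb cs bs ≟ᵛ 0ᵛ))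
        ≡⟨ sum-cong (λ y → zeros-formula (lincomb (vec {d} y) bs)) ⟩
      sumᵛ {d} (λ cs → q ^ n + q * (q ^ n * 𝟙 (lincomb cs bs ≟ᵛ 0ᵛ)))
        ≡⟨ sum-+ (λ _ → q ^ n) (λ y → q * (q ^ n * 𝟙 (lincomb (vec {d} y) bs ≟ᵛ 0ᵛ))) ⟩
      sum {q ^ d} (λ _ → q ^ n) + sumᵛ {d} (λ cs → q * (q ^ n * 𝟙 (lincomb cs bs ≟ᵛ 0ᵛ)))
        ≡⟨ cong₂ _+_ (sum-const (q ^ d) (q ^ n))
             (trans (sum-*ˡ q (λ y → q ^ n * 𝟙 (lincomb (vec {d} y) bs ≟ᵛ 0ᵛ))) (cong (q *_) n≡)) ⟩
      q ^ d * q ^ n + q * q ^ n ∎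
      where
      n≡ : sumᵛ {d} (λ cs → q ^ n * 𝟙 (lincomb cs bs ≟ᵛ 0ᵛ)) ≡ q ^ n
      n≡ = trans (sum-*ˡ (q ^ n) (λ y → 𝟙 (lincomb (vec {d} y) bs ≟ᵛ 0ᵛ))) (trans (cong (q ^ n *_) zero-once) (*-identityʳ (q ^ n)))

  join : ∀ {d e n} → (Fin d → Vec n) → (Fin e → Vec n) → Fin (d + e) → Vec n
  join {d} bs es = [ bs , es ]′ ∘ splitAt d

  ∑-splitAt : ∀ d {e} (f : Fin (d + e) → Carrier) → ∑ f ≈ ∑ (λ i → f (i ↑ˡ e)) +ᶠ ∑ (λ j → f (d ↑ʳ j))
  ∑-splitAt zero    f = R.sym (R.+-identityˡ _)
  ∑-splitAt (suc d) f = R.trans (R.+-congˡ (∑-splitAt d (f ∘ suc))) (R.sym (R.+-assoc _ _ _))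

  lincomb-join : ∀ {d e n} (bs : Fin d → Vec n) (es : Fin e → Vec n) (cs : Vec (d + e)) →
                 lincomb cs (join bs es) ≈ᵛ (lincomb (cs ∘ (_↑ˡ e)) bs +ᵛ lincomb (cs ∘ (d ↑ʳ_)) es)
  lincomb-join {d} {e} bs es cs i = R.trans (∑-splitAt d (λ j → cs j *ᶠ join bs es j i)) (R.+-cong
    (∑-cong (λ j → R.*-congˡ (R.reflexive (cong (λ s → [ bs , es ]′ s i) (Fin.splitAt-↑ˡ d j e)))))
    (∑-cong (λ j → R.*-congˡ (R.reflexive (cong (λ s → [ bs , es ]′ s i) (Fin.splitAt-↑ʳ d e j))))))

  -- A relation u + w = 0 puts u into both members, and a nonzero vector lies in only one.
  join-indep : ∀ {n} (Π : SubspacePartition n) i j → i ≢ j → LinIndep (join (basis (part Π i)) (basis (part Π j)))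
  join-indep Π i j i≢j cs e = λ k → at-index k
    where
    d = dim (part Π i)
    e′ = dim (part Π j)
    us = cs ∘ (_↑ˡ e′)
    ws = cs ∘ (d ↑ʳ_)
    u = span Π i us
    w = span Π j ws
    u+w≈0 : ∀ k → u k +ᶠ w k ≈ 0#
    u+w≈0 k = R.trans (R.sym (lincomb-join (basis (part Π i)) (basis (part Π j)) cs k)) (e k)
    u∈j : u ≈ᵛ span Π j (-1ᶠ *ᵛ ws)
    u∈j k = R.trans (-ᶠ-unique (u k) (w k) (u+w≈0 k))
      (R.trans (R.sym (-1*x≈-x (w k))) (R.sym (lincomb-* -1ᶠ ws (basis (part Π j)) k)))
    u≈0 : u ≈ᵛ 0ᵛ
    u≈0 with u ≟ᵛ 0ᵛ
    ... | yes z = z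
    ... | no u≉0 with cover Π u u≉0
    ...   | k , _ , uniq = contradiction (trans (uniq i (us , ≈ᵛ-refl)) (sym (uniq j (-1ᶠ *ᵛ ws , u∈j)))) i≢j
    w≈0 : w ≈ᵛ 0ᵛ
    w≈0 k = R.trans (R.sym (R.+-identityˡ _)) (R.trans (R.+-congʳ (R.sym (u≈0 k))) (u+w≈0 k))
    at-index : ∀ k → cs k ≈ 0#
    at-index k with splitAt d k in eq
    ... | inj₁ x = subst (λ k → cs k ≈ 0#) (Fin.splitAt⁻¹-↑ˡ eq) (indep (part Π i) us u≈0 x)
    ... | inj₂ y = subst (λ k → cs k ≈ 0#) (Fin.splitAt⁻¹-↑ʳ eq) (indep (part Π j) ws w≈0 y)

  annihilates-join : ∀ {d e n} (φ : Vec n) (bs : Fin d → Vec n) (es : Fin e → Vec n) →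
                     annihilates φ (join bs es) ≡ annihilates φ bs * annihilates φ es
  annihilates-join {d} {e} φ bs es with pairing φ bs ≟ᵛ 0ᵛ | pairing φ es ≟ᵛ 0ᵛ
  ... | yes b | yes b′ = 𝟙-yes (pairing φ (join bs es) ≟ᵛ 0ᵛ) λ k → both (splitAt d k)
    where
    both : ∀ s → dot φ ([ bs , es ]′ s) ≈ 0#
    both (inj₁ x) = b x
    both (inj₂ y) = b′ y
  ... | no ¬b | _      = 𝟙-no (pairing φ (join bs es) ≟ᵛ 0ᵛ) λ z → ¬b λ x →
          subst (λ s → dot φ ([ bs , es ]′ s) ≈ 0#) (Fin.splitAt-↑ˡ d x e) (z (x ↑ˡ e))
  ... | yes _ | no ¬b′ = 𝟙-no (pairing φ (join bs es) ≟ᵛ 0ᵛ) λ z → ¬b′ λ y →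
          subst (λ s → dot φ ([ bs , es ]′ s) ≈ 0#) (Fin.splitAt-↑ʳ d e y) (z (d ↑ʳ y))

  -- The conditions imposed by two distinct members are independent, which makes the sum of f over
  -- the functionals vanishing on a given member computable exactly.
  count-joint-annihilators : ∀ {n} (Π : SubspacePartition n) i j → i ≢ j →
    q ^ dim (part Π i) * (q ^ dim (part Π j) *
      sumᵛ (λ φ → annihilates φ (basis (part Π i)) * annihilates φ (basis (part Π j)))) ≡ q ^ n
  count-joint-annihilators {n} Π i j i≢j = begin
    q ^ d * (q ^ e * sumᵛ (λ φ → annihilates φ bs * annihilates φ es))
      ≡⟨ *-assoc (q ^ d) (q ^ e) _ ⟨
    q ^ d * q ^ e * sumᵛ (λ φ → annihilates φ bs * annihilates φ es)
      ≡⟨ cong₂ _*_ (sym (^-distribˡ-+-* q d e)) (sum-cong (λ x → sym (annihilates-join (vec x) bs es))) ⟩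
    q ^ (d + e) * sumᵛ (λ φ → annihilates φ (join bs es))
      ≡⟨ count-annihilators (join bs es) (join-indep Π i j i≢j) ⟩
    q ^ n ∎
    where
    open ≡-Reasoning
    d = dim (part Π i)
    e = dim (part Π j)
    bs = basis (part Π i)
    es = basis (part Π j)

-- The upper bound for ρ and the lower bound for σ

module Bounds {c ℓ : Level} (F : FiniteField c ℓ) where

  open Vectors F
  open Counting F

  1≤q^ : ∀ m → 1 ≤ q ^ m
  1≤q^ m = >-nonZero⁻¹ (q ^ m) {{m^n≢0 q m}}

  q^-mono-≤ : ∀ {m n} → m ≤ n → q ^ m ≤ q ^ n
  q^-mono-≤ = ^-monoʳ-≤ q

  q^-mono-< : ∀ {m n} → m < n → q ^ m < q ^ n
  q^-mono-< {m} {n} = ^-monoʳ-< q 2≤q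

  module RhoBound {k t r : ℕ} (r<t : r < t) (Π : SubspacePartition (suc k * t + r))
                  (t≤dim : ∀ i → t ≤ dim (part Π i)) where

    n = suc k * t + r
    Q = q ^ t
    ρ = q ^ r
    T = ρ * sumRange k (λ i → q ^ (i * t))
    N = size Π

    1≤n : 1 ≤ n
    1≤n = ≤-trans (≤-trans (s≤s z≤n) r<t) (≤-trans (m≤m+n t (k * t)) (m≤m+n (t + k * t) r))

    -- A sample nonzero functional; any hyperplane yields the congruence |Π| ≡ 1 modulo Q.
    ones : Vec n
    ones _ = 1#

    ones≉0 : ¬ (ones ≈ᵛ 0ᵛ)
    ones≉0 e = absurd n 1≤n e
      where
      absurd : ∀ n → 1 ≤ n → ¬ (∀ (i : Fin n) → 1# ≈ 0#)
      absurd (suc n) _ e = 0≉1 (R.sym (e zero))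

    G′ = sum (λ i → q ^ (dim (part Π i) ∸ t) * annihilates ones (basis (part Π i)))

    N≡ : N ≡ 1 + Q * G′
    N≡ = trans (sym (trans (hyperplane-identity Π ones)
          (trans (cong (λ a → N + q ^ n * a) (𝟙-no (ones ≟ᵛ 0ᵛ) ones≉0)) (trans (cong (N +_) (*-zeroʳ (q ^ n))) (+-identityʳ N)))))
        (trans (+-comm _ 1) (cong (1 +_) (trans (sum-cong divisible) (sum-*ˡ Q (λ i → q ^ (dim (part Π i) ∸ t) * annihilates ones (basis (part Π i)))))))
      where
      divisible : ∀ i → q ^ dim (part Π i) * annihilates ones (basis (part Π i))
                        ≡ Q * (q ^ (dim (part Π i) ∸ t) * annihilates ones (basis (part Π i)))
      divisible i = trans (cong (_* annihilates ones (basis (part Π i)))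
        (trans (cong (q ^_) (sym (m+[n∸m]≡n (t≤dim i)))) (^-distribˡ-+-* q t (dim (part Π i) ∸ t))))
        (*-assoc Q (q ^ (dim (part Π i) ∸ t)) _)

    volume-≤ : N * Q + 1 ≤ N + q ^ n
    volume-≤ = ≤-trans (+-monoˡ-≤ 1 (≤-trans (≤-reflexive (sym (sum-const N Q))) (sum-mono-≤ (λ i → q^-mono-≤ (t≤dim i)))))
                       (≤-reflexive (volume Π))

    -- If G′ = T + 1 + y, then N = 1 + QG′ and (Q - 1)N ≤ q^n - 1 = (Q - 1)QT + Qρ - 1 give Q² +
    -- Qy(Q - 1) ≤ Qρ, contradicting ρ < Q.
    G′≤T : G′ ≤ T
    G′≤T = ≮⇒≥ λ T<G′ → contradiction (too-large (m≤n⇒∃[o]m+o≡n T<G′)) (<-irrefl refl)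
      where
      open +-*-Solver
      too-large : (∃ λ y → suc T + y ≡ G′) → Q * Q < Q * Q
      too-large (y , e) = begin-strict
        Q * Q                           ≤⟨ m≤m+n (Q * Q) (Q * y * (Q ∸ 1)) ⟩
        Q * Q + Q * y * (Q ∸ 1)         ≤⟨ +-cancelʳ-≤ (Q * y + (1 + Q + Q * Q * T + Q * T)) _ _ bound ⟩
        Q * ρ                           <⟨ *-monoʳ-< Q {{m^n≢0 q t}} (q^-mono-< r<t) ⟩
        Q * Q                           ∎
        where
        open ≤-Reasoning
        bound : Q * Q + Q * y * (Q ∸ 1) + (Q * y + (1 + Q + Q * Q * T + Q * T)) ≤ Q * ρ + (Q * y + (1 + Q + Q * Q * T + Q * T))
        bound = begin
          Q * Q + Q * y * (Q ∸ 1) + (Q * y + (1 + Q + Q * Q * T + Q * T))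
            ≡⟨ solve 4 (λ Q y p T → Q :* Q :+ Q :* y :* p :+ (Q :* y :+ (con 1 :+ Q :+ Q :* Q :* T :+ Q :* T))
                 := Q :* Q :+ Q :* y :* (p :+ con 1) :+ (con 1 :+ Q :+ Q :* Q :* T :+ Q :* T)) refl Q y (Q ∸ 1) T ⟩
          Q * Q + Q * y * (Q ∸ 1 + 1) + (1 + Q + Q * Q * T + Q * T)
            ≡⟨ cong (λ a → Q * Q + Q * y * a + (1 + Q + Q * Q * T + Q * T)) (m∸n+n≡m (1≤q^ t)) ⟩
          Q * Q + Q * y * Q + (1 + Q + Q * Q * T + Q * T)
            ≡⟨ solve 3 (λ Q y T → Q :* Q :+ Q :* y :* Q :+ (con 1 :+ Q :+ Q :* Q :* T :+ Q :* T)
                 := (con 1 :+ Q :* (con 1 :+ T :+ y)) :* Q :+ con 1 :+ Q :* T) refl Q y T ⟩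
          (1 + Q * (suc T + y)) * Q + 1 + Q * T
            ≡⟨ cong (λ a → a * Q + 1 + Q * T) (trans (cong (λ a → 1 + Q * a) e) (sym N≡)) ⟩
          N * Q + 1 + Q * T
            ≤⟨ +-monoˡ-≤ (Q * T) volume-≤ ⟩
          N + q ^ n + Q * T
            ≡⟨ trans (+-assoc N _ _) (cong₂ _+_ (trans N≡ (cong (λ a → 1 + Q * a) (sym e))) (power-identity q k t r)) ⟩
          1 + Q * (suc T + y) + Q * (Q * T + ρ)
            ≡⟨ solve 4 (λ Q T y ρ → con 1 :+ Q :* (con 1 :+ T :+ y) :+ Q :* (Q :* T :+ ρ)
                 := Q :* ρ :+ (Q :* y :+ (con 1 :+ Q :+ Q :* Q :* T :+ Q :* T))) refl Q T y ρ ⟩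
          Q * ρ + (Q * y + (1 + Q + Q * Q * T + Q * T)) ∎

    size-≤ : N ≤ q ^ (t + r) * sumRange k (λ i → q ^ (i * t)) + 1
    size-≤ = begin
      N            ≡⟨ N≡ ⟩
      1 + Q * G′   ≤⟨ s≤s (*-monoʳ-≤ Q G′≤T) ⟩
      1 + Q * T    ≡⟨ +-comm 1 (Q * T) ⟩
      Q * T + 1    ≡⟨ cong (_+ 1) (trans (sym (*-assoc Q ρ _)) (cong (_* sumRange k (λ i → q ^ (i * t))) (sym (^-distribˡ-+-* q t r)))) ⟩
      q ^ (t + r) * sumRange k (λ i → q ^ (i * t)) + 1 ∎
      where open ≤-Reasoning

  largest-below : ∀ {N} (d : Fin N → ℕ) m → (∀ i → ¬ (d i < m)) ⊎ ∃ λ i → d i < m × (∀ j → d j < m → d j ≤ d i)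
  largest-below d zero = inj₁ λ i ()
  largest-below d (suc m) with Fin.any? (λ i → d i ℕ.≟ m)
  ... | yes (i , di≡m) = inj₂ (i , s≤s (≤-reflexive di≡m) , λ j dj≤m → ≤-trans (s≤s⁻¹ dj≤m) (≤-reflexive (sym di≡m)))
  ... | no none with largest-below d m
  ...   | inj₁ empty         = inj₁ λ i di≤m → empty i (≤∧≢⇒< (s≤s⁻¹ di≤m) λ e → none (i , e))
  ...   | inj₂ (i , lt , ub) = inj₂ (i , m<n⇒m<1+n lt , λ j dj≤m → ub j (≤∧≢⇒< (s≤s⁻¹ dj≤m) λ e → none (j , e)))

  module SigmaBound {k t r : ℕ} (1≤r : 1 ≤ r) (r<t : r < t) (Π : SubspacePartition (suc k * t + r))
                    (dim≤t : ∀ i → dim (part Π i) ≤ t) where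

    n = suc k * t + r
    Q = q ^ t
    ρ = q ^ r
    R₀ = ρ * sumRange k (λ i → q ^ (i * t))
    X = q ^ (k * t + r)
    N = size Π

    d : Fin N → ℕ
    d i = dim (part Π i)

    z : Fin N → Vec n → ℕ
    z i φ = annihilates φ (basis (part Π i))

    -- τ marks the tail, and f φ is the part of the hyperplane sum of φ that comes from the tail.
    small? : ∀ i → Dec (d i < t)
    small? i = d i <? t

    τ τ̅ : Fin N → ℕ
    τ i = 𝟙 (small? i)
    τ̅ i = 𝟙 (¬? (small? i))

    f C : Vec n → ℕ
    f φ = sum (λ i → τ i * (q ^ d i * z i φ))
    C φ = sum (λ i → τ̅ i * z i φ)

    T S : ℕ
    T = sum τ
    S = sum (λ i → τ i * q ^ d i)

    q^n≡ : q ^ n ≡ Q * X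
    q^n≡ = trans (cong (q ^_) (+-assoc t (k * t) r)) (^-distribˡ-+-* q t (k * t + r))

    power : q ^ n + Q * R₀ ≡ Q * (Q * R₀ + ρ)
    power = power-identity q k t r

    private
      split-term : ∀ i x → q ^ d i * x ≡ τ i * (q ^ d i * x) + Q * (τ̅ i * x)
      split-term i x with small? i
      ... | yes _   = sym (trans (cong₂ _+_ (*-identityˡ _) (*-zeroʳ Q)) (+-identityʳ _))
      ... | no  d≮t = cong₂ _*_ (cong (q ^_) (≤-antisym (dim≤t i) (≮⇒≥ d≮t))) (sym (*-identityˡ x))

    T+T̅≡N : T + sum τ̅ ≡ N
    T+T̅≡N = trans (sym (sum-+ τ τ̅)) (trans (sum-cong one) (trans (sum-const N 1) (*-identityʳ N)))
      where
      one : ∀ i → τ i + τ̅ i ≡ 1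
      one i with small? i
      ... | yes _ = refl
      ... | no  _ = refl

    G-split : ∀ (x : Fin N → ℕ) → sum (λ i → q ^ d i * x i) ≡ sum (λ i → τ i * (q ^ d i * x i)) + Q * sum (λ i → τ̅ i * x i)
    G-split x = trans (sum-cong (λ i → split-term i (x i)))
      (trans (sum-+ (λ i → τ i * (q ^ d i * x i)) _) (cong (sum (λ i → τ i * (q ^ d i * x i)) +_) (sum-*ˡ Q (λ i → τ̅ i * x i))))

    tail-volume : S + Q * sum τ̅ + 1 ≡ N + q ^ n
    tail-volume = trans (cong (_+ 1) (begin
      S + Q * sum τ̅
        ≡⟨ cong₂ (λ a b → a + Q * b) (sum-cong (λ i → cong (τ i *_) (sym (*-identityʳ (q ^ d i))))) (sum-cong (λ i → sym (*-identityʳ (τ̅ i)))) ⟩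
      sum (λ i → τ i * (q ^ d i * 1)) + Q * sum (λ i → τ̅ i * 1)
        ≡⟨ G-split (λ _ → 1) ⟨
      sum (λ i → q ^ d i * 1)
        ≡⟨ sum-cong (λ i → *-identityʳ (q ^ d i)) ⟩
      sum (λ i → q ^ d i) ∎)) (volume Π)
      where open ≡-Reasoning

    2≤ρ : 2 ≤ ρ
    2≤ρ = ≤-trans 2≤q (≤-trans (≤-reflexive (sym (*-identityʳ q))) (q^-mono-≤ 1≤r))

    QR<N : Q * R₀ < N
    QR<N = volume-lower {Q} {ρ} {R₀} {N} {q ^ n} power
      (≤-trans (≤-reflexive (sym (volume Π)))
        (+-monoˡ-≤ 1 (≤-trans (sum-mono-≤ (λ i → q^-mono-≤ (dim≤t i))) (≤-reflexive (trans (sum-const N Q) (*-comm N Q))))))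
      (1≤q^ t) (≤-trans 2≤ρ (≤-trans (≤-reflexive (sym (*-identityˡ ρ))) (*-monoˡ-≤ ρ (1≤q^ t))))

    module Excess {δ : ℕ} (N≡ : 1 + Q * R₀ + δ ≡ N) (δ<Q : δ < Q) where

      open +-*-Solver

      -- Members of dimension t contribute multiples of Q to the hyperplane sum, and Q divides q^n;
      -- so f φ ≡ δ modulo Q for every φ, zero included.
      residue : ∀ φ → f φ + Q * C φ ≡ δ + Q * (R₀ + X * 𝟙 (φ ≟ᵛ 0ᵛ))
      residue φ = +-cancelʳ-≡ 1 _ _ (begin
        f φ + Q * C φ + 1
          ≡⟨ cong (_+ 1) (G-split (λ i → z i φ)) ⟨
        sum (λ i → q ^ d i * z i φ) + 1
          ≡⟨ hyperplane-identity Π φ ⟩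
        N + q ^ n * 𝟙 (φ ≟ᵛ 0ᵛ)
          ≡⟨ cong₂ (λ a b → a + b * 𝟙 (φ ≟ᵛ 0ᵛ)) (sym N≡) q^n≡ ⟩
        1 + Q * R₀ + δ + Q * X * 𝟙 (φ ≟ᵛ 0ᵛ)
          ≡⟨ solve 5 (λ Q R δ X z → con 1 :+ Q :* R :+ δ :+ Q :* X :* z := δ :+ Q :* (R :+ X :* z) :+ con 1) refl Q R₀ δ X (𝟙 (φ ≟ᵛ 0ᵛ)) ⟩
        δ + Q * (R₀ + X * 𝟙 (φ ≟ᵛ 0ᵛ)) + 1 ∎)
        where open ≡-Reasoning

      δ≤f : ∀ φ → δ ≤ f φ
      δ≤f φ = residue-≤ Q (f φ) (C φ) δ _ δ<Q (residue φ)

      -- The volume identity after N and the number of members of dimension t have been eliminated: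
      -- a relation between the tail and δ alone.
      star : S + Q + Q * δ ≡ δ + Q * ρ + Q * T
      star = +-cancelʳ-≡ (Q * sum τ̅ + 1 + Q * R₀ + Q * (Q * R₀)) _ _ (begin
        S + Q + Q * δ + (Q * sum τ̅ + 1 + Q * R₀ + Q * (Q * R₀))
          ≡⟨ solve 5 (λ S Q δ t R → S :+ Q :+ Q :* δ :+ (Q :* t :+ con 1 :+ Q :* R :+ Q :* (Q :* R))
               := (S :+ Q :* t :+ con 1) :+ Q :* R :+ Q :* (con 1 :+ Q :* R :+ δ)) refl S Q δ (sum τ̅) R₀ ⟩
        (S + Q * sum τ̅ + 1) + Q * R₀ + Q * (1 + Q * R₀ + δ)
          ≡⟨ cong₂ (λ a b → a + Q * R₀ + Q * b) tail-volume (trans N≡ (sym T+T̅≡N)) ⟩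
        (N + q ^ n) + Q * R₀ + Q * (T + sum τ̅)
          ≡⟨ cong (_+ Q * (T + sum τ̅)) (trans (+-assoc N (q ^ n) (Q * R₀)) (cong₂ _+_ (sym N≡) power)) ⟩
        (1 + Q * R₀ + δ) + Q * (Q * R₀ + ρ) + Q * (T + sum τ̅)
          ≡⟨ solve 6 (λ Q R δ ρ T t → (con 1 :+ Q :* R :+ δ) :+ Q :* (Q :* R :+ ρ) :+ Q :* (T :+ t)
               := δ :+ Q :* ρ :+ Q :* T :+ (Q :* t :+ con 1 :+ Q :* R :+ Q :* (Q :* R))) refl Q R₀ δ ρ T (sum τ̅) ⟩
        δ + Q * ρ + Q * T + (Q * sum τ̅ + 1 + Q * R₀ + Q * (Q * R₀)) ∎)
        where open ≡-Reasoning

      -- An empty tail makes f vanish, so δ = 0, and `star` collapses to Q = Qρ, although ρ ≥ 2.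
      -- Here 1 ≤ r is decisive: for r = 0 there are partitions with all members of dimension t.
      tail-nonempty : ¬ (∀ i → ¬ (d i < t))
      tail-nonempty none = contradiction (*-cancelˡ-≡ 1 ρ Q {{m^n≢0 q t}} (trans (*-identityʳ Q) Q≡Qρ)) (<⇒≢ 2≤ρ)
        where
        δ≡0 : δ ≡ 0
        δ≡0 = n≤0⇒n≡0 (≤-trans (δ≤f 0ᵛ) (≤-reflexive (sum-none small? (λ i → q ^ d i * z i 0ᵛ) none)))
        Q≡Qρ : Q ≡ Q * ρ
        Q≡Qρ = begin
          Q                        ≡⟨ trans (+-identityʳ _) (cong (λ a → a + Q) (sum-none small? (λ i → q ^ d i) none)) ⟨
          S + Q + 0                ≡⟨ cong (S + Q +_) (trans (cong (Q *_) δ≡0) (*-zeroʳ Q)) ⟨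
          S + Q + Q * δ            ≡⟨ star ⟩
          δ + Q * ρ + Q * T        ≡⟨ cong₂ (λ a b → a + Q * ρ + b) δ≡0 (trans (cong (Q *_) (count-none small? none)) (*-zeroʳ Q)) ⟩
          Q * ρ + 0                ≡⟨ +-identityʳ _ ⟩
          Q * ρ                    ∎
          where open ≡-Reasoning

      module Largest (i₀ : Fin N) (small₀ : d i₀ < t) (largest : ∀ j → d j < t → d j ≤ d i₀) where

        u : ℕ
        u = q ^ d i₀

        S≤uT : S ≤ u * T
        S≤uT = ≤-trans (sum-mono-≤ bound) (≤-reflexive (trans (sum-*ʳ u τ) (*-comm T u)))
          where
          bound : ∀ i → τ i * q ^ d i ≤ τ i * u
          bound i with small? i
          ... | yes s = *-monoʳ-≤ 1 (q^-mono-≤ (largest i s))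
          ... | no  _ = z≤n

        -- A tail member W has weight q^(dim W) on q^(n-dim W) functionals, so it contributes q^n
        -- whatever its dimension.
        total : sumᵛ f ≡ T * q ^ n
        total = begin
          sumᵛ f
            ≡⟨ sum-swap (λ x i → τ i * (q ^ d i * z i (vec x))) ⟩
          sum (λ i → sumᵛ (λ φ → τ i * (q ^ d i * z i φ)))
            ≡⟨ sum-cong (λ i → trans (sum-*ˡ (τ i) (λ x → q ^ d i * z i (vec x))) (cong (τ i *_)
                 (trans (sum-*ˡ (q ^ d i) (λ x → z i (vec x))) (count-annihilators (basis (part Π i)) (indep (part Π i)))))) ⟩
          sum (λ i → τ i * q ^ n)
            ≡⟨ sum-*ʳ (q ^ n) τ ⟩
          T * q ^ n ∎
          where open ≡-Reasoning

        z-idem : ∀ i φ → z i φ * z i φ ≡ z i φ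
        z-idem i φ with pairing φ (basis (part Π i)) ≟ᵛ 0ᵛ
        ... | yes _ = refl
        ... | no  _ = refl

        joint : Fin N → ℕ
        joint i = u * (q ^ d i * sumᵛ (λ φ → z i₀ φ * z i φ))

        u-count : u * sumᵛ (z i₀) ≡ q ^ n
        u-count = count-annihilators (basis (part Π i₀)) (indep (part Π i₀))

        J : ℕ
        J = sumᵛ (λ φ → z i₀ φ * f φ)

        uJ≡ : u * J ≡ sum (λ i → τ i * joint i)
        uJ≡ = begin
          u * J
            ≡⟨ cong (u *_) (sum-cong (λ x → sym (sum-*ˡ (z i₀ (vec x)) (λ i → τ i * (q ^ d i * z i (vec x)))))) ⟩
          u * sumᵛ (λ φ → sum (λ i → z i₀ φ * (τ i * (q ^ d i * z i φ))))
            ≡⟨ cong (u *_) (sum-swap (λ x i → z i₀ (vec x) * (τ i * (q ^ d i * z i (vec x))))) ⟩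
          u * sum (λ i → sumᵛ (λ φ → z i₀ φ * (τ i * (q ^ d i * z i φ))))
            ≡⟨ cong (u *_) (sum-cong (λ i → trans
                 (sum-cong (λ x → solve 4 (λ a b c e → a :* (b :* (c :* e)) := b :* (c :* (a :* e))) refl (z i₀ (vec x)) (τ i) (q ^ d i) (z i (vec x))))
                 (trans (sum-*ˡ (τ i) (λ x → q ^ d i * (z i₀ (vec x) * z i (vec x))))
                   (cong (τ i *_) (sum-*ˡ (q ^ d i) (λ x → z i₀ (vec x) * z i (vec x))))))) ⟩
          u * sum (λ i → τ i * (q ^ d i * sumᵛ (λ φ → z i₀ φ * z i φ)))
            ≡⟨ sum-*ˡ u (λ i → τ i * (q ^ d i * sumᵛ (λ φ → z i₀ φ * z i φ))) ⟨
          sum (λ i → u * (τ i * (q ^ d i * sumᵛ (λ φ → z i₀ φ * z i φ))))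
            ≡⟨ sum-cong (λ i → solve 3 (λ u a b → u :* (a :* b) := a :* (u :* b)) refl u (τ i) (q ^ d i * sumᵛ (λ φ → z i₀ φ * z i φ))) ⟩
          sum (λ i → τ i * joint i) ∎
          where open ≡-Reasoning

        -- To uJ every tail member other than U = `part Π i₀` contributes q^n, by independence,
        -- whereas U contributes uq^n; the q^n on the left fills the place of U in Tq^n.
        average : u * J + q ^ n ≡ T * q ^ n + u * q ^ n
        average = begin
          u * J + q ^ n
            ≡⟨ cong₂ _+_ uJ≡ (sym (trans (sum-unique (Fin._≟ i₀) (λ i → τ i * q ^ n) i₀ refl (λ _ e → e)) τ₀*)) ⟩
          sum (λ i → τ i * joint i) + sum (λ i → 𝟙 (i Fin.≟ i₀) * (τ i * q ^ n))
            ≡⟨ sum-+ (λ i → τ i * joint i) _ ⟨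
          sum (λ i → τ i * joint i + 𝟙 (i Fin.≟ i₀) * (τ i * q ^ n))
            ≡⟨ sum-cong termwise ⟩
          sum (λ i → τ i * q ^ n + 𝟙 (i Fin.≟ i₀) * (τ i * (u * q ^ n)))
            ≡⟨ sum-+ (λ i → τ i * q ^ n) _ ⟩
          sum (λ i → τ i * q ^ n) + sum (λ i → 𝟙 (i Fin.≟ i₀) * (τ i * (u * q ^ n)))
            ≡⟨ cong₂ _+_ (sum-*ʳ (q ^ n) τ) (trans (sum-unique (Fin._≟ i₀) (λ i → τ i * (u * q ^ n)) i₀ refl (λ _ e → e)) τ₀*) ⟩
          T * q ^ n + u * q ^ n ∎
          where
          open ≡-Reasoning
          τ₀* : ∀ {x} → τ i₀ * x ≡ x
          τ₀* {x} = trans (cong (_* x) (𝟙-yes (small? i₀) small₀)) (*-identityˡ x)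
          termwise : ∀ i → τ i * joint i + 𝟙 (i Fin.≟ i₀) * (τ i * q ^ n) ≡ τ i * q ^ n + 𝟙 (i Fin.≟ i₀) * (τ i * (u * q ^ n))
          termwise i with i Fin.≟ i₀
          ... | yes refl = trans (cong₂ _+_ (cong (τ i *_) joint₀) (*-identityˡ _)) (trans (+-comm _ (τ i * q ^ n)) (cong (τ i * q ^ n +_) (sym (*-identityˡ _))))
            where
            joint₀ : joint i₀ ≡ u * q ^ n
            joint₀ = cong (u *_) (trans (cong (u *_) (sum-cong (λ x → z-idem i₀ (vec x)))) u-count)
          ... | no i≢i₀ = cong (_+ 0) (cong (τ i *_) (count-joint-annihilators Π i₀ i (i≢i₀ ∘ sym)))

        -- Average of f over the functionals that do not vanish on the largest tail member.
        δ+1≤T : δ + 1 ≤ T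
        δ+1≤T = *-cancelʳ-≤ (δ + 1) T (u ∸ 1) {{>-nonZero (m<n⇒0<n∸m 2≤u)}} (+-cancelʳ-≤ (δ + 1 + T) _ _ (begin
          (δ + 1) * (u ∸ 1) + (δ + 1 + T)
            ≡⟨ solve 3 (λ δ p T → (δ :+ con 1) :* p :+ (δ :+ con 1 :+ T) := δ :* (p :+ con 1) :+ T :+ (p :+ con 1)) refl δ (u ∸ 1) T ⟩
          δ * (u ∸ 1 + 1) + T + (u ∸ 1 + 1)
            ≡⟨ cong (λ a → δ * a + T + a) (m∸n+n≡m (1≤q^ (d i₀))) ⟩
          δ * u + T + u
            ≤⟨ *-cancelʳ-≤ _ _ (q ^ n) {{m^n≢0 q n}} scaled ⟩
          T * u + δ + 1
            ≡⟨ cong (λ a → T * a + δ + 1) (m∸n+n≡m (1≤q^ (d i₀))) ⟨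
          T * (u ∸ 1 + 1) + δ + 1
            ≡⟨ solve 3 (λ δ p T → T :* (p :+ con 1) :+ δ :+ con 1 := T :* p :+ (δ :+ con 1 :+ T)) refl δ (u ∸ 1) T ⟩
          T * (u ∸ 1) + (δ + 1 + T) ∎))
          where
          open ≤-Reasoning
          2≤u : 1 < u
          2≤u = ≤-trans 2≤q (≤-trans (≤-reflexive (sym (*-identityʳ q))) (q^-mono-≤ (nonzero Π i₀)))
          -- This is (1 - z)δ ≤ (1 - z)f, multiplied out. Summed over φ and combined with `average`
          -- it becomes (u - 1)δ ≤ (u - 1)(T - 1).
          pointwise : ∀ φ → δ + z i₀ φ * f φ ≤ f φ + z i₀ φ * δ
          pointwise φ with pairing φ (basis (part Π i₀)) ≟ᵛ 0ᵛ
          ... | yes _ = ≤-reflexive (trans (cong (δ +_) (*-identityˡ (f φ))) (trans (+-comm δ (f φ)) (cong (f φ +_) (sym (*-identityˡ δ)))))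
          ... | no  _ = ≤-trans (≤-reflexive (+-identityʳ δ)) (≤-trans (δ≤f φ) (m≤m+n (f φ) 0))
          summed : q ^ n * δ + J ≤ T * q ^ n + sumᵛ (z i₀) * δ
          summed = begin
            q ^ n * δ + J
              ≡⟨ trans (cong (_+ J) (sym (sum-const (q ^ n) δ))) (sym (sum-+ (λ _ → δ) (λ x → z i₀ (vec x) * f (vec x)))) ⟩
            sumᵛ {n} (λ φ → δ + z i₀ φ * f φ)
              ≤⟨ sum-mono-≤ (λ x → pointwise (vec x)) ⟩
            sumᵛ {n} (λ φ → f φ + z i₀ φ * δ)
              ≡⟨ trans (sum-+ (λ x → f (vec x)) (λ x → z i₀ (vec x) * δ)) (cong₂ _+_ total (sum-*ʳ δ (λ x → z i₀ (vec x)))) ⟩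
            T * q ^ n + sumᵛ (z i₀) * δ ∎
          scaled : (δ * u + T + u) * q ^ n ≤ (T * u + δ + 1) * q ^ n
          scaled = begin
            (δ * u + T + u) * q ^ n
              ≡⟨ solve 4 (λ δ u T n → (δ :* u :+ T :+ u) :* n := u :* (n :* δ) :+ (T :* n :+ u :* n)) refl δ u T (q ^ n) ⟩
            u * (q ^ n * δ) + (T * q ^ n + u * q ^ n)
              ≡⟨ cong (u * (q ^ n * δ) +_) average ⟨
            u * (q ^ n * δ) + (u * J + q ^ n)
              ≡⟨ solve 4 (λ u a b n → u :* a :+ (u :* b :+ n) := u :* (a :+ b) :+ n) refl u (q ^ n * δ) J (q ^ n) ⟩
            u * (q ^ n * δ + J) + q ^ n
              ≤⟨ +-monoˡ-≤ (q ^ n) (*-monoʳ-≤ u summed) ⟩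
            u * (T * q ^ n + sumᵛ (z i₀) * δ) + q ^ n
              ≡⟨ solve 5 (λ u T n s δ → u :* (T :* n :+ s :* δ) :+ n := u :* T :* n :+ u :* s :* δ :+ n) refl u T (q ^ n) (sumᵛ (z i₀)) δ ⟩
            u * T * q ^ n + u * sumᵛ (z i₀) * δ + q ^ n
              ≡⟨ cong (λ a → u * T * q ^ n + a * δ + q ^ n) u-count ⟩
            u * T * q ^ n + q ^ n * δ + q ^ n
              ≡⟨ solve 4 (λ δ u T n → u :* T :* n :+ n :* δ :+ n := (T :* u :+ δ :+ con 1) :* n) refl δ u T (q ^ n) ⟩
            (T * u + δ + 1) * q ^ n ∎

        -- Average of f over the functionals that vanish on the largest tail member.
        δ+Q+1≤T+u : δ < u → δ + Q + 1 ≤ T + u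
        δ+Q+1≤T+u δ<u = *-cancelʳ-≤ _ _ (q ^ n) {{m^n≢0 q n}} (begin
          (δ + Q + 1) * q ^ n
            ≡⟨ solve 3 (λ δ Q n → (δ :+ Q :+ con 1) :* n := (δ :+ Q) :* n :+ n) refl δ Q (q ^ n) ⟩
          (δ + Q) * q ^ n + q ^ n
            ≡⟨ cong (λ a → (δ + Q) * a + q ^ n) u-count ⟨
          (δ + Q) * (u * sumᵛ (z i₀)) + q ^ n
            ≡⟨ cong (_+ q ^ n) (solve 3 (λ a u s → a :* (u :* s) := u :* (s :* a)) refl (δ + Q) u (sumᵛ (z i₀))) ⟩
          u * (sumᵛ (z i₀) * (δ + Q)) + q ^ n
            ≡⟨ cong (λ a → u * a + q ^ n) (sum-*ʳ (δ + Q) (λ x → z i₀ (vec x))) ⟨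
          u * sumᵛ (λ φ → z i₀ φ * (δ + Q)) + q ^ n
            ≤⟨ +-monoˡ-≤ (q ^ n) (*-monoʳ-≤ u (sum-mono-≤ (λ x → pointwise (vec x)))) ⟩
          u * J + q ^ n
            ≡⟨ average ⟩
          T * q ^ n + u * q ^ n
            ≡⟨ *-distribʳ-+ (q ^ n) T u ⟨
          (T + u) * q ^ n ∎)
          where
          open ≤-Reasoning
          -- If φ vanishes on U, then U alone contributes u > δ to f φ, and `residue-next` raises
          -- the bound to δ + Q.
          u≤f : ∀ φ → z i₀ φ ≡ 1 → u ≤ f φ
          u≤f φ z≡1 = ≤-trans
            (≤-reflexive (sym (trans (cong₂ (λ a b → a * (u * b)) (𝟙-yes (small? i₀) small₀) z≡1) (trans (*-identityˡ _) (*-identityʳ u)))))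
            (term≤sum (λ i → τ i * (q ^ d i * z i φ)) i₀)
          pointwise : ∀ φ → z i₀ φ * (δ + Q) ≤ z i₀ φ * f φ
          pointwise φ with pairing φ (basis (part Π i₀)) ≟ᵛ 0ᵛ | u≤f φ
          ... | yes _ | u≤ = *-monoʳ-≤ 1 (residue-next Q (f φ) (C φ) δ _ (residue φ) (≤-trans δ<u (u≤ refl)))
          ... | no  _ | _  = z≤n

        -- If δ < u, then 2u ≤ Q holds because dim U < t and q ≥ 2. Otherwise u ≤ δ < q^c forces dim
        -- U < c, and `half` gives δ < q^c ≤ q^(t+r-dim U), where the last power is Qρ/u.
        impossible : ∀ {c} → δ < q ^ c → (d i₀ < c → c + d i₀ ≤ t + r) → ⊥
        impossible {c} δ<q^c half with δ <? u
        ... | yes δ<u = tail-too-short {Q} {ρ} {T} {δ} {u} {S} star S≤uT (<⇒≤ 2≤ρ) (1≤q^ (d i₀))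
                          (≤-trans (*-monoˡ-≤ u 2≤q) (q^-mono-≤ small₀)) δ<u (δ+Q+1≤T+u δ<u)
        ... | no  δ≮u = tail-too-thin {Q} {ρ} {T} {δ} {u} {q ^ (t + r ∸ d i₀)} {S} star S≤uT Qρ≡ (q^-mono-≤ (<⇒≤ small₀))
                          (≤-trans (1≤q^ (d i₀)) u≤δ) (≤-trans δ<q^c (q^-mono-≤ (m+n≤o⇒m≤o∸n c c+d≤t+r))) δ+1≤T
          where
          u≤δ : u ≤ δ
          u≤δ = ≮⇒≥ δ≮u
          c+d≤t+r : c + d i₀ ≤ t + r
          c+d≤t+r = half (≰⇒> λ c≤d → <⇒≱ (≤-<-trans u≤δ δ<q^c) (q^-mono-≤ c≤d))
          Qρ≡ : Q * ρ ≡ u * q ^ (t + r ∸ d i₀)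
          Qρ≡ = trans (sym (^-distribˡ-+-* q t r)) (trans (cong (q ^_) (sym (m+[n∸m]≡n (≤-trans (<⇒≤ small₀) (m≤m+n t r)))))
                  (^-distribˡ-+-* q (d i₀) (t + r ∸ d i₀)))

    h : ℕ
    h = ⌈ t + r /2⌉

    h≤t : h ≤ t
    h≤t = ≤-trans (⌈n/2⌉-mono (+-monoʳ-≤ t (<⇒≤ r<t))) (≤-reflexive (sym (n≡⌈n+n/2⌉ t)))

    h+d≤t+r : ∀ {m} → m < h → h + m ≤ t + r
    h+d≤t+r {m} m<h = ≤-trans (+-monoʳ-≤ h (s≤s⁻¹ (≤-trans m<h ⌈⌉≤1+⌊⌋))) (≤-reflexive (trans (+-comm h _) (⌊n/2⌋+⌈n/2⌉≡n (t + r))))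
      where
      ⌈⌉≤1+⌊⌋ : h ≤ suc ⌊ t + r /2⌋
      ⌈⌉≤1+⌊⌋ = ⌊n/2⌋-mono (n≤1+n (suc (t + r)))

    size-≥ : q ^ (t + r) * sumRange k (λ i → q ^ (i * t)) + q ^ h + 1 ≤ N
    size-≥ with m≤n⇒∃[o]m+o≡n QR<N
    ... | δ , N≡ = ≮⇒≥ λ N<value → absurd (δ<q^h N<value)
      where
      M = sumRange k (λ i → q ^ (i * t))
      δ<q^h : N < q ^ (t + r) * M + q ^ h + 1 → δ < q ^ h
      δ<q^h N<value = +-cancelˡ-< (1 + Q * R₀) δ (q ^ h) (begin-strict
        1 + Q * R₀ + δ                ≡⟨ N≡ ⟩
        N                             <⟨ N<value ⟩
        q ^ (t + r) * M + q ^ h + 1   ≡⟨ cong (λ a → a + q ^ h + 1) (trans (cong (_* M) (^-distribˡ-+-* q t r)) (*-assoc Q ρ M)) ⟩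
        Q * R₀ + q ^ h + 1            ≡⟨ +-comm _ 1 ⟩
        1 + Q * R₀ + q ^ h            ∎)
        where open ≤-Reasoning
      absurd : ¬ (δ < q ^ h)
      absurd δ< with largest-below d t
      ... | inj₁ none                  = Excess.tail-nonempty N≡ (≤-trans δ< (q^-mono-≤ h≤t)) none
      ... | inj₂ (i₀ , small , largest) =
        Excess.Largest.impossible N≡ (≤-trans δ< (q^-mono-≤ h≤t)) i₀ small largest {h} δ< h+d≤t+r

-- The values of ρ and σ, where construction and bound meet

theorem1 : ∀ {c ℓ} (F : FiniteField c ℓ) (n k t r : ℕ) →
    r < t → 2 ≤ k → n ≡ k * t + r →
    VectorSpace.IsRho F n t (rhoValue (FiniteField.q F) k t r)
    × (1 ≤ r → VectorSpace.IsSigma F n t (sigmaValue (FiniteField.q F) k t r))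
theorem1 F n (suc (suc k)) t r r<t (s≤s (s≤s _)) refl =
  (rho-partition , λ Π (t≤dim , _) → RhoBound.size-≤ {suc k} r<t Π t≤dim) ,
  λ 1≤r → sigma-partition 1≤r , λ Π (dim≤t , _) → SigmaBound.size-≥ {suc k} 1≤r r<t Π dim≤t
  where
  open Vectors F
  open Construction F
  open Bounds F

  1≤t : 1 ≤ t
  1≤t = ≤-trans (s≤s z≤n) r<t

  -- `suc k` extensions by t lead from dimension t + r to n.
  arrange : suc k * t + (t + r) ≡ suc (suc k) * t + r
  arrange = trans (sym (+-assoc (suc k * t) t r)) (cong (_+ r) (+-comm (suc k * t) t))

  rho-partition : Σ (SubspacePartition (suc (suc k) * t + r)) λ Π →
                  MinDim Π t × size Π ≡ rhoValue q (suc (suc k)) t r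
  rho-partition =
    let (Π , size≡ , t≤ , has) = iterate-extend 1≤t (t ≤_) ≤-refl
          (trivialPartition (≤-trans 1≤t (m≤m+n t r))) (λ _ → m≤m+n t r) (suc k)
    in subst (λ n → Σ (SubspacePartition n) λ Π → MinDim Π t × size Π ≡ rhoValue q (suc (suc k)) t r)
             arrange (Π , (t≤ , has (s≤s z≤n)) , size≡)

  sigma-partition : 1 ≤ r → Σ (SubspacePartition (suc (suc k) * t + r)) λ Π →
                    MaxDim Π t × size Π ≡ sigmaValue q (suc (suc k)) t r
  sigma-partition 1≤r =
    let (Π₀ , size₀ , _ , dims) = extend {h} {l} 1≤l (⌊n/2⌋≤⌈n/2⌉ (t + r)) (trivialPartition (≤-trans 1≤l (⌊n/2⌋≤⌈n/2⌉ (t + r))))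
        (Π₁ , size₁ , bounded) = subst (λ m → Σ (SubspacePartition m) λ Π → size Π ≡ q ^ h + 1 × (∀ i → dim (part Π i) ≤ t))
                                       (⌊n/2⌋+⌈n/2⌉≡n (t + r)) (Π₀ , size₀ , λ i → small (dims i))
        (Π , size≡ , ≤t , has) = iterate-extend 1≤t (_≤ t) ≤-refl Π₁ bounded (suc k)
    in subst (λ n → Σ (SubspacePartition n) λ Π → MaxDim Π t × size Π ≡ sigmaValue q (suc (suc k)) t r)
             arrange (Π , (≤t , has (s≤s z≤n)) , trans size≡ (trans (cong (_ +_) size₁) (sym (+-assoc _ (q ^ h) 1))))
    where
    h l : ℕ
    h = ⌈ t + r /2⌉
    l = ⌊ t + r /2⌋
    -- 1 ≤ r < t gives t + r ≥ 2, so even the smaller half is a nonzero dimension.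
    1≤l : 1 ≤ l
    1≤l = ⌊n/2⌋-mono (≤-trans (s≤s 1≤r) (≤-trans r<t (m≤m+n t r)))
    h≤t : h ≤ t
    h≤t = ≤-trans (⌈n/2⌉-mono (+-monoʳ-≤ t (<⇒≤ r<t))) (≤-reflexive (sym (n≡⌈n+n/2⌉ t)))
    small : ∀ {x} → x ≡ l ⊎ ∃ (λ (j : Fin 1) → x ≡ h) → x ≤ t
    small (inj₁ refl)       = ≤-trans (⌊n/2⌋≤⌈n/2⌉ (t + r)) h≤t
    small (inj₂ (_ , refl)) = h≤t
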